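{- Let $m\ge 1$ be an integer and $0<\varepsilon\le 1$. For the problem $P_m|\varepsilon,\mathrm{online},pmtn|\sum p_j(1-U_j)$ (online maximization of total accepted processing time on $m$ parallel identical machines, with preemption and migration, commitment on acceptance, and slack factor $\varepsilon$) there is a deterministic online algorithm with strict competitive ratio at most $$m\cdot(1+\varepsilon)\cdot\left(\left(\frac{1+\varepsilon}{\varepsilon}\right)^{\frac1m}-1\right).$$
   Context: Problem. There are $m$ parallel identical machines and a finite sequence $\mathcal{J}$ of jobs. Job $J_j$ has release (submission) date $r_j\ge 0$, processing time $p_j>0$ and deadline $d_j$ satisfying the slack condition $d_j-r_j\ge(1+\varepsilon)p_j$. The sequence is ordered so that $J_i$ precedes $J_j$ whenever $r_i<r_j$ (several jobs may have the same release date). Jobs are revealed in sequence order; job $J_j$ becomes known at time $r_j$, and the online algorithm must decide immediately, before seeing any later job of the sequence, whether to accept it ($U_j=0$) or reject it ($U_j=1$). The decision is irrevocable, and every accepted job must be processed completely within $[r_j,d_j]$. Preemption: a job in execution may be interrupted at any time and resumed immediately or later, possibly on a different machine, without penalty; at any time a machine processes at most one job and a job is processed on at most one machine. The online algorithm may choose and modify the future schedule of accepted jobs over time, provided all accepted jobs meet their deadlines. The objective is to maximize $\sum_j p_j(1-U_j)$. Let $\mathrm{ALG}(\mathcal{J})$ be the objective value of the online algorithm and $\mathrm{OPT}(\mathcal{J})$ the optimal offline value, i.e. the maximum total processing time of a subset of the jobs of $\mathcal{J}$ that has a preemptive schedule (with migration) on $m$ machines completing each job of the subset between its release date and its deadline.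 The algorithm has strict competitive ratio (at most) $c$ if $\mathrm{OPT}(\mathcal{J})\le c\cdot\mathrm{ALG}(\mathcal{J})$ for every job sequence $\mathcal{J}$ satisfying the slack condition. -}

module Defs where

open import Algebra.Bundles using (CommutativeRing; Semiring)
import Algebra.Definitions.RawSemiring as RawSemiringDefinitions
open import Algebra.Structures using (IsCommutativeRing)
open import Data.Bool.Base using (Bool; if_then_else_)
open import Data.Fin.Base using (Fin; toℕ)
open import Data.Fin.Subset using (Subset; _∈_)
open import Data.List.Base
  using (List; _∷ʳ_; length; lookup; take; map; filter; foldr)
open import Data.List.Relation.Unary.All using (All)
open import Data.List.Relation.Unary.Any using (Any)
open import Data.List.Relation.Unary.AllPairs using (AllPairs)
open import Data.Nat.Base using (ℕ)
import Data.Nat.Properties as ℕ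
open import Data.Product.Base using (∃; ∃-syntax; _×_)
open import Data.Sum.Base using (_⊎_)
import Data.Vec.Base as Vec
open import Function.Bundles using (_⇔_)
open import Level using (0ℓ)
import Relation.Binary.Construct.NonStrictToStrict as NonStrictToStrict
open import Relation.Binary.PropositionalEquality.Core using (_≡_; _≢_)
open import Relation.Binary.Structures using (IsDecTotalOrder)

-- The (classical) real numbers, given by their axioms as a
-- Dedekind-complete totally ordered field.  The value of _⁻¹ at 0# is
-- unspecified, as is the value of sup on sets that are empty or
-- unbounded above.

record Reals : Set₁ where
  infix  8 _⁻¹
  infixl 7 _*_
  infixl 6 _+_
  infix  4 _≤_
  field
    ℝ   : Set
    _+_ : ℝ → ℝ → ℝ
    _*_ : ℝ → ℝ → ℝ
    -_  : ℝ → ℝ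
    0#  : ℝ
    1#  : ℝ
    _⁻¹ : ℝ → ℝ
    _≤_ : ℝ → ℝ → Set
    sup : (ℝ → Set) → ℝ

  UpperBound : (ℝ → Set) → ℝ → Set
  UpperBound P b = ∀ x → P x → x ≤ b

  field
    isCommutativeRing : IsCommutativeRing _≡_ _+_ _*_ -_ 0# 1#
    0≢1               : 0# ≢ 1#
    ⁻¹-inverseʳ       : ∀ x → x ≢ 0# → x * x ⁻¹ ≡ 1#
    isDecTotalOrder   : IsDecTotalOrder _≡_ _≤_
    +-monoˡ-≤         : ∀ z {x y} → x ≤ y → x + z ≤ y + z
    *-nonNegative     : ∀ {x y} → 0# ≤ x → 0# ≤ y → 0# ≤ x * y
    sup-upper         : ∀ P → ∃ P → ∃ (UpperBound P) → UpperBound P (sup P)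
    sup-least         : ∀ P → ∃ P → ∀ b → UpperBound P b → sup P ≤ b

  commutativeRing : CommutativeRing 0ℓ 0ℓ
  commutativeRing = record { isCommutativeRing = isCommutativeRing }

  open NonStrictToStrict _≡_ _≤_ public using (_<_)

  private
    module S = RawSemiringDefinitions
      (Semiring.rawSemiring (CommutativeRing.semiring commutativeRing))

  open S public using (_^_; sum)

  infixl 7 _/_
  infixl 6 _-_

  _-_ : ℝ → ℝ → ℝ
  x - y = x + (- y)

  _/_ : ℝ → ℝ → ℝ
  x / y = x * y ⁻¹

  fromℕ : ℕ → ℝ
  fromℕ n = n S.× 1#

  -- x ^ (1 / m), meaningful for 0# ≤ x and m ≥ 1.
  root : ℕ → ℝ → ℝ
  root m x = sup (λ y → 0# ≤ y × y ^ m ≤ x)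

module Scheduling (ℛ : Reals) where
  open Reals ℛ public

  record Job : Set where
    field
      release  : ℝ
      time     : ℝ
      deadline : ℝ

  open Job public

  record ValidJob (ε : ℝ) (j : Job) : Set where
    field
      release≥0 : 0# ≤ release j
      time>0    : 0# < time j
      slack     : (1# + ε) * time j ≤ deadline j - release j

  record Admissible (ε : ℝ) (J : List Job) : Set where
    field
      valid   : All (ValidJob ε) J
      ordered : AllPairs (λ i j → release i ≤ release j) J

  value : (J : List Job) → Subset (length J) → ℝ
  value J S = sum λ k → if Vec.lookup S k then time (lookup J k) else 0#

  -- A job is identified by its position in the sequence, which does not
  -- change when the sequence is extended at the end.  A segment occupies
  -- its machine during the half-open interval [start, end).
  record Segment (m : ℕ) : Set where
    field
      machine : Fin m
      job     : ℕ
      start   : ℝ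
      end     : ℝ

  open Segment public

  -- Preemptive schedules with migration: a job may be split into finitely
  -- many segments, on arbitrary machines.
  Schedule : ℕ → Set
  Schedule m = List (Segment m)

  Disjoint : ∀ {m} → Segment m → Segment m → Set
  Disjoint s t = end s ≤ start t ⊎ end t ≤ start s

  NoConflict : ∀ {m} → Segment m → Segment m → Set
  NoConflict s t = machine s ≡ machine t ⊎ job s ≡ job t → Disjoint s t

  processed : ∀ {m} → Schedule m → ℕ → ℝ
  processed σ k =
    foldr _+_ 0# (map (λ s → end s - start s) (filter (λ s → job s ℕ.≟ k) σ))

  record SegmentFits {m} (J : List Job) (S : Subset (length J))
                     (s : Segment m) : Set where
    field
      index           : Fin (length J)
      index-job       : toℕ index ≡ job s
      selected        : index ∈ S
      after-release   : release (lookup J index) ≤ start s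
      start≤end       : start s ≤ end s
      before-deadline : end s ≤ deadline (lookup J index)

  record Schedules {m} (J : List Job) (S : Subset (length J))
                   (σ : Schedule m) : Set where
    field
      fits        : All (SegmentFits J S) σ
      no-conflict : AllPairs NoConflict σ
      complete    : ∀ k → k ∈ S → processed σ (toℕ k) ≡ time (lookup J k)

  -- The supremum is a maximum, since J has finitely many subsets.
  OPT : ℕ → List Job → ℝ
  OPT m J = sup λ v →
    ∃[ S ] (∃[ σ ] Schedules {m} J S σ) × v ≡ value J S

  Runs : ∀ {m} → Schedule m → Fin m → ℝ → ℕ → Set
  Runs σ i x k =
    Any (λ s → machine s ≡ i × job s ≡ k × start s ≤ x × x < end s) σ

  AgreeBefore : ∀ {m} → ℝ → Schedule m → Schedule m → Set
  AgreeBefore t σ τ = ∀ i x k → x < t → Runs σ i x k ⇔ Runs τ i x k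

  acceptedBy : (List Job → Job → Bool) → (J : List Job) → Subset (length J)
  acceptedBy accept J =
    Vec.tabulate λ k → accept (take (toℕ k) J) (lookup J k)

  -- accept past j is the irrevocable decision on j, the jobs of past having
  -- been revealed before it.  plan J is the complete schedule intended
  -- once exactly the jobs of J have been revealed; when a further job
  -- arrives, it may be changed only from that job's release date onwards.
  record OnlineAlgorithm (m : ℕ) (ε : ℝ) : Set where
    field
      accept        : List Job → Job → Bool
      plan          : List Job → Schedule m
      plan-feasible : ∀ J → Admissible ε J →
                      Schedules J (acceptedBy accept J) (plan J)
      plan-online   : ∀ J j → Admissible ε (J ∷ʳ j) →
                      AgreeBefore (release j) (plan J) (plan (J ∷ʳ j))

    accepted : (J : List Job) → Subset (length J)
    accepted = acceptedBy accept

    ALG : List Job → ℝ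
    ALG J = value J (accepted J)

  StrictCompetitiveRatio : ∀ {m ε} → OnlineAlgorithm m ε → ℝ → Set
  StrictCompetitiveRatio {m} {ε} A c =
    ∀ J → Admissible ε J → OPT m J ≤ c * OnlineAlgorithm.ALG A J

module Submission where

-- The algorithm maintains a threshold h ≥ t and rejects a job exactly if its
-- deadline precedes h.  Let f be the m-th root of (1 + ε) / ε, q = 1 / f and
-- c = q + ⋯ + qᵐ, and let V D be the volume of the work that cannot be put
-- off beyond D.  Accepting a job raises h to the last point D at which
-- V D − V h ≥ c (D − h), and h = t is raised to a deadline D as soon as
-- V D = c (D − t).  While t < h, only jobs that have to be resumed before h
-- are processed, in the order of the times at which they have to be.  The
-- slack of the jobs ensures V D ≤ k (D − t) + (q^(k+1) + ⋯ + qᵐ) (h − t) for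
-- t ≤ D ≤ h and k ≤ m; for k = m this means that all accepted jobs can be
-- completed.
--
-- The intervals [t, h) of total length u are paid for by work of volume c u,
-- and any other schedule does at most m u in them, where m ≤ R c for the
-- claimed ratio R.  Outside of them h = t, all jobs are accepted and the
-- machines work by earliest deadlines.  A potential argument shows that any
-- other schedule then does at most 18 / 13 times as much, and 18 / 13 ≤ R.

open import Algebra.Bundles using (CommutativeRing; RawRing)
import Algebra.Properties.Ring as RingProperties
import Algebra.Solver.Ring as RingSolver
open import Algebra.Solver.Ring.AlmostCommutativeRing
  using (AlmostCommutativeRing; fromCommutativeRing; _-Raw-AlmostCommutative⟶_)
open import Data.Bool.Base using (Bool; true; false; if_then_else_; _∧_; _∨_; not; T)
import Data.Bool.Properties as Bool
open import Data.Empty using (⊥)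
open import Data.Fin.Base as Fin using (Fin; toℕ)
import Data.Fin.Properties as Fin
open import Data.Fin.Subset using (Subset) renaming (_∈_ to _∈ₛ_)
open import Data.Integer.Base as ℤ using (ℤ; -[1+_]) renaming (+_ to pos)
import Data.Integer.Properties as ℤ
open import Data.List.Base
  using (List; []; _∷_; _++_; _∷ʳ_; _ʳ++_; allFin; cartesianProduct; foldl
        ; length; lookup; map; reverse; tabulate; take)
open import Data.List.Membership.Propositional using (_∈_)
open import Data.List.Membership.Propositional.Properties
  using (∈-++⁻; ∈-allFin; ∈-cartesianProduct⁺; ∈-cartesianProduct⁻; ∈-lookup
        ; ∈-map⁺; ∈-map⁻; ∈-tabulate⁺; ∈-tabulate⁻)
open import Data.List.Properties
  using (++-assoc; ++-identityʳ; foldl-∷ʳ; length-++; length-tabulate; tabulate-cong)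
open import Data.List.Relation.Unary.All as All using (All; []; _∷_)
import Data.List.Relation.Unary.All.Properties as All
open import Data.List.Relation.Unary.AllPairs as AllPairs using (AllPairs; []; _∷_)
import Data.List.Relation.Unary.AllPairs.Properties as AllPairs
open import Data.List.Relation.Unary.Any using (here; there)
import Data.List.Relation.Unary.Any.Properties as Any
open import Data.List.Relation.Unary.Unique.Propositional using (Unique)
open import Data.List.Relation.Unary.Unique.Propositional.Properties using (allFin⁺)
open import Data.Maybe.Base using (Maybe; just; nothing)
open import Data.Nat.Base as ℕ using (ℕ; zero; suc; s≤s; z≤n)
import Data.Nat.Properties as ℕ
open import Data.Nat.Solver using (module +-*-Solver)
open import Data.Product.Base
  using (Σ; Σ-syntax; ∃; ∃-syntax; _×_; _,_; proj₁; proj₂)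
open import Data.Sum.Base using (_⊎_; inj₁; inj₂)
open import Data.Unit.Base using (tt)
open import Data.Vec.Base as Vec using (Vec; []; _∷_)
open import Data.Vec.N-ary using (N-ary; curryⁿ; _$ⁿ_; ∀ⁿʰ)
open import Data.Vec.Properties using ([]=⇒lookup; lookup⇒[]=; lookup∘tabulate)
open import Function.Base using (_∘_; _|>_)
open import Function.Bundles using (_⇔_; mk⇔; Equivalence)
open import Level using (0ℓ)
open import Relation.Binary.Bundles using (DecTotalOrder; Poset)
open import Relation.Binary.PropositionalEquality hiding (_≗_; [_])
import Relation.Binary.Reasoning.PartialOrder as PartialOrderReasoning
open import Relation.Binary.Structures using (IsDecTotalOrder)
open import Relation.Nullary using (¬_; Dec; yes; no; contradiction; does)
open import Relation.Nullary.Decidable using (_×-dec_; from-yes; map′)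
open import Defs

module Ordered (ℛ : Reals) where
  open Reals ℛ public
  open CommutativeRing commutativeRing public
    using (+-assoc; +-comm; +-identityˡ; +-identityʳ; *-assoc; *-comm
          ; *-identityˡ; *-identityʳ; distribˡ; distribʳ; -‿inverseˡ
          ; -‿inverseʳ; zeroˡ; zeroʳ; ring)
  open IsDecTotalOrder isDecTotalOrder public
    using (_≟_; _≤?_; total)
    renaming (refl to ≤-refl; reflexive to ≤-reflexive; trans to ≤-trans
             ; antisym to ≤-antisym)
  private module R = RingProperties ring

  natural : ℕ → ℝ
  natural zero          = 0#
  natural (suc zero)    = 1#
  natural (suc (suc n)) = 1# + natural (suc n)

  natural-suc : ∀ n → natural (suc n) ≡ 1# + natural n
  natural-suc zero    = sym (+-identityʳ 1#)
  natural-suc (suc n) = refl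

  natural-+ : ∀ m n → natural (m ℕ.+ n) ≡ natural m + natural n
  natural-+ zero    n = sym (+-identityˡ _)
  natural-+ (suc m) n = trans (natural-suc (m ℕ.+ n))
    (trans (cong (1# +_) (natural-+ m n))
    (trans (sym (+-assoc 1# (natural m) (natural n)))
           (cong (_+ natural n) (sym (natural-suc m)))))

  natural-* : ∀ m n → natural (m ℕ.* n) ≡ natural m * natural n
  natural-* zero    n = sym (zeroˡ _)
  natural-* (suc m) n = trans (natural-+ n (m ℕ.* n))
    (trans (cong₂ _+_ (sym (*-identityˡ _)) (natural-* m n))
    (trans (sym (distribʳ (natural n) 1# (natural m)))
           (cong (_* natural n) (sym (natural-suc m)))))

  natural≡fromℕ : ∀ n → natural n ≡ fromℕ n
  natural≡fromℕ zero    = refl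
  natural≡fromℕ (suc n) = trans (natural-suc n) (cong (1# +_) (natural≡fromℕ n))

  integer : ℤ → ℝ
  integer (pos n)  = natural n
  integer -[1+ n ] = - natural (suc n)

  private
    cancel : ∀ a b c → (a + b) - (a + c) ≡ b - c
    cancel a b c = begin
      (a + b) + - (a + c)      ≡⟨ cong₂ _+_ (+-comm a b) (sym (R.-‿+-comm a c)) ⟩
      (b + a) + (- a + - c)    ≡⟨ +-assoc b a _ ⟩
      b + (a + (- a + - c))    ≡⟨ cong (b +_) (sym (+-assoc a (- a) (- c))) ⟩
      b + ((a + - a) + - c)    ≡⟨ cong (λ x → b + (x + - c)) (-‿inverseʳ a) ⟩
      b + (0# + - c)           ≡⟨ cong (b +_) (+-identityˡ (- c)) ⟩
      b - c                    ∎
      where open ≡-Reasoning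

    integer-⊖ : ∀ m n → integer (m ℤ.⊖ n) ≡ natural m - natural n
    integer-⊖ zero    zero    = sym (-‿inverseʳ 0#)
    integer-⊖ zero    (suc n) = sym (+-identityˡ _)
    integer-⊖ (suc m) zero    = sym (trans (cong (natural (suc m) +_) R.-0#≈0#) (+-identityʳ _))
    integer-⊖ (suc m) (suc n) = begin
      integer (suc m ℤ.⊖ suc n)             ≡⟨ cong integer (ℤ.[1+m]⊖[1+n]≡m⊖n m n) ⟩
      integer (m ℤ.⊖ n)                     ≡⟨ integer-⊖ m n ⟩
      natural m - natural n                 ≡⟨ sym (cancel 1# _ _) ⟩
      (1# + natural m) - (1# + natural n)   ≡⟨ cong₂ _-_ (sym (natural-suc m)) (sym (natural-suc n)) ⟩
      natural (suc m) - natural (suc n)     ∎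
      where open ≡-Reasoning

    integer-neg : ∀ i → integer (ℤ.- i) ≡ - integer i
    integer-neg (pos zero)    = sym R.-0#≈0#
    integer-neg (pos (suc n)) = refl
    integer-neg -[1+ n ]      = sym (R.-‿involutive _)

    integer-+ : ∀ i j → integer (i ℤ.+ j) ≡ integer i + integer j
    integer-+ (pos m)  (pos n)  = natural-+ m n
    integer-+ (pos m)  -[1+ n ] = integer-⊖ m (suc n)
    integer-+ -[1+ m ] (pos n)  = trans (integer-⊖ n (suc m)) (+-comm _ _)
    integer-+ -[1+ m ] -[1+ n ] = trans
      (cong -_ (trans (cong natural (cong suc (sym (ℕ.+-suc m n)))) (natural-+ (suc m) (suc n))))
      (sym (R.-‿+-comm _ _))

    integer-* : ∀ i j → integer (i ℤ.* j) ≡ integer i * integer j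
    integer-* (pos m)       (pos n)       = trans (cong integer (sym (ℤ.pos-* m n))) (natural-* m n)
    integer-* (pos zero)    -[1+ n ]      = sym (zeroˡ _)
    integer-* (pos (suc m)) -[1+ n ]      =
      trans (cong -_ (natural-* (suc m) (suc n))) (R.-‿distribʳ-* _ _)
    integer-* -[1+ m ]      (pos zero)    = trans (cong integer (ℤ.*-zeroʳ -[1+ m ])) (sym (zeroʳ _))
    integer-* -[1+ m ]      (pos (suc n)) =
      trans (cong -_ (natural-* (suc m) (suc n))) (R.-‿distribˡ-* _ _)
    integer-* -[1+ m ]      -[1+ n ]      = trans (natural-* (suc m) (suc n))
      (trans (sym (R.-‿involutive _))
      (trans (cong -_ (R.-‿distribˡ-* _ _)) (R.-‿distribʳ-* _ _)))

    almostCommutativeRing : AlmostCommutativeRing 0ℓ 0ℓ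
    almostCommutativeRing = fromCommutativeRing commutativeRing

    integers : RawRing 0ℓ 0ℓ
    integers = record
      { Carrier = ℤ ; _≈_ = _≡_ ; _+_ = ℤ._+_ ; _*_ = ℤ._*_ ; -_ = ℤ.-_
      ; 0# = ℤ.0ℤ ; 1# = ℤ.1ℤ }

    morphism : integers -Raw-AlmostCommutative⟶ almostCommutativeRing
    morphism = record
      { ⟦_⟧ = integer ; +-homo = integer-+ ; *-homo = integer-*
      ; -‿homo = integer-neg ; 0-homo = refl ; 1-homo = refl }

    equal? : ∀ i j → Maybe (integer i ≡ integer j)
    equal? i j with i ℤ.≟ j
    ... | yes i≡j = just (cong integer i≡j)
    ... | no  _   = nothing

  module Solver = RingSolver integers almostCommutativeRing morphism equal?
  open Solver public
    using (Polynomial; con; var; _:+_; _:*_; _:-_; :-_; _:^_)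
    renaming (⟦_⟧ to ⟦_⟧ₚ)
  open Solver using (normalise; ⟦_⟧N; correct)

  # : ∀ {n} → ℕ → Polynomial n
  # k = con (pos k)

  infix 6 _⊑_ _≗_ _≗˘_ _≐_
  infix 3 _⊢_≼_ _⊢_≈_

  data Fact (n : ℕ) : Set where
    _⊑_ _≗_ _≗˘_ : Polynomial n → Polynomial n → Fact n

  data Equation (n : ℕ) : Set where
    _≐_ : Polynomial n → Polynomial n → Equation n

  data Problem (n : ℕ) : Set where
    _⊢_≼_ : List (Fact n) → Polynomial n → Polynomial n → Problem n
    _⊢_≈_ : List (Equation n) → Polynomial n → Polynomial n → Problem n

  Holds : ∀ {n} → Vec ℝ n → Fact n → Set
  Holds ρ (p ⊑ q)  = ⟦ p ⟧ₚ ρ ≤ ⟦ q ⟧ₚ ρ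
  Holds ρ (p ≗ q)  = ⟦ p ⟧ₚ ρ ≡ ⟦ q ⟧ₚ ρ
  Holds ρ (p ≗˘ q) = ⟦ p ⟧ₚ ρ ≡ ⟦ q ⟧ₚ ρ

  slack : ∀ {n} → Fact n → Polynomial n
  slack (p ⊑ q)  = q :- p
  slack (p ≗ q)  = q :- p
  slack (p ≗˘ q) = p :- q

  slacks : ∀ {n} → List (Fact n) → Polynomial n
  slacks []       = con ℤ.0ℤ
  slacks (h ∷ hs) = slack h :+ slacks hs

  differences : ∀ {n} → List (Equation n) → Polynomial n
  differences []             = con ℤ.0ℤ
  differences ((p ≐ q) ∷ hs) = (q :- p) :+ differences hs

  -- A problem is solved when the difference of the two sides of the goal
  -- is, as a polynomial, the sum of the differences in the hypotheses.
  Valid : ∀ {n} → Problem n → Set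
  Valid (hs ⊢ p ≼ q) = normalise (slacks hs) ≡ normalise (q :- p)
  Valid (hs ⊢ p ≈ q) = normalise (differences hs) ≡ normalise (q :- p)

  Consequence : ∀ {n} → Vec ℝ n → Problem n → Set
  Consequence ρ ([] ⊢ p ≼ q)             = ⟦ p ⟧ₚ ρ ≤ ⟦ q ⟧ₚ ρ
  Consequence ρ (h ∷ hs ⊢ p ≼ q)         = Holds ρ h → Consequence ρ (hs ⊢ p ≼ q)
  Consequence ρ ([] ⊢ p ≈ q)             = ⟦ p ⟧ₚ ρ ≡ ⟦ q ⟧ₚ ρ
  Consequence ρ ((r ≐ s) ∷ hs ⊢ p ≈ q)   = ⟦ r ⟧ₚ ρ ≡ ⟦ s ⟧ₚ ρ → Consequence ρ (hs ⊢ p ≈ q)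

  +-mono-≤ : ∀ {a b c d} → a ≤ b → c ≤ d → a + c ≤ b + d
  +-mono-≤ {a} {b} {c} {d} a≤b c≤d = ≤-trans (+-monoˡ-≤ c a≤b)
    (subst₂ _≤_ (+-comm c b) (+-comm d b) (+-monoˡ-≤ b c≤d))

  diff-nonneg : ∀ {a b} → a ≤ b → 0# ≤ b - a
  diff-nonneg {a} {b} a≤b = subst (_≤ b - a) (-‿inverseʳ a) (+-monoˡ-≤ (- a) a≤b)

  diff-nonneg⁻¹ : ∀ {a b} → 0# ≤ b - a → a ≤ b
  diff-nonneg⁻¹ {a} {b} h = subst₂ _≤_ (+-identityˡ a)
    (trans (+-assoc b (- a) a) (trans (cong (b +_) (-‿inverseˡ a)) (+-identityʳ b)))
    (+-monoˡ-≤ a h)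

  private
    diff-zero : ∀ {a b} → a ≡ b → b - a ≡ 0#
    diff-zero {a} refl = -‿inverseʳ a

    diff-zero⁻¹ : ∀ {a b} → b - a ≡ 0# → a ≡ b
    diff-zero⁻¹ {a} {b} h = sym (R.x∙y⁻¹≈ε⇒x≈y b a h)

    slack-nonneg : ∀ {n} (ρ : Vec ℝ n) h → Holds ρ h → 0# ≤ ⟦ slack h ⟧ₚ ρ
    slack-nonneg ρ (p ⊑ q)  h = diff-nonneg h
    slack-nonneg ρ (p ≗ q)  h = ≤-reflexive (sym (diff-zero h))
    slack-nonneg ρ (p ≗˘ q) h = ≤-reflexive (sym (diff-zero (sym h)))

    same : ∀ {n} (p q : Polynomial n) → normalise p ≡ normalise q → ∀ ρ → ⟦ p ⟧ₚ ρ ≡ ⟦ q ⟧ₚ ρ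
    same p q eq ρ = trans (sym (correct p ρ)) (trans (cong (λ r → ⟦ r ⟧N ρ) eq) (correct q ρ))

    nonneg-sum : ∀ {a b} → 0# ≤ a → 0# ≤ b → 0# ≤ a + b
    nonneg-sum {a} {b} h k = subst (_≤ a + b) (+-identityˡ 0#) (+-mono-≤ h k)

    conclude≤ : ∀ {n} (ρ : Vec ℝ n) hs p q s → 0# ≤ s →
                s + ⟦ slacks hs ⟧ₚ ρ ≡ ⟦ q ⟧ₚ ρ - ⟦ p ⟧ₚ ρ →
                Consequence ρ (hs ⊢ p ≼ q)
    conclude≤ ρ []       p q s 0≤s eq =
      diff-nonneg⁻¹ (subst (0# ≤_) (trans (sym (+-identityʳ s)) eq) 0≤s)
    conclude≤ ρ (h ∷ hs) p q s 0≤s eq holds =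
      conclude≤ ρ hs p q (s + ⟦ slack h ⟧ₚ ρ)
        (nonneg-sum 0≤s (slack-nonneg ρ h holds)) (trans (+-assoc _ _ _) eq)

    conclude≡ : ∀ {n} (ρ : Vec ℝ n) hs p q →
                ⟦ differences hs ⟧ₚ ρ ≡ ⟦ q ⟧ₚ ρ - ⟦ p ⟧ₚ ρ →
                Consequence ρ (hs ⊢ p ≈ q)
    conclude≡ ρ []             p q eq       = diff-zero⁻¹ (sym eq)
    conclude≡ ρ ((r ≐ s) ∷ hs) p q eq holds =
      conclude≡ ρ hs p q
        (trans (sym (trans (cong (_+ ⟦ differences hs ⟧ₚ ρ) (diff-zero holds)) (+-identityˡ _))) eq)

    conclude : ∀ {n} (ρ : Vec ℝ n) (P : Problem n) → Valid P → Consequence ρ P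
    conclude ρ (hs ⊢ p ≼ q) valid = conclude≤ ρ hs p q 0# ≤-refl
      (trans (+-identityˡ _) (same (slacks hs) (q :- p) valid ρ))
    conclude ρ (hs ⊢ p ≈ q) valid = conclude≡ ρ hs p q (same (differences hs) (q :- p) valid ρ)

    generalise : ∀ n {P : Vec ℝ n → Set} → (∀ ρ → P ρ) → ∀ⁿʰ n (curryⁿ P)
    generalise zero    f = f []
    generalise (suc n) f = generalise n (f ∘ (_ ∷_))

    variables : ∀ n → Vec (Polynomial n) n
    variables n = Vec.map var (Vec.allFin n)

  arith : ∀ n (f : N-ary n (Polynomial n) (Problem n)) → Valid (f $ⁿ variables n) →
          ∀ⁿʰ n (curryⁿ (λ ρ → Consequence ρ (f $ⁿ variables n)))
  arith n f valid = generalise n (λ ρ → conclude ρ (f $ⁿ variables n) valid)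

module OrderedField (ℛ : Reals) where
  open Ordered ℛ public

  ≰⇒≥ : ∀ {x y} → ¬ x ≤ y → y ≤ x
  ≰⇒≥ {x} {y} x≰y with total x y
  ... | inj₁ x≤y = contradiction x≤y x≰y
  ... | inj₂ y≤x = y≤x

  ≰⇒> : ∀ {x y} → ¬ x ≤ y → y < x
  ≰⇒> x≰y = ≰⇒≥ x≰y , λ { refl → x≰y ≤-refl }

  <⇒≤ : ∀ {x y} → x < y → x ≤ y
  <⇒≤ = proj₁

  <⇒≱ : ∀ {x y} → x < y → ¬ y ≤ x
  <⇒≱ (x≤y , x≢y) y≤x = x≢y (≤-antisym x≤y y≤x)

  ≮⇒≥ : ∀ {x y} → ¬ x < y → y ≤ x
  ≮⇒≥ {x} {y} x≮y with y ≤? x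
  ... | yes y≤x = y≤x
  ... | no  y≰x = contradiction (≰⇒> y≰x) x≮y

  <-≤-trans : ∀ {x y z} → x < y → y ≤ z → x < z
  <-≤-trans x<y y≤z = ≰⇒> (λ z≤x → <⇒≱ x<y (≤-trans y≤z z≤x))

  ≤-<-trans : ∀ {x y z} → x ≤ y → y < z → x < z
  ≤-<-trans x≤y y<z = ≰⇒> (λ z≤x → <⇒≱ y<z (≤-trans z≤x x≤y))

  _<?_ : ∀ x y → Dec (x < y)
  x <? y with y ≤? x
  ... | yes y≤x = no (λ x<y → <⇒≱ x<y y≤x)
  ... | no  y≰x = yes (≰⇒> y≰x)

  ≤-by-< : ∀ {x y} → (y < x → x ≤ y) → x ≤ y
  ≤-by-< {x} {y} h with x ≤? y
  ... | yes x≤y = x≤y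
  ... | no  x≰y = h (≰⇒> x≰y)

  square-nonneg : ∀ x → 0# ≤ x * x
  square-nonneg x with total 0# x
  ... | inj₁ 0≤x = *-nonNegative 0≤x 0≤x
  ... | inj₂ x≤0 = arith 1 (λ x → (# 0 ⊑ (# 0 :- x) :* (# 0 :- x) ∷ []) ⊢ # 0 ≼ x :* x) refl
                     (*-nonNegative 0≤-x 0≤-x)
    where
    0≤-x : 0# ≤ 0# - x
    0≤-x = diff-nonneg x≤0

  0≤1 : 0# ≤ 1#
  0≤1 = subst (0# ≤_) (*-identityˡ 1#) (square-nonneg 1#)

  0<1 : 0# < 1#
  0<1 = 0≤1 , 0≢1

  *-monoʳ-≤ : ∀ {a b} c → 0# ≤ c → a ≤ b → c * a ≤ c * b
  *-monoʳ-≤ c 0≤c a≤b =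
    arith 3 (λ a b c → (# 0 ⊑ c :* (b :- a) ∷ []) ⊢ c :* a ≼ c :* b) refl
      (*-nonNegative 0≤c (diff-nonneg a≤b))

  *-monoˡ-≤ : ∀ {a b} c → 0# ≤ c → a ≤ b → a * c ≤ b * c
  *-monoˡ-≤ c 0≤c a≤b =
    arith 3 (λ a b c → (# 0 ⊑ c :* (b :- a) ∷ []) ⊢ a :* c ≼ b :* c) refl
      (*-nonNegative 0≤c (diff-nonneg a≤b))

  *-mono-≤ : ∀ {a b c d} → 0# ≤ a → 0# ≤ d → a ≤ b → c ≤ d → a * c ≤ b * d
  *-mono-≤ {a} {b} {c} {d} 0≤a 0≤d a≤b c≤d =
    ≤-trans (*-monoʳ-≤ a 0≤a c≤d) (*-monoˡ-≤ d 0≤d a≤b)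

  +-nonneg : ∀ {a b} → 0# ≤ a → 0# ≤ b → 0# ≤ a + b
  +-nonneg = arith 2 (λ a b → (# 0 ⊑ a ∷ # 0 ⊑ b ∷ []) ⊢ # 0 ≼ a :+ b) refl

  +-pos : ∀ {a b} → 0# ≤ a → 0# < b → 0# < a + b
  +-pos 0≤a 0<b = <-≤-trans 0<b (arith 2 (λ a b → (# 0 ⊑ a ∷ []) ⊢ b ≼ a :+ b) refl 0≤a)

  <-diff : ∀ {a b} → a < b → 0# < b - a
  <-diff a<b = ≰⇒> (λ h → <⇒≱ a<b
    (arith 2 (λ a b → (b :- a ⊑ # 0 ∷ []) ⊢ b ≼ a) refl h))

  <-diff⁻¹ : ∀ {a b} → 0# < b - a → a < b
  <-diff⁻¹ 0<d = ≰⇒> (λ h → <⇒≱ 0<d (arith 2 (λ a b → (b ⊑ a ∷ []) ⊢ b :- a ≼ # 0) refl h))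

  ⁻¹-nonneg : ∀ {x} → 0# < x → 0# ≤ x ⁻¹
  ⁻¹-nonneg {x} (0≤x , 0≢x) with total 0# (x ⁻¹)
  ... | inj₁ 0≤x⁻¹ = 0≤x⁻¹
  ... | inj₂ x⁻¹≤0 = contradiction
    (arith 2 (λ x y → (# 0 ⊑ x :* (# 0 :- y) ∷ x :* y ≗˘ # 1 ∷ []) ⊢ # 1 ≼ # 0) refl
      (*-nonNegative 0≤x (diff-nonneg x⁻¹≤0)) (⁻¹-inverseʳ x (0≢x ∘ sym)))
    (<⇒≱ 0<1)

  ⁻¹-cancel : ∀ {x} → 0# < x → x * x ⁻¹ ≡ 1#
  ⁻¹-cancel (_ , 0≢x) = ⁻¹-inverseʳ _ (0≢x ∘ sym)

  *-cancelˡ-≤ : ∀ {a b} c → 0# < c → c * a ≤ c * b → a ≤ b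
  *-cancelˡ-≤ {a} {b} c 0<c h = arith 4
    (λ a b c d → (# 0 ⊑ d :* (c :* b :- c :* a) ∷ b :* (c :* d) ≗ b :* # 1 ∷ a :* (c :* d) ≗˘ a :* # 1 ∷ [])
      ⊢ a ≼ b) refl
    (*-nonNegative (⁻¹-nonneg 0<c) (diff-nonneg h))
    (cong (b *_) (⁻¹-cancel 0<c)) (cong (a *_) (⁻¹-cancel 0<c))

  *-cancelˡ-≡ : ∀ {a b} c → 0# < c → c * a ≡ c * b → a ≡ b
  *-cancelˡ-≡ c 0<c h = ≤-antisym (*-cancelˡ-≤ c 0<c (≤-reflexive h))
                                  (*-cancelˡ-≤ c 0<c (≤-reflexive (sym h)))

  *-pos : ∀ {a b} → 0# < a → 0# < b → 0# < a * b
  *-pos {a} {b} 0<a 0<b = ≰⇒> (λ h → <⇒≱ 0<b (*-cancelˡ-≤ a 0<a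
    (≤-trans h (≤-reflexive (sym (zeroʳ a))))))

  /-cancel : ∀ {a b} → 0# < b → b * (a / b) ≡ a
  /-cancel {a} {b} 0<b = arith 3 (λ a b c → (a :* (b :* c) ≐ a :* # 1 ∷ []) ⊢ b :* (a :* c) ≈ a) refl
    (cong (a *_) (⁻¹-cancel 0<b))

  /-pos : ∀ {a b} → 0# < a → 0# < b → 0# < a / b
  /-pos {a} {b} 0<a 0<b = ≰⇒> (λ h → <⇒≱ 0<a
    (subst (_≤ 0#) (/-cancel 0<b) (≤-trans (*-monoʳ-≤ b (<⇒≤ 0<b) h) (≤-reflexive (zeroʳ b)))))

  natural-nonneg : ∀ n → 0# ≤ natural n
  natural-nonneg zero    = ≤-refl
  natural-nonneg (suc n) = subst (0# ≤_) (sym (natural-suc n)) (+-nonneg 0≤1 (natural-nonneg n))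

  natural-mono : ∀ {m n} → m ℕ.≤ n → natural m ≤ natural n
  natural-mono {m} {n} m≤n = subst (λ k → natural m ≤ natural k) (ℕ.m+[n∸m]≡n m≤n)
    (subst (natural m ≤_) (sym (natural-+ m (n ℕ.∸ m)))
      (arith 2 (λ a b → (# 0 ⊑ b ∷ []) ⊢ a ≼ a :+ b) refl (natural-nonneg (n ℕ.∸ m))))

  natural-pos : ∀ {n} → 1 ℕ.≤ n → 0# < natural n
  natural-pos 1≤n = <-≤-trans 0<1 (natural-mono 1≤n)

  0<natural : ∀ n → 0# < natural (suc n)
  0<natural n = natural-pos {suc n} (ℕ.s≤s ℕ.z≤n)

  natural-∸ : ∀ {m n} → n ℕ.≤ m → natural (m ℕ.∸ n) ≡ natural m - natural n
  natural-∸ {m} {n} n≤m = arith 3 (λ a b c → (a :+ b ≐ c ∷ []) ⊢ b ≈ c :- a) refl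
    (trans (sym (natural-+ n (m ℕ.∸ n))) (cong natural (ℕ.m+[n∸m]≡n n≤m)))

  natural-cancel-≤ : ∀ {m n} → natural m ≤ natural n → m ℕ.≤ n
  natural-cancel-≤ {m} {n} h with m ℕ.≤? n
  ... | yes m≤n = m≤n
  ... | no  m≰n = contradiction (≤-trans (natural-mono (ℕ.≰⇒> m≰n)) h)
    (<⇒≱ (subst (natural n <_) (sym (natural-suc n))
      (<-diff⁻¹ (subst (0# <_) (arith 1 (λ a → [] ⊢ # 1 ≈ (# 1 :+ a) :- a) refl) 0<1))))

  infixr 5 _⊓_ _⊔_

  _⊔_ : ℝ → ℝ → ℝ
  x ⊔ y with x ≤? y
  ... | yes _ = y
  ... | no  _ = x

  x≤x⊔y : ∀ x y → x ≤ x ⊔ y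
  x≤x⊔y x y with x ≤? y
  ... | yes x≤y = x≤y
  ... | no  _   = ≤-refl

  y≤x⊔y : ∀ x y → y ≤ x ⊔ y
  y≤x⊔y x y with x ≤? y
  ... | yes _   = ≤-refl
  ... | no  x≰y = ≰⇒≥ x≰y

  ⊔-lub : ∀ {x y z} → x ≤ z → y ≤ z → x ⊔ y ≤ z
  ⊔-lub {x} {y} x≤z y≤z with x ≤? y
  ... | yes _ = y≤z
  ... | no  _ = x≤z

  _⊓_ : ℝ → ℝ → ℝ
  x ⊓ y with x ≤? y
  ... | yes _ = x
  ... | no  _ = y

  x⊓y≤x : ∀ x y → x ⊓ y ≤ x
  x⊓y≤x x y with x ≤? y
  ... | yes _   = ≤-refl
  ... | no  x≰y = ≰⇒≥ x≰y

  x⊓y≤y : ∀ x y → x ⊓ y ≤ y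
  x⊓y≤y x y with x ≤? y
  ... | yes x≤y = x≤y
  ... | no  _   = ≤-refl

  ⊓-glb : ∀ {x y z} → z ≤ x → z ≤ y → z ≤ x ⊓ y
  ⊓-glb {x} {y} z≤x z≤y with x ≤? y
  ... | yes _ = z≤x
  ... | no  _ = z≤y

  ⊓-case : ∀ x y → x ⊓ y ≡ x ⊎ x ⊓ y ≡ y
  ⊓-case x y with x ≤? y
  ... | yes _ = inj₁ refl
  ... | no  _ = inj₂ refl

module Powers (ℛ : Reals) where
  open OrderedField ℛ

  ^-nonneg : ∀ {x} n → 0# ≤ x → 0# ≤ x ^ n
  ^-nonneg zero    0≤x = 0≤1
  ^-nonneg (suc n) 0≤x = *-nonNegative 0≤x (^-nonneg n 0≤x)

  ^-mono-≤ : ∀ {x y} n → 0# ≤ x → x ≤ y → x ^ n ≤ y ^ n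
  ^-mono-≤ zero    0≤x x≤y = ≤-refl
  ^-mono-≤ (suc n) 0≤x x≤y =
    *-mono-≤ 0≤x (^-nonneg n (≤-trans 0≤x x≤y)) x≤y (^-mono-≤ n 0≤x x≤y)

  1≤^ : ∀ {x} n → 1# ≤ x → 1# ≤ x ^ n
  1≤^ zero    1≤x = ≤-refl
  1≤^ {x} (suc n) 1≤x = ≤-trans 1≤x (subst (_≤ x * x ^ n) (trans (*-comm x 1#) (*-identityˡ x))
    (*-monoʳ-≤ x (≤-trans 0≤1 1≤x) (1≤^ n 1≤x)))

  x≤x^n : ∀ {x n} → 1 ℕ.≤ n → 1# ≤ x → x ≤ x ^ n
  x≤x^n {x} {suc n} _ 1≤x = subst (_≤ x * x ^ n) (trans (*-comm x 1#) (*-identityˡ x))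
    (*-monoʳ-≤ x (≤-trans 0≤1 1≤x) (1≤^ n 1≤x))

  1^n : ∀ n → 1# ^ n ≡ 1#
  1^n zero    = refl
  1^n (suc n) = trans (*-identityˡ _) (1^n n)

  *-^ : ∀ x y n → (x * y) ^ n ≡ x ^ n * y ^ n
  *-^ x y zero    = sym (*-identityˡ 1#)
  *-^ x y (suc n) = trans (cong (x * y *_) (*-^ x y n))
    (arith 4 (λ x y a b → [] ⊢ x :* y :* (a :* b) ≈ x :* a :* (y :* b)) refl)

  ^-swap : ∀ x m n → (x ^ m) ^ n ≡ (x ^ n) ^ m
  ^-swap x m zero    = sym (1^n m)
  ^-swap x m (suc n) = trans (cong (x ^ m *_) (^-swap x m n)) (sym (*-^ x (x ^ n) m))

  natural-^ : ∀ a n → natural (a ℕ.^ n) ≡ natural a ^ n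
  natural-^ a zero    = refl
  natural-^ a (suc n) = trans (natural-* a (a ℕ.^ n)) (cong (natural a *_) (natural-^ a n))

  bernoulli : ∀ {x} n → 0# ≤ x → 1# + natural n * x ≤ (1# + x) ^ n
  bernoulli {x} zero    0≤x = ≤-reflexive (arith 1 (λ x → [] ⊢ # 1 :+ # 0 :* x ≈ # 1) refl)
  bernoulli {x} (suc n) 0≤x = subst (λ a → 1# + a * x ≤ (1# + x) ^ suc n) (sym (natural-suc n))
    (arith 3 (λ x k p → ((# 1 :+ x) :* (# 1 :+ k :* x) ⊑ (# 1 :+ x) :* p ∷ # 0 ⊑ k :* (x :* x) ∷ [])
        ⊢ # 1 :+ (# 1 :+ k) :* x ≼ (# 1 :+ x) :* p) refl
      (*-monoʳ-≤ (1# + x) (+-nonneg 0≤1 0≤x) (bernoulli n 0≤x))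
      (*-nonNegative (natural-nonneg n) (square-nonneg x)))

  bernoulli⁻ : ∀ {x} n → 0# ≤ x → (1# + x) ^ n * (1# - natural n * x) ≤ 1#
  bernoulli⁻ {x} zero    0≤x = ≤-reflexive (arith 1 (λ x → [] ⊢ # 1 :* (# 1 :- # 0 :* x) ≈ # 1) refl)
  bernoulli⁻ {x} (suc n) 0≤x =
    subst (λ a → (1# + x) ^ suc n * (1# - a * x) ≤ 1#) (sym (natural-suc n))
      (arith 3 (λ x k p → (p :* (# 1 :- k :* x) ⊑ # 1 ∷ # 0 ⊑ p :* ((# 1 :+ k) :* (x :* x)) ∷ [])
          ⊢ (# 1 :+ x) :* p :* (# 1 :- (# 1 :+ k) :* x) ≼ # 1) refl
        (bernoulli⁻ n 0≤x)
        (*-nonNegative (^-nonneg n (+-nonneg 0≤1 0≤x))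
          (*-nonNegative (+-nonneg 0≤1 (natural-nonneg n)) (square-nonneg x))))

  -- The Padé bound e^a ≤ (2 + a) / (2 − a) at a = n y.
  padé : ∀ {y} n → 0# ≤ y →
         (1# + y) ^ n * (natural 2 - natural n * y) ≤ natural 2 + natural n * y
  padé {y} zero    0≤y = ≤-reflexive (arith 1 (λ y → [] ⊢ # 1 :* (# 2 :- # 0 :* y) ≈ # 2 :+ # 0 :* y) refl)
  padé {y} (suc n) 0≤y = subst (λ k → (1# + y) ^ suc n * (natural 2 - k * y) ≤ natural 2 + k * y)
    (sym (natural-suc n)) step
    where
    k = natural n
    a = k * y
    p = (1# + y) ^ n
    0≤a = *-nonNegative (natural-nonneg n) 0≤y
    0≤p = ^-nonneg n (+-nonneg 0≤1 0≤y)
    step : (1# + y) * p * (natural 2 - (1# + k) * y) ≤ natural 2 + (1# + k) * y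
    step with natural 2 ≤? (1# + k) * y
    ... | yes small = arith 3
      (λ y k p → (# 0 ⊑ p :* ((# 1 :+ y) :* ((# 1 :+ k) :* y :- # 2)) ∷ # 0 ⊑ # 2 ∷ # 0 ⊑ k :* y ∷ # 0 ⊑ y ∷ [])
        ⊢ (# 1 :+ y) :* p :* (# 2 :- (# 1 :+ k) :* y) ≼ # 2 :+ (# 1 :+ k) :* y) refl
      (*-nonNegative 0≤p (*-nonNegative (+-nonneg 0≤1 0≤y) (diff-nonneg small)))
      (natural-nonneg 2) 0≤a 0≤y
    ... | no large = *-cancelˡ-≤ (natural 2 - a)
      (<-≤-trans (<-diff (≰⇒> large))
        (arith 2 (λ y k → (# 0 ⊑ y ∷ []) ⊢ # 2 :- (# 1 :+ k) :* y ≼ # 2 :- k :* y) refl 0≤y))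
      (arith 3 (λ y k p →
          (# 0 ⊑ (# 1 :+ y) :* (# 2 :- (# 1 :+ k) :* y) :* ((# 2 :+ k :* y) :- p :* (# 2 :- k :* y))
          ∷ # 0 ⊑ (k :* y) :* (k :* y) :* y :+ # 2 :* (y :* y) :+ k :* y :* (y :* y) ∷ [])
          ⊢ (# 2 :- k :* y) :* ((# 1 :+ y) :* p :* (# 2 :- (# 1 :+ k) :* y))
            ≼ (# 2 :- k :* y) :* (# 2 :+ (# 1 :+ k) :* y)) refl
        (*-nonNegative (*-nonNegative (+-nonneg 0≤1 0≤y) (diff-nonneg (≰⇒≥ large)))
          (diff-nonneg (padé n 0≤y)))
        (+-nonneg (+-nonneg (*-nonNegative (*-nonNegative 0≤a 0≤a) 0≤y)
          (*-nonNegative (natural-nonneg 2) (square-nonneg y)))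
          (*-nonNegative 0≤a (square-nonneg y))))

  ^-increase : ∀ {x} n → 0# ≤ x →
               ∃[ C ] 0# ≤ C × (∀ η → 0# ≤ η → η ≤ 1# → (x + η) ^ n ≤ x ^ n + η * C)
  ^-increase {x} zero    0≤x = 0# , ≤-refl , λ η _ _ →
    ≤-reflexive (arith 1 (λ h → [] ⊢ # 1 ≈ # 1 :+ h :* # 0) refl)
  ^-increase {x} (suc n) 0≤x with ^-increase n 0≤x
  ... | C , 0≤C , bound = x ^ n + (x + 1#) * C
    , +-nonneg (^-nonneg n 0≤x) (*-nonNegative (+-nonneg 0≤x 0≤1) 0≤C)
    , λ η 0≤η η≤1 → arith 5 (λ x h C p r →
        ((x :+ h) :* r ⊑ (x :+ h) :* (p :+ h :* C) ∷ # 0 ⊑ h :* C :* (# 1 :- h) ∷ [])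
        ⊢ (x :+ h) :* r ≼ x :* p :+ h :* (p :+ (x :+ # 1) :* C)) refl
      (*-monoʳ-≤ (x + η) (+-nonneg 0≤x 0≤η) (bound η 0≤η η≤1))
      (*-nonNegative (*-nonNegative 0≤η 0≤C) (diff-nonneg η≤1))

  module Root (m : ℕ) (1≤m : 1 ℕ.≤ m) (K : ℝ) (1≤K : 1# ≤ K) where

    Below : ℝ → Set
    Below y = 0# ≤ y × y ^ m ≤ K

    private
      nonempty : ∃ Below
      nonempty = 1# , 0≤1 , subst (_≤ K) (sym (1^n m)) 1≤K

      bounded : UpperBound Below K
      bounded y (0≤y , y^m≤K) with y ≤? 1#
      ... | yes y≤1 = ≤-trans y≤1 1≤K
      ... | no  y≰1 = ≤-trans (x≤x^n 1≤m (≰⇒≥ y≰1)) y^m≤K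

    root-upper : ∀ y → Below y → y ≤ root m K
    root-upper = sup-upper Below nonempty (K , bounded)

    1≤root : 1# ≤ root m K
    1≤root = root-upper 1# (proj₂ nonempty)

    K≤root^m : K ≤ root m K ^ m
    K≤root^m = ≤-by-< λ gap → contradiction (η≤0 gap) (<⇒≱ (0<η gap))
      where
      f = root m K
      0≤f = ≤-trans 0≤1 1≤root
      increase = ^-increase m 0≤f
      C = proj₁ increase
      0≤C = proj₁ (proj₂ increase)
      0<C+1 : 0# < C + 1#
      0<C+1 = +-pos 0≤C 0<1
      module _ (gap : f ^ m < K) where
        d = K - f ^ m
        η = 1# ⊓ d / (C + 1#)
        0<η : 0# < η
        0<η with ⊓-case 1# (d / (C + 1#))
        ... | inj₁ eq = subst (0# <_) (sym eq) 0<1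
        ... | inj₂ eq = subst (0# <_) (sym eq) (/-pos (<-diff gap) 0<C+1)
        ηC≤d : η * C ≤ d
        ηC≤d = arith 4 (λ h C d r → (# 0 ⊑ (C :+ # 1) :* (r :- h) ∷ # 0 ⊑ h ∷ (C :+ # 1) :* r ≗ d ∷ [])
            ⊢ h :* C ≼ d) refl
          (*-nonNegative (<⇒≤ 0<C+1) (diff-nonneg (x⊓y≤y _ _))) (<⇒≤ 0<η) (/-cancel 0<C+1)
        η≤0 : η ≤ 0#
        η≤0 = arith 2 (λ f h → (f :+ h ⊑ f ∷ []) ⊢ h ≼ # 0) refl
          (root-upper (f + η) (+-nonneg 0≤f (<⇒≤ 0<η)
            , ≤-trans (proj₂ (proj₂ increase) η (<⇒≤ 0<η) (x⊓y≤x _ _))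
                (arith 3 (λ p e K → (e ⊑ K :- p ∷ []) ⊢ p :+ e ≼ K) refl ηC≤d)))

module Parameters (ℛ : Reals) (m : ℕ) (1≤m : 1 ℕ.≤ m) (ε : Reals.ℝ ℛ)
                  (0<ε : Reals._<_ ℛ (Reals.0# ℛ) ε)
                  (ε≤1 : Reals._≤_ ℛ ε (Reals.1# ℛ)) where
  open OrderedField ℛ
  open Powers ℛ

  M K f q : ℝ
  M = natural m
  K = (1# + ε) / ε
  f = root m K
  q = f ⁻¹

  0≤ε : 0# ≤ ε
  0≤ε = <⇒≤ 0<ε

  0<M : 0# < M
  0<M = natural-pos 1≤m

  0<1+ε : 0# < 1# + ε
  0<1+ε = +-pos 0≤1 0<ε

  εK : ε * K ≡ 1# + ε
  εK = /-cancel 0<ε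

  1≤K : 1# ≤ K
  1≤K = *-cancelˡ-≤ ε 0<ε (subst (ε * 1# ≤_) (sym εK)
    (arith 1 (λ e → (# 0 ⊑ # 1 ∷ []) ⊢ e :* # 1 ≼ # 1 :+ e) refl 0≤1))

  open Root m 1≤m K 1≤K

  1≤f : 1# ≤ f
  1≤f = 1≤root

  0<f : 0# < f
  0<f = <-≤-trans 0<1 1≤f

  fq : f * q ≡ 1#
  fq = ⁻¹-cancel 0<f

  0≤q : 0# ≤ q
  0≤q = ⁻¹-nonneg 0<f

  q≤1 : q ≤ 1#
  q≤1 = arith 2 (λ f q → (# 0 ⊑ q :* (f :- # 1) ∷ f :* q ≗ # 1 ∷ []) ⊢ q ≼ # 1) refl
    (*-nonNegative 0≤q (diff-nonneg 1≤f)) fq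

  0<q : 0# < q
  0<q = 0≤q , λ 0≡q → 0≢1 (trans (sym (zeroʳ f)) (trans (cong (f *_) 0≡q) fq))

  q^≤1 : ∀ n → q ^ n ≤ 1#
  q^≤1 zero    = ≤-refl
  q^≤1 (suc n) = arith 2 (λ q p → (# 0 ⊑ (# 1 :- q) :* p ∷ p ⊑ # 1 ∷ []) ⊢ q :* p ≼ # 1) refl
    (*-nonNegative (diff-nonneg q≤1) (^-nonneg n 0≤q)) (q^≤1 n)

  0≤q^ : ∀ n → 0# ≤ q ^ n
  0≤q^ n = ^-nonneg n 0≤q

  fq^ : ∀ n → f ^ n * q ^ n ≡ 1#
  fq^ n = trans (sym (*-^ f q n)) (trans (cong (_^ n) fq) (1^n n))

  q^m-small : (1# + ε) * q ^ m ≤ ε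
  q^m-small = arith 5 (λ e K F Q z →
      (# 0 ⊑ e :* Q :* (F :- K) ∷ e :* K :* Q ≗˘ (# 1 :+ e) :* Q ∷ e :* (F :* Q) ≗ e :* # 1 ∷ [])
      ⊢ (# 1 :+ e) :* Q ≼ e) refl {x = ε} {x = K} {x = f ^ m} {x = q ^ m} {x = 0#}
    (*-nonNegative (*-nonNegative 0≤ε (^-nonneg m 0≤q)) (diff-nonneg K≤root^m))
    (cong (_* q ^ m) εK) (cong (ε *_) (fq^ m))

  G : ℕ → ℝ
  G zero    = 0#
  G (suc k) = G k + q ^ suc k

  G-geometric : ∀ k → (f - 1#) * G k ≡ 1# - q ^ k
  G-geometric zero    = arith 1 (λ f → [] ⊢ (f :- # 1) :* # 0 ≈ # 1 :- # 1) refl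
  G-geometric (suc k) = arith 4 (λ f q g p →
      ((f :- # 1) :* g ≐ # 1 :- p ∷ f :* q :* p ≐ # 1 :* p ∷ [])
      ⊢ (f :- # 1) :* (g :+ q :* p) ≈ # 1 :- q :* p) refl
    (G-geometric k) (cong (_* q ^ k) fq)

  G-step : ∀ k → G k ≤ G (suc k)
  G-step k = arith 2 (λ a b → (# 0 ⊑ b ∷ []) ⊢ a ≼ a :+ b) refl (^-nonneg (suc k) 0≤q)

  G-growth : ∀ k n → G (n ℕ.+ k) - G k ≤ natural n
  G-growth k zero    = ≤-reflexive (-‿inverseʳ (G k))
  G-growth k (suc n) = subst (G (suc n ℕ.+ k) - G k ≤_) (sym (natural-suc n))
    (arith 4 (λ a b p n → (a :- b ⊑ n ∷ p ⊑ # 1 ∷ []) ⊢ (a :+ p) :- b ≼ # 1 :+ n) refl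
      (G-growth k n) (q^≤1 (suc (n ℕ.+ k))))

  G-mono : ∀ {k n} → k ℕ.≤ n → G k ≤ G n
  G-mono {k} {n} k≤n = subst (λ i → G k ≤ G i) (ℕ.m∸n+n≡m k≤n) (go (n ℕ.∸ k))
    where
    go : ∀ i → G k ≤ G (i ℕ.+ k)
    go zero    = ≤-refl
    go (suc i) = ≤-trans (go i) (G-step (i ℕ.+ k))

  c : ℝ
  c = G m

  σ : ℕ → ℝ
  σ k = c - G k

  G≤ : ∀ k → G k ≤ natural k
  G≤ k = subst₂ _≤_ (arith 1 (λ a → [] ⊢ a :- # 0 ≈ a) refl) refl
    (subst (λ i → G i - 0# ≤ natural k) (ℕ.+-identityʳ k) (G-growth 0 k))

  c≤M : c ≤ M
  c≤M = G≤ m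

  0<c : 0# < c
  0<c = <-≤-trans (subst (0# <_) (arith 1 (λ q → [] ⊢ q ≈ # 0 :+ q :* # 1) refl) 0<q) (G-mono 1≤m)

  0≤c : 0# ≤ c
  0≤c = <⇒≤ 0<c

  0≤G : ∀ k → 0# ≤ G k
  0≤G k = G-mono {0} {k} z≤n

  0≤σ : ∀ {k} → k ℕ.≤ m → 0# ≤ σ k
  0≤σ k≤m = diff-nonneg (G-mono k≤m)

  σ-last : σ m ≡ 0#
  σ-last = -‿inverseʳ c

  k+σ≤M : ∀ {k} → k ℕ.≤ m → natural k + σ k ≤ M
  k+σ≤M {k} k≤m = arith 4 (λ k s d M → (s ⊑ d ∷ d ≗ M :- k ∷ []) ⊢ k :+ s ≼ M) refl
    (subst (λ i → G i - G k ≤ natural (m ℕ.∸ k)) (ℕ.m∸n+n≡m k≤m) (G-growth k (m ℕ.∸ k)))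
    (natural-∸ k≤m)

  fact₁ : 1# ≤ c * (1# + ε) * (f - 1#)
  fact₁ = arith 4 (λ c e f Q →
      ((# 1 :+ e) :* Q ⊑ e ∷ (# 1 :+ e) :* ((f :- # 1) :* c) ≗˘ (# 1 :+ e) :* (# 1 :- Q) ∷ [])
      ⊢ # 1 ≼ c :* (# 1 :+ e) :* (f :- # 1)) refl
    q^m-small (cong ((1# + ε) *_) (G-geometric m))

  0<f-1 : 0# < f - 1#
  0<f-1 = ≰⇒> λ f-1≤0 → <⇒≱ 0<1 (≤-trans fact₁
    (subst (c * (1# + ε) * (f - 1#) ≤_) (zeroʳ _)
      (*-monoʳ-≤ (c * (1# + ε)) (*-nonNegative 0≤c (<⇒≤ 0<1+ε)) f-1≤0)))

  fact₂ : ∀ k → c * q ^ k - σ k ≤ ε * c * (1# - q ^ k)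
  fact₂ k = *-cancelˡ-≤ (f - 1#) 0<f-1
    (arith 6 (λ e F Q p c g →
        (# 0 ⊑ (# 1 :- p) :* (e :- (# 1 :+ e) :* Q)
        ∷ (F :- # 1) :* c :* (p :- # 1 :- e :* (# 1 :- p)) ≗ (# 1 :- Q) :* (p :- # 1 :- e :* (# 1 :- p))
        ∷ (F :- # 1) :* g ≗ # 1 :- p ∷ [])
        ⊢ (F :- # 1) :* (c :* p :- (c :- g)) ≼ (F :- # 1) :* (e :* c :* (# 1 :- p))) refl
      (*-nonNegative (diff-nonneg (q^≤1 k)) (diff-nonneg q^m-small))
      (cong (_* (q ^ k - 1# - ε * (1# - q ^ k))) (G-geometric m)) (G-geometric k))

  fG≤ : ∀ k → f * G k ≤ natural k
  fG≤ zero    = ≤-reflexive (zeroʳ f)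
  fG≤ (suc k) = subst (f * G (suc k) ≤_) (sym (natural-suc k))
    (arith 5 (λ f g q p n → (f :* g ⊑ n ∷ p ⊑ # 1 ∷ f :* q :* p ≗ # 1 :* p ∷ [])
       ⊢ f :* (g :+ q :* p) ≼ # 1 :+ n) refl
      (fG≤ k) (q^≤1 k) (cong (_* q ^ k) fq))

  fact₃ : ∀ k → G k * (c * (1# + ε) + 1#) ≤ natural k * (c * (1# + ε))
  fact₃ k = arith 4 (λ g C f n →
      (# 0 ⊑ g :* (C :* (f :- # 1) :- # 1) ∷ # 0 ⊑ C :* (n :- f :* g) ∷ [])
      ⊢ g :* (C :+ # 1) ≼ n :* C) refl
    (*-nonNegative (0≤G k) (diff-nonneg fact₁))
    (*-nonNegative (*-nonNegative 0≤c (<⇒≤ 0<1+ε)) (diff-nonneg (fG≤ k)))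

  R : ℝ
  R = M * (1# + ε) * (f - 1#)

  M≤Rc : M ≤ R * c
  M≤Rc = arith 4 (λ M e F c → (# 0 ⊑ M :* (c :* (# 1 :+ e) :* (F :- # 1) :- # 1) ∷ [])
      ⊢ M ≼ M :* (# 1 :+ e) :* (F :- # 1) :* c) refl
    (*-nonNegative (<⇒≤ 0<M) (diff-nonneg fact₁))

  private
    power-below-two : ∀ a b {z} → a ℕ.^ 8 ℕ.≤ 2 ℕ.* b ℕ.^ 8 → 1 ℕ.≤ b → 0# ≤ z →
                      natural b * z ≤ natural a → z ^ 8 ≤ natural 2
    power-below-two a b {z} h 1≤b 0≤z bz≤a = *-cancelˡ-≤ (natural b ^ 8)
      (subst (0# <_) (natural-^ b 8) (natural-pos (ℕ.m^n>0 b {{ℕ.>-nonZero 1≤b}} 8)))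
      (≤-trans (≤-reflexive (sym (*-^ (natural b) z 8)))
      (≤-trans (^-mono-≤ 8 (*-nonNegative (natural-nonneg b) 0≤z) bz≤a)
      (≤-trans (≤-reflexive (sym (natural-^ a 8)))
      (≤-trans (natural-mono h)
               (≤-reflexive (trans (natural-* 2 (b ℕ.^ 8))
                 (trans (*-comm _ _) (cong (_* natural 2) (natural-^ b 8)))))))))

    -- x = 18 / (13 m (1 + ε)) is the sum of t = 9 / (13 m) and s.
    x t τ s Z W : ℝ
    x = natural 18 / (natural 13 * M * (1# + ε))
    t = natural 9 / (natural 13 * M)
    τ = natural 9 / (natural 104 * M)
    s = x - t
    Z = (1# + τ) ^ m
    W = (1# + s) ^ m

    pos₁₃ : 0# < natural 13 * M
    pos₁₃ = *-pos (0<natural 12) 0<M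

    x-def : natural 13 * M * (1# + ε) * x ≡ natural 18
    x-def = /-cancel (*-pos pos₁₃ 0<1+ε)

    t-def : natural 13 * M * t ≡ natural 9
    t-def = /-cancel pos₁₃

    τ-def : natural 104 * M * τ ≡ natural 9
    τ-def = /-cancel (*-pos (0<natural 103) 0<M)

    0≤τ : 0# ≤ τ
    0≤τ = <⇒≤ (/-pos (0<natural 8) (*-pos (0<natural 103) 0<M))

    t≡8τ : t ≡ natural 8 * τ
    t≡8τ = *-cancelˡ-≡ (natural 13 * M) pos₁₃
      (arith 3 (λ M t u → (# 13 :* M :* t ≐ # 9 ∷ # 9 ≐ # 104 :* M :* u ∷ [])
        ⊢ # 13 :* M :* t ≈ # 13 :* M :* (# 8 :* u)) refl t-def (sym τ-def))

    0≤t : 0# ≤ t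
    0≤t = <⇒≤ (/-pos (0<natural 8) pos₁₃)

    0≤s : 0# ≤ s
    0≤s = *-cancelˡ-≤ (natural 13 * M * (1# + ε)) (*-pos pos₁₃ 0<1+ε)
      (arith 4 (λ M e x t →
          (# 9 :* e ⊑ # 9 :* # 1 ∷ # 13 :* M :* (# 1 :+ e) :* x ≗˘ # 18
          ∷ (# 1 :+ e) :* (# 13 :* M :* t) ≗ (# 1 :+ e) :* # 9 ∷ [])
          ⊢ # 13 :* M :* (# 1 :+ e) :* # 0 ≼ # 13 :* M :* (# 1 :+ e) :* (x :- t)) refl
        (*-monoʳ-≤ (natural 9) (natural-nonneg 9) ε≤1) x-def (cong ((1# + ε) *_) t-def))

    0≤Z : 0# ≤ Z
    0≤Z = ^-nonneg m (+-nonneg 0≤1 0≤τ)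

    Z-bound : natural 199 * Z ≤ natural 217
    Z-bound = arith 3 (λ M u Z →
        (# 104 :* (Z :* (# 2 :- M :* u)) ⊑ # 104 :* (# 2 :+ M :* u) ∷ (# 1 :+ Z) :* (# 104 :* M :* u) ≗ (# 1 :+ Z) :* # 9 ∷ [])
        ⊢ # 199 :* Z ≼ # 217) refl
      (*-monoʳ-≤ (natural 104) (natural-nonneg 104) (padé m 0≤τ)) (cong ((1# + Z) *_) τ-def)

    t-power : (1# + t) ^ m ≤ natural 2
    t-power = ≤-trans
      (^-mono-≤ m (+-nonneg 0≤1 0≤t)
        (subst (λ u → 1# + u ≤ (1# + τ) ^ 8) (sym t≡8τ) (bernoulli 8 0≤τ)))
      (≤-trans (≤-reflexive (^-swap (1# + τ) 8 m))
        (power-below-two 217 199 (from-yes (217 ℕ.^ 8 ℕ.≤? 2 ℕ.* 199 ℕ.^ 8)) (s≤s z≤n) 0≤Z Z-bound))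

    x-below : Below (1# + x)
    x-below = +-nonneg 0≤1 0≤x , *-cancelˡ-≤ ε 0<ε (subst (ε * (1# + x) ^ m ≤_) (sym εK)
      (≤-trans (*-monoʳ-≤ ε 0≤ε product) step))
      where
      0≤x : 0# ≤ x
      0≤x = arith 2 (λ x t → (# 0 ⊑ x :- t ∷ # 0 ⊑ t ∷ []) ⊢ # 0 ≼ x) refl 0≤s 0≤t
      0≤W : 0# ≤ W
      0≤W = ^-nonneg m (+-nonneg 0≤1 0≤s)
      product : (1# + x) ^ m ≤ natural 2 * W
      product = ≤-trans (^-mono-≤ m (+-nonneg 0≤1 0≤x)
          (arith 2 (λ x t → (# 0 ⊑ t :* (x :- t) ∷ []) ⊢ # 1 :+ x ≼ (# 1 :+ t) :* (# 1 :+ (x :- t))) refl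
            (*-nonNegative 0≤t 0≤s)))
        (≤-trans (≤-reflexive (*-^ (1# + t) (1# + s) m)) (*-monoˡ-≤ W 0≤W t-power))
      step : ε * (natural 2 * W) ≤ 1# + ε
      step = *-cancelˡ-≤ (natural 13) (0<natural 12)
        (arith 5 (λ e W M x t →
          (# 0 ⊑ # 4 :* (W :* (# 1 :- e))
          ∷ # 0 ⊑ # 13 :* (# 1 :+ e) :* (# 1 :- W :* (# 1 :- M :* (x :- t)))
          ∷ W :* (# 13 :* M :* (# 1 :+ e) :* x) ≗ W :* # 18
          ∷ W :* ((# 1 :+ e) :* (# 13 :* M :* t)) ≗˘ W :* ((# 1 :+ e) :* # 9) ∷ [])
          ⊢ # 13 :* (e :* (# 2 :* W)) ≼ # 13 :* (# 1 :+ e)) refl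
        (*-nonNegative (natural-nonneg 4) (*-nonNegative 0≤W (diff-nonneg ε≤1)))
        (*-nonNegative (*-nonNegative (natural-nonneg 13) (<⇒≤ 0<1+ε)) (diff-nonneg (bernoulli⁻ m 0≤s)))
        (cong (W *_) x-def) (cong (λ a → W * ((1# + ε) * a)) t-def))

  -- The ratio is smallest for ε = 1 and m → ∞, where it tends to
  -- 2 ln 2 = 1.386…; the analysis of the algorithm needs 18/13 = 1.384….
  18≤13R : natural 18 ≤ natural 13 * R
  18≤13R = arith 4 (λ M e F x →
      (# 0 ⊑ # 13 :* M :* (# 1 :+ e) :* (F :- (# 1 :+ x)) ∷ # 13 :* M :* (# 1 :+ e) :* x ≗˘ # 18 ∷ [])
      ⊢ # 18 ≼ # 13 :* (M :* (# 1 :+ e) :* (F :- # 1))) refl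
    (*-nonNegative (*-nonNegative (<⇒≤ pos₁₃) (<⇒≤ 0<1+ε)) (diff-nonneg (root-upper (1# + x) x-below)))
    x-def

module Weighting (ℛ : Reals) (m : ℕ) (1≤m : 1 ℕ.≤ m) where
  open OrderedField ℛ

  private
    M D : ℝ
    M = natural m
    D = natural 24 * M

    0<M : 0# < M
    0<M = natural-pos 1≤m

    0≤M : 0# ≤ M
    0≤M = <⇒≤ 0<M

    0<D : 0# < D
    0<D = *-pos (0<natural 23) 0<M

    r : ℕ → ℝ
    r k = natural 13 * natural (2 ℕ.* m ℕ.∸ k) / D

    Dr : ∀ k → D * r k ≡ natural 13 * natural (2 ℕ.* m ℕ.∸ k)
    Dr k = /-cancel 0<D

    2M-k : ∀ {k} → k ℕ.≤ m → natural (2 ℕ.* m ℕ.∸ k) ≡ natural 2 * M - natural k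
    2M-k k≤m = trans (natural-∸ (ℕ.≤-trans k≤m (ℕ.m≤m+n m _))) (cong (_- _) (natural-* 2 m))

    0≤r : ∀ k → 0# ≤ r k
    0≤r k = *-cancelˡ-≤ D 0<D (subst₂ _≤_ (sym (zeroʳ D)) (sym (Dr k))
      (*-nonNegative (natural-nonneg 13) (natural-nonneg (2 ℕ.* m ℕ.∸ k))))

    r-anti : ∀ {j k} → j ℕ.≤ k → r k ≤ r j
    r-anti {j} {k} j≤k = *-cancelˡ-≤ D 0<D (subst₂ _≤_ (sym (Dr k)) (sym (Dr j))
      (*-monoʳ-≤ (natural 13) (natural-nonneg 13) (natural-mono (ℕ.∸-monoʳ-≤ (2 ℕ.* m) j≤k))))

  -- 1 + κ = 18 / 13 is slightly less than 2 ln 2.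
  κ : ℝ
  κ = natural 5 / natural 13

  13κ : natural 13 * κ ≡ natural 5
  13κ = /-cancel (0<natural 12)

  0≤κ : 0# ≤ κ
  0≤κ = <⇒≤ (/-pos (0<natural 4) (0<natural 12))

  -- ψ k = min(1, (13 (2 m − k) / 24 m)²) is log-concave, large enough for
  -- ψ-narrow and small enough for ψ-wide.
  ψ : ℕ → ℝ
  ψ k = 1# ⊓ r k * r k

  0≤ψ : ∀ k → 0# ≤ ψ k
  0≤ψ k = ⊓-glb 0≤1 (square-nonneg (r k))

  ψ≤1 : ∀ k → ψ k ≤ 1#
  ψ≤1 k = x⊓y≤x _ _

  private
    ψ≤r² : ∀ k → ψ k ≤ r k * r k
    ψ≤r² k = x⊓y≤y _ _

    one-early : ∀ {k} → k ℕ.≤ m → 1# ≤ r k * r k → natural 13 * natural k ≤ natural 2 * M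
    one-early {k} k≤m 1≤r² = arith 3
      (λ M k r → (# 24 :* M :* # 1 ⊑ # 24 :* M :* r ∷ # 24 :* M :* r ≗ # 13 :* (# 2 :* M :- k) ∷ [])
        ⊢ # 13 :* k ≼ # 2 :* M) refl
      (*-monoʳ-≤ D (<⇒≤ 0<D) 1≤r) (trans (Dr k) (cong (natural 13 *_) (2M-k k≤m)))
      where
      1≤r : 1# ≤ r k
      1≤r = ≤-by-< λ r<1 → ≤-trans 1≤r²
        (arith 1 (λ r → (# 0 ⊑ r :* (# 1 :- r) ∷ []) ⊢ r :* r ≼ r) refl
          (*-nonNegative (0≤r k) (diff-nonneg (<⇒≤ r<1))))

  ψ-anti : ∀ {j k} → j ℕ.≤ k → ψ k ≤ ψ j
  ψ-anti {j} {k} j≤k = ⊓-glb (ψ≤1 k)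
    (≤-trans (ψ≤r² k) (*-mono-≤ (0≤r k) (0≤r j) (r-anti j≤k) (r-anti j≤k)))

  ψ-narrow : ∀ {k} → k ℕ.≤ m → (1# - ψ k) * (M - natural k) ≤ κ * natural k
  ψ-narrow {k} k≤m with ⊓-case 1# (r k * r k)
  ... | inj₁ ψ≡1 = subst (λ y → (1# - y) * (M - natural k) ≤ κ * natural k) (sym ψ≡1)
    (arith 3 (λ M k c → (# 0 ⊑ c :* k ∷ []) ⊢ (# 1 :- # 1) :* (M :- k) ≼ c :* k) refl
      (*-nonNegative 0≤κ (natural-nonneg k)))
  ... | inj₂ ψ≡r² = subst (λ y → (1# - y) * (M - natural k) ≤ κ * natural k) (sym ψ≡r²)
    (*-cancelˡ-≤ (natural 361 * natural 13 * (D * D)) (*-pos (*-pos (0<natural 360) (0<natural 12)) (*-pos 0<D 0<D))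
      (arith 4 (λ M b c r →
          (# 0 ⊑ (# 19 :* b :- # 7 :* M) :* (# 19 :* b :- # 7 :* M) :* (# 9366 :* M :- # 2197 :* b)
          ∷ # 0 ⊑ # 3079 :* (M :* M :* (M :- b))
          ∷ # 0 ⊑ # 7287 :* (M :* M :* M) :+ # 57 :* (b :* b :* M)
          ∷ # 361 :* # 13 :* (M :- b) :* ((# 24 :* M :* r) :* (# 24 :* M :* r))
              ≗˘ # 361 :* # 13 :* (M :- b) :* ((# 13 :* (# 2 :* M :- b)) :* (# 13 :* (# 2 :* M :- b)))
          ∷ # 361 :* ((# 24 :* M) :* (# 24 :* M)) :* b :* (# 13 :* c) ≗˘ # 361 :* ((# 24 :* M) :* (# 24 :* M)) :* b :* # 5
          ∷ [])
          ⊢ # 361 :* # 13 :* (# 24 :* M :* (# 24 :* M)) :* ((# 1 :- r :* r) :* (M :- b))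
            ≼ # 361 :* # 13 :* (# 24 :* M :* (# 24 :* M)) :* (c :* b)) refl
        (*-nonNegative (square-nonneg _) below)
        (*-nonNegative (natural-nonneg 3079) (*-nonNegative (*-nonNegative 0≤M 0≤M) (diff-nonneg (natural-mono k≤m))))
        (+-nonneg (*-nonNegative (natural-nonneg 7287) (*-nonNegative (*-nonNegative 0≤M 0≤M) 0≤M))
          (*-nonNegative (natural-nonneg 57) (*-nonNegative (square-nonneg (natural k)) 0≤M)))
        (cong (λ y → natural 361 * natural 13 * (M - natural k) * (y * y)) (trans (Dr k) (cong (natural 13 *_) (2M-k k≤m))))
        (cong (natural 361 * (D * D) * natural k *_) 13κ)))
    where
    below : 0# ≤ natural 9366 * M - natural 2197 * natural k
    below = arith 2 (λ M b → (# 0 ⊑ # 7169 :* M ∷ # 2197 :* b ⊑ # 2197 :* M ∷ []) ⊢ # 0 ≼ # 9366 :* M :- # 2197 :* b) refl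
      (*-nonNegative (natural-nonneg 7169) 0≤M)
      (*-monoʳ-≤ (natural 2197) (natural-nonneg 2197) (natural-mono k≤m))

  private
    cubic : ∀ {a b} → 0# ≤ a → a ≤ b → b ≤ M →
      natural 2197 * ((M - b + a) * ((natural 2 * M - a) * (natural 2 * M - a)))
        ≤ natural 2197 * ((M - b) * ((natural 2 * M - b) * (natural 2 * M - b))) + natural 2880 * (M * M * M)
    cubic {a} {b} 0≤a a≤b b≤M = *-cancelˡ-≤ (natural 27 * natural 3375) (*-pos (0<natural 26) (0<natural 3374))
      (arith 3 (λ M a b →
        (# 0 ⊑ # 3375 :* # 2197 :* ((# 2 :* (M :- b :+ a) :- (# 2 :* M :- a)) :* (# 2 :* (M :- b :+ a) :- (# 2 :* M :- a))
                                     :* ((M :- b :+ a) :+ # 4 :* (# 2 :* M :- a)))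
        ∷ # 0 ⊑ # 2197 :* ((# 15 :* b :- # 11 :* M) :* (# 15 :* b :- # 11 :* M) :* (# 979 :* M :- # 345 :* b))
        ∷ # 0 ⊑ # 2197 :* # 315 :* (b :* (M :* M))
        ∷ # 0 ⊑ # 2185577 :* (M :* M :* M) ∷ [])
        ⊢ # 27 :* # 3375 :* (# 2197 :* ((M :- b :+ a) :* ((# 2 :* M :- a) :* (# 2 :* M :- a))))
          ≼ # 27 :* # 3375 :* (# 2197 :* ((M :- b) :* ((# 2 :* M :- b) :* (# 2 :* M :- b))) :+ # 2880 :* (M :* M :* M))) refl
        (*-nonNegative (*-nonNegative (natural-nonneg 3375) (natural-nonneg 2197))
          (*-nonNegative (square-nonneg _) (+-nonneg (+-nonneg (diff-nonneg b≤M) 0≤a)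
            (*-nonNegative (natural-nonneg 4)
              (arith 3 (λ M a b → (# 0 ⊑ M ∷ a ⊑ b ∷ b ⊑ M ∷ []) ⊢ # 0 ≼ # 2 :* M :- a) refl 0≤M a≤b b≤M)))))
        (*-nonNegative (natural-nonneg 2197) (*-nonNegative (square-nonneg _)
          (arith 2 (λ M b → (# 0 ⊑ # 634 :* M ∷ # 345 :* b ⊑ # 345 :* M ∷ []) ⊢ # 0 ≼ # 979 :* M :- # 345 :* b) refl
            (*-nonNegative (natural-nonneg 634) 0≤M) (*-monoʳ-≤ (natural 345) (natural-nonneg 345) b≤M))))
        (*-nonNegative (*-nonNegative (natural-nonneg 2197) (natural-nonneg 315))
          (*-nonNegative (≤-trans 0≤a a≤b) (square-nonneg M)))
        (*-nonNegative (natural-nonneg 2185577) (*-nonNegative (square-nonneg M) 0≤M)))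

  ψ-wide : ∀ {j k} → j ℕ.+ k ℕ.≤ m →
           (M - natural j) * ψ k ≤ (M - natural (j ℕ.+ k)) * ψ (j ℕ.+ k) + κ * M
  ψ-wide {j} {k} j+k≤m with ⊓-case 1# (r (j ℕ.+ k) * r (j ℕ.+ k))
  ... | inj₁ ψ≡1 = subst (λ y → (M - natural j) * ψ k ≤ (M - natural (j ℕ.+ k)) * y + κ * M) (sym ψ≡1)
    (*-cancelˡ-≤ (natural 13) (0<natural 12)
      (arith 5 (λ M j n c y →
          (# 0 ⊑ # 13 :* ((M :- j) :* (# 1 :- y)) ∷ # 13 :* n ⊑ # 2 :* M
          ∷ # 0 ⊑ # 13 :* j ∷ # 13 :* c :* M ≗˘ # 5 :* M ∷ # 0 ⊑ # 3 :* M ∷ [])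
          ⊢ # 13 :* ((M :- j) :* y) ≼ # 13 :* ((M :- n) :* # 1 :+ c :* M)) refl
        (*-nonNegative (natural-nonneg 13) (*-nonNegative 0≤M-j (diff-nonneg (ψ≤1 k))))
        (one-early j+k≤m (subst (_≤ r (j ℕ.+ k) * r (j ℕ.+ k)) ψ≡1 (ψ≤r² (j ℕ.+ k))))
        (*-nonNegative (natural-nonneg 13) (natural-nonneg j))
        (cong (_* M) 13κ) (*-nonNegative (natural-nonneg 3) 0≤M)))
    where
    0≤M-j : 0# ≤ M - natural j
    0≤M-j = diff-nonneg (natural-mono (ℕ.≤-trans (ℕ.m≤m+n j k) j+k≤m))
  ... | inj₂ ψ≡r² = subst (λ y → (M - natural j) * ψ k ≤ (M - natural (j ℕ.+ k)) * y + κ * M) (sym ψ≡r²)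
    (≤-trans (*-monoʳ-≤ (M - natural j) (diff-nonneg (natural-mono j≤m)) (ψ≤r² k))
      (*-cancelˡ-≤ (natural 13 * (D * D)) (*-pos (0<natural 12) (*-pos 0<D 0<D))
        (arith 6 (λ M j k c x y →
            (# 2197 :* ((M :- (j :+ k) :+ k) :* ((# 2 :* M :- k) :* (# 2 :* M :- k)))
              ⊑ # 2197 :* ((M :- (j :+ k)) :* ((# 2 :* M :- (j :+ k)) :* (# 2 :* M :- (j :+ k)))) :+ # 2880 :* (M :* M :* M)
            ∷ # 13 :* (M :- j) :* (# 24 :* M :* x :* (# 24 :* M :* x))
              ≗ # 13 :* (M :- j) :* (# 13 :* (# 2 :* M :- k) :* (# 13 :* (# 2 :* M :- k)))
            ∷ # 13 :* (M :- (j :+ k)) :* (# 24 :* M :* y :* (# 24 :* M :* y))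
              ≗˘ # 13 :* (M :- (j :+ k)) :* (# 13 :* (# 2 :* M :- (j :+ k)) :* (# 13 :* (# 2 :* M :- (j :+ k))))
            ∷ # 576 :* (M :* M :* M) :* (# 13 :* c) ≗˘ # 576 :* (M :* M :* M) :* # 5 ∷ [])
            ⊢ # 13 :* (# 24 :* M :* (# 24 :* M)) :* ((M :- j) :* (x :* x))
              ≼ # 13 :* (# 24 :* M :* (# 24 :* M)) :* ((M :- (j :+ k)) :* (y :* y) :+ c :* M)) refl
          (cubic (natural-nonneg k) k≤b b≤M)
          (cong (λ z → natural 13 * (M - natural j) * (z * z)) (trans (Dr k) (cong (natural 13 *_) (2M-k k≤m))))
          (cong (λ z → natural 13 * (M - (natural j + natural k)) * (z * z))
            (trans (Dr (j ℕ.+ k)) (cong (natural 13 *_) (trans (2M-k j+k≤m) (cong (λ z → natural 2 * M - z) (natural-+ j k))))))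
          (cong (natural 576 * (M * M * M) *_) 13κ)
        |> subst (λ n → natural 13 * (D * D) * ((M - natural j) * (r k * r k))
                     ≤ natural 13 * (D * D) * ((M - n) * (r (j ℕ.+ k) * r (j ℕ.+ k)) + κ * M)) (sym (natural-+ j k)))))
    where
    j≤m : j ℕ.≤ m
    j≤m = ℕ.≤-trans (ℕ.m≤m+n j k) j+k≤m
    k≤m : k ℕ.≤ m
    k≤m = ℕ.≤-trans (ℕ.m≤n+m k j) j+k≤m
    k≤b : natural k ≤ natural j + natural k
    k≤b = arith 2 (λ j k → (# 0 ⊑ j ∷ []) ⊢ k ≼ j :+ k) refl (natural-nonneg j)
    b≤M : natural j + natural k ≤ M
    b≤M = subst (_≤ M) (natural-+ j k) (natural-mono j+k≤m)

  ψ-total : ∀ {j k} → j ℕ.≤ m → m ℕ.≤ j ℕ.+ k → (M - natural j) * ψ k ≤ κ * M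
  ψ-total {j} {k} j≤m m≤j+k = ≤-trans
    (*-monoʳ-≤ (M - natural j) (diff-nonneg (natural-mono j≤m)) (ψ-anti m∸j≤k))
    (≤-trans (ψ-wide {j} {m ℕ.∸ j} (ℕ.≤-reflexive (ℕ.m+[n∸m]≡n j≤m)))
      (subst (λ n → (M - natural n) * ψ n + κ * M ≤ κ * M) (sym (ℕ.m+[n∸m]≡n j≤m))
        (≤-reflexive (arith 3 (λ M y c → [] ⊢ (M :- M) :* y :+ c :* M ≈ c :* M) refl))))
    where
    m∸j≤k : m ℕ.∸ j ℕ.≤ k
    m∸j≤k = ℕ.m≤n+o⇒m∸n≤o m j m≤j+k

  private
    r-concave : ∀ k → r k * r (2 ℕ.+ k) ≤ r (suc k) * r (suc k)
    r-concave k = *-cancelˡ-≤ (D * D) (*-pos 0<D 0<D) (subst₂ _≤_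
        (products (r k) (r (2 ℕ.+ k)) (Dr k) (Dr (2 ℕ.+ k)))
        (products (r (suc k)) (r (suc k)) (Dr (suc k)) (Dr (suc k)))
        (*-monoʳ-≤ (natural 169) (natural-nonneg 169) (subst₂ _≤_
          (natural-* (2 ℕ.* m ℕ.∸ k) (2 ℕ.* m ℕ.∸ (2 ℕ.+ k))) (natural-* (2 ℕ.* m ℕ.∸ suc k) (2 ℕ.* m ℕ.∸ suc k))
          (natural-mono (concave (2 ℕ.* m) k)))))
      where
      products : ∀ x y {a b} → D * x ≡ natural 13 * a → D * y ≡ natural 13 * b →
                 natural 169 * (a * b) ≡ D * D * (x * y)
      products x y {a} {b} p q = arith 5 (λ D x y a b →
          (# 13 :* b :* (# 13 :* a) ≐ # 13 :* b :* (D :* x) ∷ D :* x :* (# 13 :* b) ≐ D :* x :* (D :* y) ∷ [])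
          ⊢ # 169 :* (a :* b) ≈ D :* D :* (x :* y)) refl
        (cong (natural 13 * b *_) (sym p)) (cong (D * x *_) (sym q))
      concave : ∀ n k → (n ℕ.∸ k) ℕ.* (n ℕ.∸ (2 ℕ.+ k)) ℕ.≤ (n ℕ.∸ suc k) ℕ.* (n ℕ.∸ suc k)
      concave n zero          = square n
        where
        square : ∀ n → n ℕ.* (n ℕ.∸ 2) ℕ.≤ (n ℕ.∸ 1) ℕ.* (n ℕ.∸ 1)
        square zero          = z≤n
        square (suc zero)    = z≤n
        square (suc (suc n)) = ℕ.≤-trans (ℕ.≤-reflexive (cong (n ℕ.+_) (sym (ℕ.*-suc n n)))) (ℕ.n≤1+n _)
      concave zero    (suc k) = z≤n
      concave (suc n) (suc k) = concave n k

  ψ-concave : ∀ k → ψ k * ψ (2 ℕ.+ k) ≤ ψ (suc k) * ψ (suc k)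
  ψ-concave k with ⊓-case 1# (r (suc k) * r (suc k))
  ... | inj₁ ψ≡1 = subst (λ y → ψ k * ψ (2 ℕ.+ k) ≤ y * y) (sym ψ≡1)
    (*-mono-≤ (0≤ψ k) 0≤1 (ψ≤1 k) (ψ≤1 (2 ℕ.+ k)))
  ... | inj₂ ψ≡r² = subst (λ y → ψ k * ψ (2 ℕ.+ k) ≤ y * y) (sym ψ≡r²)
    (≤-trans (*-mono-≤ (0≤ψ k) (square-nonneg _) (ψ≤r² k) (ψ≤r² (2 ℕ.+ k)))
      (subst (_≤ r (suc k) * r (suc k) * (r (suc k) * r (suc k)))
        (arith 2 (λ x y → [] ⊢ x :* y :* (x :* y) ≈ x :* x :* (y :* y)) refl)
        (*-mono-≤ 0≤p (square-nonneg _) (r-concave k) (r-concave k))))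
    where
    0≤p : 0# ≤ r k * r (2 ℕ.+ k)
    0≤p = *-nonNegative (0≤r k) (0≤r (2 ℕ.+ k))

  γ : ℕ → ℝ
  γ k with ψ k ≟ 0#
  ... | yes _ = 1#
  ... | no  _ = 1# - ψ (suc k) / ψ k

  ψ-suc : ∀ k → ψ (suc k) ≡ (1# - γ k) * ψ k
  ψ-suc k with ψ k ≟ 0#
  ... | yes ψ≡0 = ≤-antisym
    (≤-trans (ψ-anti (ℕ.n≤1+n k)) (≤-trans (≤-reflexive ψ≡0)
      (≤-reflexive (arith 1 (λ y → [] ⊢ # 0 ≈ (# 1 :- # 1) :* y) refl))))
    (≤-trans (≤-reflexive (arith 1 (λ y → [] ⊢ (# 1 :- # 1) :* y ≈ # 0) refl)) (0≤ψ (suc k)))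
  ... | no ψ≢0 = arith 3 (λ x y z → (x ≐ y :* (x :* z) ∷ []) ⊢ x ≈ (# 1 :- (# 1 :- x :* z)) :* y) refl
    (sym (/-cancel (0≤ψ k , ψ≢0 ∘ sym)))

  0≤γ : ∀ k → 0# ≤ γ k
  0≤γ k with ψ k ≟ 0#
  ... | yes _   = 0≤1
  ... | no  ψ≢0 = diff-nonneg (*-cancelˡ-≤ (ψ k) 0<ψ (subst₂ _≤_ (sym (/-cancel 0<ψ))
    (sym (trans (*-comm _ _) (*-identityˡ _))) (ψ-anti (ℕ.n≤1+n k))))
    where
    0<ψ : 0# < ψ k
    0<ψ = 0≤ψ k , ψ≢0 ∘ sym

  γ≤1 : ∀ k → γ k ≤ 1#
  γ≤1 k with ψ k ≟ 0#
  ... | yes _   = ≤-refl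
  ... | no  ψ≢0 = arith 1 (λ x → (# 0 ⊑ x ∷ []) ⊢ # 1 :- x ≼ # 1) refl
    (*-nonNegative (0≤ψ (suc k)) (⁻¹-nonneg (0≤ψ k , ψ≢0 ∘ sym)))

  γ-mono : ∀ k → γ k ≤ γ (suc k)
  γ-mono k with ψ (suc k) ≟ 0# | γ≤1 k
  ... | yes _    | γ≤1′ = γ≤1′
  ... | no  ψ'≢0 | _ with ψ k ≟ 0#
  ...   | yes ψ≡0 = contradiction (≤-antisym (≤-trans (ψ-anti (ℕ.n≤1+n k)) (≤-reflexive ψ≡0)) (0≤ψ (suc k))) ψ'≢0
  ...   | no  ψ≢0 = arith 2 (λ x y → (x ⊑ y ∷ []) ⊢ # 1 :- y ≼ # 1 :- x) refl
    (*-cancelˡ-≤ (ψ (suc k) * ψ k) (*-pos 0<ψ' 0<ψ)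
      (arith 5 (λ x y z u v → (x :* z ⊑ y :* y ∷ x :* (y :* (z :* u)) ≗ x :* z ∷ y :* (x :* (y :* v)) ≗˘ y :* y ∷ [])
        ⊢ y :* x :* (z :* u) ≼ y :* x :* (y :* v)) refl
        (ψ-concave k) (cong (ψ k *_) (/-cancel 0<ψ')) (cong (ψ (suc k) *_) (/-cancel 0<ψ))))
    where
    0<ψ : 0# < ψ k
    0<ψ = 0≤ψ k , ψ≢0 ∘ sym
    0<ψ' : 0# < ψ (suc k)
    0<ψ' = 0≤ψ (suc k) , ψ'≢0 ∘ sym

≤ᵇ-true : ∀ {j k} → (j ℕ.≤ᵇ k) ≡ true → j ℕ.≤ k
≤ᵇ-true {j} {k} e = ℕ.≤ᵇ⇒≤ j k (subst T (sym e) tt)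

≤ᵇ-false : ∀ {j k} → (j ℕ.≤ᵇ k) ≡ false → k ℕ.< j
≤ᵇ-false {j} {k} e = ℕ.≰⇒> (λ j≤k → subst T e (ℕ.≤⇒≤ᵇ j≤k))

true-or-false : ∀ b → b ≡ true ⊎ b ≡ false
true-or-false true  = inj₁ refl
true-or-false false = inj₂ refl

holds-or-not : {P : Set} → Dec P → P ⊎ ¬ P
holds-or-not (yes p) = inj₁ p
holds-or-not (no ¬p) = inj₂ ¬p

does-true : {P : Set} {d : Dec P} → does d ≡ true → P
does-true {d = yes p} _ = p

does-false : {P : Set} {d : Dec P} → does d ≡ false → ¬ P
does-false {d = no ¬p} _ = ¬p

true-does : {P : Set} (d : Dec P) → P → does d ≡ true
true-does (yes _) p = refl
true-does (no ¬p) p = contradiction p ¬p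

false-does : {P : Set} (d : Dec P) → ¬ P → does d ≡ false
false-does (yes p) ¬p = contradiction p ¬p
false-does (no _)  ¬p = refl

count : {A : Set} → List A → (A → Bool) → ℕ
count []       p = 0
count (x ∷ xs) p = if p x then suc (count xs p) else count xs p

count-≤ : {A : Set} (xs : List A) {p q : A → Bool} →
          (∀ {x} → x ∈ xs → p x ≡ true → q x ≡ true) → count xs p ℕ.≤ count xs q
count-≤ []       h = z≤n
count-≤ (x ∷ xs) {p} {q} h with p x in px | q x in qx
... | true  | true  = s≤s (count-≤ xs (h ∘ there))
... | true  | false = contradiction (trans (sym (h (here refl) px)) qx) λ ()
... | false | true  = ℕ.m≤n⇒m≤1+n (count-≤ xs (h ∘ there))
... | false | false = count-≤ xs (h ∘ there)

count-< : {A : Set} (xs : List A) {p q : A → Bool} →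
          (∀ {x} → x ∈ xs → p x ≡ true → q x ≡ true) →
          ∀ {y} → y ∈ xs → p y ≡ false → q y ≡ true → count xs p ℕ.< count xs q
count-< (x ∷ xs) {p} {q} h (here refl) py qy rewrite py | qy = s≤s (count-≤ xs (h ∘ there))
count-< (x ∷ xs) {p} {q} h (there y∈) py qy with p x in px | q x in qx
... | true  | true  = s≤s (count-< xs (h ∘ there) y∈ py qy)
... | true  | false = contradiction (trans (sym (h (here refl) px)) qx) λ ()
... | false | true  = ℕ.m≤n⇒m≤1+n (count-< xs (h ∘ there) y∈ py qy)
... | false | false = count-< xs (h ∘ there) y∈ py qy

count-cong : {A : Set} (xs : List A) {p q : A → Bool} →
             (∀ {x} → x ∈ xs → p x ≡ q x) → count xs p ≡ count xs q
count-cong xs h = ℕ.≤-antisym (count-≤ xs (λ x∈ px → trans (sym (h x∈)) px))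
                              (count-≤ xs (λ x∈ qx → trans (h x∈) qx))

count≤length : {A : Set} (xs : List A) {p : A → Bool} → count xs p ℕ.≤ length xs
count≤length []       = z≤n
count≤length (x ∷ xs) {p} with p x
... | true  = s≤s (count≤length xs)
... | false = ℕ.m≤n⇒m≤1+n (count≤length xs)

module Summation (ℛ : Reals) where
  open OrderedField ℛ

  private variable
    A B : Set

  ∑ : List A → (A → ℝ) → ℝ
  ∑ []       g = 0#
  ∑ (x ∷ xs) g = g x + ∑ xs g

  [_] : Bool → ℝ
  [ b ] = if b then 1# else 0#

  0≤[] : ∀ b → 0# ≤ [ b ]
  0≤[] true  = 0≤1
  0≤[] false = ≤-refl

  []≤1 : ∀ b → [ b ] ≤ 1#
  []≤1 true  = ≤-refl
  []≤1 false = 0≤1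

  ∑-cong : ∀ (xs : List A) {g h : A → ℝ} → (∀ {x} → x ∈ xs → g x ≡ h x) → ∑ xs g ≡ ∑ xs h
  ∑-cong []       eq = refl
  ∑-cong (x ∷ xs) eq = cong₂ _+_ (eq (here refl)) (∑-cong xs (eq ∘ there))

  ∑-mono : ∀ (xs : List A) {g h : A → ℝ} → (∀ {x} → x ∈ xs → g x ≤ h x) → ∑ xs g ≤ ∑ xs h
  ∑-mono []       le = ≤-refl
  ∑-mono (x ∷ xs) le = +-mono-≤ (le (here refl)) (∑-mono xs (le ∘ there))

  ∑-zero : ∀ (xs : List A) → ∑ xs (λ _ → 0#) ≡ 0#
  ∑-zero []       = refl
  ∑-zero (x ∷ xs) = trans (+-identityˡ _) (∑-zero xs)

  ∑-nonneg : ∀ (xs : List A) {g : A → ℝ} → (∀ {x} → x ∈ xs → 0# ≤ g x) → 0# ≤ ∑ xs g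
  ∑-nonneg xs {g} h = subst (_≤ ∑ xs g) (∑-zero xs) (∑-mono xs h)

  ∑-nonpos : ∀ (xs : List A) {g : A → ℝ} → (∀ {x} → x ∈ xs → g x ≤ 0#) → ∑ xs g ≤ 0#
  ∑-nonpos xs {g} h = subst (∑ xs g ≤_) (∑-zero xs) (∑-mono xs h)

  ∑-member : ∀ (xs : List A) {g : A → ℝ} {x} → x ∈ xs → (∀ {y} → y ∈ xs → 0# ≤ g y) → g x ≤ ∑ xs g
  ∑-member (x ∷ xs) (here refl) h =
    arith 2 (λ a b → (# 0 ⊑ b ∷ []) ⊢ a ≼ a :+ b) refl (∑-nonneg xs (h ∘ there))
  ∑-member (y ∷ xs) (there x∈) h =
    arith 3 (λ a b c → (# 0 ⊑ a ∷ c ⊑ b ∷ []) ⊢ c ≼ a :+ b) refl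
      (h (here refl)) (∑-member xs x∈ (h ∘ there))

  ∑-+ : ∀ (xs : List A) (g h : A → ℝ) → ∑ xs (λ x → g x + h x) ≡ ∑ xs g + ∑ xs h
  ∑-+ []       g h = sym (+-identityˡ 0#)
  ∑-+ (x ∷ xs) g h = arith 5
    (λ a b c d e → (c ≐ d :+ e ∷ []) ⊢ a :+ b :+ c ≈ (a :+ d) :+ (b :+ e)) refl (∑-+ xs g h)

  ∑-- : ∀ (xs : List A) (g h : A → ℝ) → ∑ xs (λ x → g x - h x) ≡ ∑ xs g - ∑ xs h
  ∑-- []       g h = sym (-‿inverseʳ 0#)
  ∑-- (x ∷ xs) g h = arith 5
    (λ a b c d e → (c ≐ d :- e ∷ []) ⊢ (a :- b) :+ c ≈ (a :+ d) :- (b :+ e)) refl (∑-- xs g h)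

  ∑-*ˡ : ∀ (xs : List A) k (g : A → ℝ) → ∑ xs (λ x → k * g x) ≡ k * ∑ xs g
  ∑-*ˡ []       k g = sym (zeroʳ k)
  ∑-*ˡ (x ∷ xs) k g = arith 4
    (λ k a b c → (b ≐ k :* c ∷ []) ⊢ k :* a :+ b ≈ k :* (a :+ c)) refl (∑-*ˡ xs k g)

  ∑-*ʳ : ∀ (xs : List A) k (g : A → ℝ) → ∑ xs (λ x → g x * k) ≡ ∑ xs g * k
  ∑-*ʳ xs k g = trans (∑-cong xs (λ _ → *-comm _ k)) (trans (∑-*ˡ xs k g) (*-comm k _))

  ∑-++ : ∀ (xs ys : List A) (g : A → ℝ) → ∑ (xs ++ ys) g ≡ ∑ xs g + ∑ ys g
  ∑-++ []       ys g = sym (+-identityˡ _)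
  ∑-++ (x ∷ xs) ys g = trans (cong (g x +_) (∑-++ xs ys g)) (sym (+-assoc _ _ _))

  ∑-swap : ∀ (xs : List A) (ys : List B) (g : A → B → ℝ) →
           ∑ xs (λ x → ∑ ys (g x)) ≡ ∑ ys (λ y → ∑ xs (λ x → g x y))
  ∑-swap []       ys g = sym (∑-zero ys)
  ∑-swap (x ∷ xs) ys g = trans (cong (∑ ys (g x) +_) (∑-swap xs ys g))
    (sym (∑-+ ys (g x) (λ y → ∑ xs (λ x → g x y))))

  ∑-map : ∀ (f : A → B) (xs : List A) (g : B → ℝ) → ∑ (map f xs) g ≡ ∑ xs (g ∘ f)
  ∑-map f []       g = refl
  ∑-map f (x ∷ xs) g = cong (g (f x) +_) (∑-map f xs g)

  natural-count : ∀ (xs : List A) p → natural (count xs p) ≡ ∑ xs (λ x → [ p x ])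
  natural-count []       p = refl
  natural-count (x ∷ xs) p with p x
  ... | true  = trans (natural-suc (count xs p)) (cong (1# +_) (natural-count xs p))
  ... | false = trans (natural-count xs p) (sym (+-identityˡ _))

  ∑-const : ∀ (xs : List A) k → ∑ xs (λ _ → k) ≡ natural (length xs) * k
  ∑-const []       k = sym (zeroˡ k)
  ∑-const (x ∷ xs) k = trans (cong (k +_) (∑-const xs k))
    (trans (arith 2 (λ n k → [] ⊢ k :+ n :* k ≈ (# 1 :+ n) :* k) refl)
           (cong (_* k) (sym (natural-suc (length xs)))))

  -- Summation by parts: raising the weights from 0 to g, a nondecreasing
  -- function of rank, cannot exceed what raising them to 1 on some set
  -- {rank ≥ k} does.
  module _ (xs : List A) (rank : A → ℕ) (D : A → ℝ) (g : ℕ → ℝ)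
           (g-mono : ∀ k → g k ≤ g (suc k)) (g≤1 : ∀ k → g k ≤ 1#) (0≤g : ∀ k → 0# ≤ g k)
           (b : ℝ) (0≤b : 0# ≤ b) where

    private
      above : ℕ → (A → ℝ) → ℝ
      above k h = ∑ xs (λ x → [ k ℕ.≤ᵇ rank x ] * h x)

      above-suc : ∀ k (h : A → ℝ) (l : ℝ) →
        above k (λ x → g (rank x) * D x) - l * above k D
          ≡ (above (suc k) (λ x → g (rank x) * D x) - g k * above (suc k) D) + (g k - l) * above k D
      above-suc k h l = begin
        above k gD - l * above k D
          ≡⟨ cong (λ z → above k gD - z) (sym (∑-*ˡ xs l _)) ⟩
        above k gD - ∑ xs (λ x → l * (at k x * D x))
          ≡⟨ sym (∑-- xs _ _) ⟩
        ∑ xs (λ x → at k x * gD x - l * (at k x * D x))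
          ≡⟨ ∑-cong xs (λ {x} _ → pointwise x) ⟩
        ∑ xs (λ x → (at (suc k) x * gD x - g k * (at (suc k) x * D x)) + (g k - l) * (at k x * D x))
          ≡⟨ ∑-+ xs _ _ ⟩
        ∑ xs (λ x → at (suc k) x * gD x - g k * (at (suc k) x * D x)) + ∑ xs (λ x → (g k - l) * (at k x * D x))
          ≡⟨ cong₂ _+_ (trans (∑-- xs _ _) (cong (λ z → above (suc k) gD - z) (∑-*ˡ xs (g k) _)))
                       (∑-*ˡ xs (g k - l) _) ⟩
        (above (suc k) gD - g k * above (suc k) D) + (g k - l) * above k D ∎
        where
        open ≡-Reasoning
        gD : A → ℝ
        gD x = g (rank x) * D x
        at : ℕ → A → ℝ
        at i x = [ i ℕ.≤ᵇ rank x ]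
        pointwise : ∀ x → at k x * gD x - l * (at k x * D x)
          ≡ (at (suc k) x * gD x - g k * (at (suc k) x * D x)) + (g k - l) * (at k x * D x)
        pointwise x with k ℕ.≤ᵇ rank x in e | suc k ℕ.≤ᵇ rank x in e'
        ... | true  | true  = arith 4 (λ g h l d → [] ⊢
          # 1 :* (g :* d) :- l :* (# 1 :* d) ≈ (# 1 :* (g :* d) :- h :* (# 1 :* d)) :+ (h :- l) :* (# 1 :* d)) refl
        ... | true  | false = arith 4 (λ g h l d → (g :* d ≐ h :* d ∷ []) ⊢
          # 1 :* (g :* d) :- l :* (# 1 :* d) ≈ (# 0 :* (g :* d) :- h :* (# 0 :* d)) :+ (h :- l) :* (# 1 :* d)) refl
          (cong (λ j → g j * D x) (ℕ.≤-antisym (ℕ.≤-pred (≤ᵇ-false {suc k} {rank x} e')) (≤ᵇ-true {k} {rank x} e)))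
        ... | false | true  = contradiction (ℕ.<⇒≤ (≤ᵇ-true {suc k} {rank x} e')) (ℕ.<⇒≱ (≤ᵇ-false {k} {rank x} e))
        ... | false | false = arith 4 (λ g h l d → [] ⊢
          # 0 :* (g :* d) :- l :* (# 0 :* d) ≈ (# 0 :* (g :* d) :- h :* (# 0 :* d)) :+ (h :- l) :* (# 0 :* d)) refl

      above-beyond : ∀ K (h : A → ℝ) → (∀ {x} → x ∈ xs → rank x ℕ.< K) → above K h ≡ 0#
      above-beyond K h bound = trans (∑-cong xs zero-term) (∑-zero xs)
        where
        zero-term : ∀ {x} → x ∈ xs → [ K ℕ.≤ᵇ rank x ] * h x ≡ 0#
        zero-term {x} x∈ with K ℕ.≤ᵇ rank x in e
        ... | true  = contradiction (bound x∈) (ℕ.≤⇒≯ (≤ᵇ-true e))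
        ... | false = zeroˡ _

      rank-bound : ∀ (ys : List A) → ∃[ K ] (∀ {x} → x ∈ ys → rank x ℕ.< K)
      rank-bound []       = 0 , λ ()
      rank-bound (y ∷ ys) with rank-bound ys
      ... | K , bound = suc (rank y) ℕ.+ K , λ where
        (here refl) → ℕ.m≤m+n _ K
        (there x∈)  → ℕ.≤-trans (bound x∈) (ℕ.m≤n+m K _)

      descend : (∀ k → above k D ≤ b) → ∀ i k → (∀ {x} → x ∈ xs → rank x ℕ.< i ℕ.+ k) →
                ∀ l → l ≤ g k → l ≤ 1# →
                above k (λ x → g (rank x) * D x) - l * above k D ≤ (1# - l) * b
      descend h zero    k bound l l≤g l≤1 = subst (_≤ (1# - l) * b)
        (sym (trans (cong₂ (λ y z → y - l * z) (above-beyond k _ bound) (above-beyond k D bound))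
                    (arith 1 (λ l → [] ⊢ # 0 :- l :* # 0 ≈ # 0) refl)))
        (*-nonNegative (diff-nonneg l≤1) 0≤b)
      descend h (suc i) k bound l l≤g l≤1 = subst (_≤ (1# - l) * b) (sym (above-suc k D l))
        (arith 5 (λ X T g l b → (X ⊑ (# 1 :- g) :* b ∷ (g :- l) :* T ⊑ (g :- l) :* b ∷ [])
            ⊢ X :+ (g :- l) :* T ≼ (# 1 :- l) :* b) refl
          (descend h i (suc k) (λ {x} x∈ → subst (rank x ℕ.<_) (sym (ℕ.+-suc i k)) (bound x∈)) (g k) (g-mono k) (g≤1 k))
          (*-monoʳ-≤ (g k - l) (diff-nonneg l≤g) (h k)))

    by-parts : (∀ k → ∑ xs (λ x → [ k ℕ.≤ᵇ rank x ] * D x) ≤ b) →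
               ∑ xs (λ x → g (rank x) * D x) ≤ b
    by-parts h = subst (_≤ b) (∑-cong xs λ _ → *-identityˡ _)
      (arith 3 (λ X T b → (X :- # 0 :* T ⊑ (# 1 :- # 0) :* b ∷ []) ⊢ X ≼ b) refl
        (descend h (proj₁ K) 0 (λ {x} x∈ → subst (rank x ℕ.<_) (sym (ℕ.+-identityʳ _)) (proj₂ K x∈)) 0# (0≤g 0) 0≤1))
      where
      K = rank-bound xs

module Volumes (ℛ : Reals) where
  open OrderedField ℛ
  open Summation ℛ

  -- The part of a job with remaining time r and deadline d that has to be
  -- processed before D, if nothing but this job is taken into account.
  share : ℝ → ℝ → ℝ → ℝ
  share r d D = 0# ⊔ (r ⊓ (D - (d - r)))

  module _ {r d : ℝ} where

    0≤share : ∀ D → 0# ≤ share r d D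
    0≤share D = x≤x⊔y _ _

    share≤r : ∀ D → 0# ≤ r → share r d D ≤ r
    share≤r D 0≤r = ⊔-lub 0≤r (x⊓y≤x _ _)

    share-mono : ∀ {D D'} → D ≤ D' → share r d D ≤ share r d D'
    share-mono {D} {D'} D≤D' = ⊔-lub (x≤x⊔y _ _) (≤-trans
      (⊓-glb (x⊓y≤x _ _) (≤-trans (x⊓y≤y _ _) (+-monoˡ-≤ (- (d - r)) D≤D')))
      (y≤x⊔y _ _))

    share≤laxity : ∀ {D} → d - r ≤ D → share r d D ≤ D - (d - r)
    share≤laxity ℓ≤D = ⊔-lub (diff-nonneg ℓ≤D) (x⊓y≤y _ _)

    laxity≤share : ∀ {D} → D ≤ d → D - (d - r) ≤ share r d D
    laxity≤share {D} D≤d = ≤-trans (⊓-glb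
      (arith 3 (λ D d r → (D ⊑ d ∷ []) ⊢ D :- (d :- r) ≼ r) refl D≤d) ≤-refl) (y≤x⊔y _ _)

    share-late : ∀ {D} → 0# ≤ r → d ≤ D → share r d D ≡ r
    share-late {D} 0≤r d≤D = ≤-antisym (share≤r D 0≤r) (≤-trans (⊓-glb ≤-refl
      (arith 3 (λ D d r → (d ⊑ D ∷ []) ⊢ r ≼ D :- (d :- r)) refl d≤D)) (y≤x⊔y _ _))

    share-early : ∀ {D} → D ≤ d - r → share r d D ≡ 0#
    share-early {D} D≤ℓ = ≤-antisym (⊔-lub ≤-refl (≤-trans (x⊓y≤y _ _)
      (arith 3 (λ D d r → (D ⊑ d :- r ∷ []) ⊢ D :- (d :- r) ≼ # 0) refl D≤ℓ))) (0≤share D)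

    share-middle : ∀ {D} → d - r ≤ D → D ≤ d → share r d D ≡ D - (d - r)
    share-middle ℓ≤D D≤d = ≤-antisym (share≤laxity ℓ≤D) (laxity≤share D≤d)

  share-anti : ∀ {r r' d D} → r' ≤ r → share r' d D ≤ share r d D
  share-anti {r} {r'} {d} {D} r'≤r = ⊔-lub (x≤x⊔y _ _) (≤-trans
    (⊓-glb (≤-trans (x⊓y≤x _ _) r'≤r) (≤-trans (x⊓y≤y _ _)
      (arith 4 (λ r s d D → (s ⊑ r ∷ []) ⊢ D :- (d :- s) ≼ D :- (d :- r)) refl r'≤r)))
    (y≤x⊔y _ _))

  share-run : ∀ {r d D δ} → δ ≤ r → 0# ≤ δ → d - r + δ ≤ D →
              share (r - δ) d D ≡ share r d D - δ
  share-run {r} {d} {D} {δ} δ≤r 0≤δ ℓ+δ≤D with total D d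
  ... | inj₁ D≤d = trans
    (share-middle (arith 4 (λ r d D e → (d :- r :+ e ⊑ D ∷ []) ⊢ d :- (r :- e) ≼ D) refl ℓ+δ≤D) D≤d)
    (trans (arith 4 (λ r d D e → [] ⊢ D :- (d :- (r :- e)) ≈ D :- (d :- r) :- e) refl)
      (cong (_- δ) (sym (share-middle
        (arith 4 (λ r d D e → (d :- r :+ e ⊑ D ∷ # 0 ⊑ e ∷ []) ⊢ d :- r ≼ D) refl ℓ+δ≤D 0≤δ) D≤d))))
  ... | inj₂ d≤D = trans (share-late (diff-nonneg δ≤r) d≤D)
    (cong (_- δ) (sym (share-late (≤-trans 0≤δ δ≤r) d≤D)))

  share-convex : ∀ {r d a D b} → 0# ≤ r → a ≤ D → D ≤ b → d ≤ a ⊎ b ≤ d →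
                 (b - a) * share r d D ≤ (b - D) * share r d a + (D - a) * share r d b
  share-convex {r} {d} {a} {D} {b} 0≤r a≤D D≤b (inj₁ d≤a) =
    arith 7 (λ r a D b x y z →
        ((b :- a) :* x ≗ (b :- a) :* r ∷ (b :- D) :* y ≗˘ (b :- D) :* r ∷ (D :- a) :* z ≗˘ (D :- a) :* r ∷ [])
        ⊢ (b :- a) :* x ≼ (b :- D) :* y :+ (D :- a) :* z) refl
      (cong ((b - a) *_) (share-late 0≤r (≤-trans d≤a a≤D)))
      (cong ((b - D) *_) (share-late 0≤r d≤a))
      (cong ((D - a) *_) (share-late 0≤r (≤-trans d≤a (≤-trans a≤D D≤b))))
  share-convex {r} {d} {a} {D} {b} 0≤r a≤D D≤b (inj₂ b≤d) with total D (d - r)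
  ... | inj₁ D≤ℓ = ≤-trans (≤-reflexive (trans (cong ((b - a) *_) (share-early D≤ℓ)) (zeroʳ _)))
    (+-nonneg (*-nonNegative (diff-nonneg D≤b) (0≤share a)) (*-nonNegative (diff-nonneg a≤D) (0≤share b)))
  ... | inj₂ ℓ≤D = subst (λ z → (b - a) * z ≤ (b - D) * share r d a + (D - a) * share r d b)
    (sym (share-middle ℓ≤D (≤-trans D≤b b≤d)))
    (arith 6 (λ l a D b x y →
        (# 0 ⊑ (b :- D) :* (x :- (a :- l)) ∷ # 0 ⊑ (D :- a) :* (y :- (b :- l)) ∷ [])
        ⊢ (b :- a) :* (D :- l) ≼ (b :- D) :* x :+ (D :- a) :* y) refl
      (*-nonNegative (diff-nonneg D≤b) (diff-nonneg (laxity≤share (≤-trans (≤-trans a≤D D≤b) b≤d))))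
      (*-nonNegative (diff-nonneg a≤D) (diff-nonneg (laxity≤share b≤d))))

  record Task : Set where
    constructor task
    field
      id   : ℕ
      rel  : ℝ
      dl   : ℝ
      size : ℝ

  open Task public

  module _ (es : List Task) (rem : Task → ℝ) where

    V : ℝ → ℝ
    V D = ∑ es (λ e → share (rem e) (dl e) D)

    0≤V : ∀ D → 0# ≤ V D
    0≤V D = ∑-nonneg es (λ _ → 0≤share D)

    V-mono : ∀ {D D'} → D ≤ D' → V D ≤ V D'
    V-mono D≤D' = ∑-mono es (λ _ → share-mono D≤D')

    V-convex : ∀ {a D b} → (∀ {e} → e ∈ es → 0# ≤ rem e) → a ≤ D → D ≤ b →
               (∀ {e} → e ∈ es → dl e ≤ a ⊎ b ≤ dl e) →
               (b - a) * V D ≤ (b - D) * V a + (D - a) * V b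
    V-convex {a} {D} {b} 0≤rem a≤D D≤b apart = subst₂ _≤_ (∑-*ˡ es _ _)
      (trans (∑-+ es _ _) (cong₂ _+_ (∑-*ˡ es _ _) (∑-*ˡ es _ _)))
      (∑-mono es (λ e∈ → share-convex (0≤rem e∈) a≤D D≤b (apart e∈)))

    -- V is convex between consecutive deadlines, so that a linear bound
    -- need only be checked there and at the two ends of the interval.
    V-linear-bound : ∀ α β → (∀ {e} → e ∈ es → 0# ≤ rem e) → ∀ bs lo hi D → lo ≤ D → D ≤ hi →
      V lo ≤ α * lo + β → V hi ≤ α * hi + β →
      (∀ {b} → b ∈ bs → lo ≤ b → b ≤ hi → V b ≤ α * b + β) →
      (∀ {e} → e ∈ es → dl e ∈ bs ⊎ dl e ≤ lo ⊎ hi ≤ dl e) →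
      V D ≤ α * D + β
    V-linear-bound α β 0≤rem [] lo hi D lo≤D D≤hi Vlo Vhi Vb apart with hi ≤? lo
    ... | yes hi≤lo = subst (λ x → V x ≤ α * x + β) (≤-antisym lo≤D (≤-trans D≤hi hi≤lo)) Vlo
    ... | no  hi≰lo = *-cancelˡ-≤ (hi - lo) (<-diff (≰⇒> hi≰lo))
      (arith 8 (λ lo hi D α β x y z →
          ((hi :- lo) :* x ⊑ (hi :- D) :* y :+ (D :- lo) :* z
          ∷ (hi :- D) :* y ⊑ (hi :- D) :* (α :* lo :+ β) ∷ (D :- lo) :* z ⊑ (D :- lo) :* (α :* hi :+ β) ∷ [])
          ⊢ (hi :- lo) :* x ≼ (hi :- lo) :* (α :* D :+ β)) refl
        (V-convex 0≤rem lo≤D D≤hi (λ {e} e∈ → outside {e} (apart e∈)))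
        (*-monoʳ-≤ (hi - D) (diff-nonneg D≤hi) Vlo) (*-monoʳ-≤ (D - lo) (diff-nonneg lo≤D) Vhi))
      where
      outside : ∀ {e} → dl e ∈ [] ⊎ dl e ≤ lo ⊎ hi ≤ dl e → dl e ≤ lo ⊎ hi ≤ dl e
      outside (inj₂ o) = o
    V-linear-bound α β 0≤rem (b ∷ bs) lo hi D lo≤D D≤hi Vlo Vhi Vb apart with b ≤? lo | hi ≤? b
    ... | yes b≤lo | _ = V-linear-bound α β 0≤rem bs lo hi D lo≤D D≤hi Vlo Vhi (Vb ∘ there)
      (λ {e} e∈ → drop {e} (apart e∈))
      where
      drop : ∀ {e} → dl e ∈ (b ∷ bs) ⊎ dl e ≤ lo ⊎ hi ≤ dl e → dl e ∈ bs ⊎ dl e ≤ lo ⊎ hi ≤ dl e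
      drop (inj₁ (here refl)) = inj₂ (inj₁ b≤lo)
      drop (inj₁ (there ∈bs)) = inj₁ ∈bs
      drop (inj₂ o)           = inj₂ o
    ... | no _ | yes hi≤b = V-linear-bound α β 0≤rem bs lo hi D lo≤D D≤hi Vlo Vhi (Vb ∘ there)
      (λ {e} e∈ → drop {e} (apart e∈))
      where
      drop : ∀ {e} → dl e ∈ (b ∷ bs) ⊎ dl e ≤ lo ⊎ hi ≤ dl e → dl e ∈ bs ⊎ dl e ≤ lo ⊎ hi ≤ dl e
      drop (inj₁ (here refl)) = inj₂ (inj₂ hi≤b)
      drop (inj₁ (there ∈bs)) = inj₁ ∈bs
      drop (inj₂ o)           = inj₂ o
    ... | no b≰lo | no hi≰b with total D b
    ...   | inj₁ D≤b = V-linear-bound α β 0≤rem bs lo b D lo≤D D≤b Vlo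
      (Vb (here refl) (≰⇒≥ b≰lo) (≰⇒≥ hi≰b)) (λ c∈ lo≤c c≤b → Vb (there c∈) lo≤c (≤-trans c≤b (≰⇒≥ hi≰b)))
      (λ {e} e∈ → narrow {e} (apart e∈))
      where
      narrow : ∀ {e} → dl e ∈ (b ∷ bs) ⊎ dl e ≤ lo ⊎ hi ≤ dl e → dl e ∈ bs ⊎ dl e ≤ lo ⊎ b ≤ dl e
      narrow (inj₁ (here refl))  = inj₂ (inj₂ ≤-refl)
      narrow (inj₁ (there ∈bs))  = inj₁ ∈bs
      narrow (inj₂ (inj₁ d≤lo))  = inj₂ (inj₁ d≤lo)
      narrow (inj₂ (inj₂ hi≤d))  = inj₂ (inj₂ (≤-trans (≰⇒≥ hi≰b) hi≤d))
    ...   | inj₂ b≤D = V-linear-bound α β 0≤rem bs b hi D b≤D D≤hi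
      (Vb (here refl) (≰⇒≥ b≰lo) (≰⇒≥ hi≰b)) Vhi (λ c∈ b≤c c≤hi → Vb (there c∈) (≤-trans (≰⇒≥ b≰lo) b≤c) c≤hi)
      (λ {e} e∈ → narrow {e} (apart e∈))
      where
      narrow : ∀ {e} → dl e ∈ (b ∷ bs) ⊎ dl e ≤ lo ⊎ hi ≤ dl e → dl e ∈ bs ⊎ dl e ≤ b ⊎ hi ≤ dl e
      narrow (inj₁ (here refl))  = inj₂ (inj₁ ≤-refl)
      narrow (inj₁ (there ∈bs))  = inj₁ ∈bs
      narrow (inj₂ (inj₁ d≤lo))  = inj₂ (inj₁ (≤-trans d≤lo (≰⇒≥ b≰lo)))
      narrow (inj₂ (inj₂ hi≤d))  = inj₂ (inj₂ hi≤d)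

module States (ℛ : Reals) (m : ℕ) (1≤m : 1 ℕ.≤ m) (ε : Reals.ℝ ℛ)
               (0<ε : Reals._<_ ℛ (Reals.0# ℛ) ε)
               (ε≤1 : Reals._≤_ ℛ ε (Reals.1# ℛ)) where
  open OrderedField ℛ
  open Summation ℛ
  open Volumes ℛ
  open Parameters ℛ m 1≤m ε 0<ε ε≤1
  open Scheduling ℛ using (Schedule)

  -- Jobs submitted before the threshold are rejected if they are due
  -- before it; the union of the intervals [t, threshold] so far has length
  -- used.  While t < threshold the machines are reserved for the work due
  -- before the threshold; work k is all processing of job k up to now, and
  -- idle k the part of it that was done while t = threshold.
  record State : Set where
    field
      now       : ℝ
      threshold : ℝ
      used      : ℝ
      tasks     : List Task
      work      : ℕ → ℝ
      idle      : ℕ → ℝ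
      segs      : Schedule m

    rem : Task → ℝ
    rem e = size e - work (id e)

    start-by : Task → ℝ
    start-by e = dl e - rem e

    Vol : ℝ → ℝ
    Vol = V tasks rem

  record Sound (s : State) : Set where
    open State s
    field
      now≤threshold : now ≤ threshold
      0≤used        : 0# ≤ used
      distinct      : AllPairs (λ e e' → id e ≢ id e') tasks
      fresh         : ∀ {e} → e ∈ tasks → id e ℕ.< length tasks
      fresh-work    : ∀ k → length tasks ℕ.≤ k → work k ≡ 0#
      fresh-idle    : ∀ k → length tasks ℕ.≤ k → idle k ≡ 0#
      0≤work        : ∀ k → 0# ≤ work k
      0≤rem         : ∀ {e} → e ∈ tasks → 0# ≤ rem e
      rel≤now       : ∀ {e} → e ∈ tasks → rel e ≤ now
      far-volume    : ∀ {D} → threshold ≤ D → Vol D ≤ Vol threshold + c * (D - threshold)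
      -- For k = m, the volume due before D does not exceed the capacity left.
      -- The other bounds ensure that this persists when the threshold is
      -- raised.
      near-volume   : ∀ {k D} → k ℕ.≤ m → now ≤ D → D ≤ threshold →
                      Vol D ≤ natural k * (D - now) + σ k * (threshold - now)
      far-task      : ∀ {e} → e ∈ tasks → threshold < dl e →
                      idle (id e) + rem e ≡ size e ⊎ dl e - threshold ≤ rem e
      -- A block of length x is paid for by work of volume c x.
      account       : c * used + ∑ tasks (idle ∘ id) ≡ ∑ tasks (work ∘ id) + Vol threshold

    Vol-now : Vol now ≡ 0#
    Vol-now = ≤-antisym
      (≤-trans (near-volume {m} ℕ.≤-refl ≤-refl now≤threshold) (≤-reflexive
        (trans (cong (λ x → natural m * (now - now) + x * (threshold - now)) σ-last)
          (arith 3 (λ M t h → [] ⊢ M :* (t :- t) :+ # 0 :* (h :- t) ≈ # 0) refl))))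
      (0≤V tasks rem now)

    no-share : ∀ {e} → e ∈ tasks → share (rem e) (dl e) now ≤ 0#
    no-share e∈ = ≤-trans (∑-member tasks e∈ (λ _ → 0≤share now)) (≤-reflexive Vol-now)

    now≤start-by : ∀ {e} → e ∈ tasks → 0# < rem e → now ≤ start-by e
    now≤start-by {e} e∈ 0<rem = ≮⇒≥ λ late → contradiction
      (≤-trans (y≤x⊔y _ _) (no-share e∈))
      (<⇒≱ (positive late))
      where
      positive : start-by e < now → 0# < rem e ⊓ (now - start-by e)
      positive late with ⊓-case (rem e) (now - start-by e)
      ... | inj₁ eq = subst (0# <_) (sym eq) 0<rem
      ... | inj₂ eq = subst (0# <_) (sym eq) (<-diff late)

    now<dl : ∀ {e} → e ∈ tasks → 0# < rem e → now < dl e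
    now<dl {e} e∈ 0<rem = ≤-<-trans (now≤start-by e∈ 0<rem)
      (<-diff⁻¹ (subst (0# <_) (arith 2 (λ d r → [] ⊢ r ≈ d :- (d :- r)) refl) 0<rem))

    pending-or-done : ∀ {e} → e ∈ tasks → 0# < rem e ⊎ rem e ≡ 0#
    pending-or-done {e} e∈ with 0# <? rem e
    ... | yes 0<rem = inj₁ 0<rem
    ... | no  0≮rem = inj₂ (≤-antisym (≮⇒≥ 0≮rem) (0≤rem e∈))

    Vol≤k : ∀ {D} → now ≤ D → D ≤ threshold → Vol D ≤ M * (D - now)
    Vol≤k {D} now≤D D≤h = ≤-trans (near-volume {m} ℕ.≤-refl now≤D D≤h) (≤-reflexive
      (trans (cong (λ x → M * (D - now) + x * (threshold - now)) σ-last)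
        (arith 2 (λ a b → [] ⊢ a :+ # 0 :* b ≈ a) refl)))

  -- Processing the jobs in χ during a time interval of length δ.
  module Flow (s : State) (χ : ℕ → Bool) (δ : ℝ) where
    open State s

    advance : (ℕ → ℝ) → ℕ → ℝ
    advance w k = w k + [ χ k ] * δ

    rem' : Task → ℝ
    rem' e = size e - advance work (id e)

    rem'-eq : ∀ e → rem' e ≡ rem e - [ χ (id e) ] * δ
    rem'-eq e = arith 3 (λ p w x → [] ⊢ p :- (w :+ x) ≈ p :- w :- x) refl

    Vol' : ℝ → ℝ
    Vol' = V tasks rem'

    near : ℝ → Task → Bool
    near b e = χ (id e) ∧ does (start-by e <? b)

    active : ℝ → ℝ
    active b = natural (count tasks (near b))

  -- Conditions under which the set of running jobs, and hence the rate at
  -- which every volume decreases, is constant.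
  record Steady (s : State) (χ : ℕ → Bool) (δ : ℝ) : Set where
    open State s
    field
      0≤δ      : 0# ≤ δ
      no-cross : ∀ {e b} → e ∈ tasks → b ∈ tasks → χ (id e) ≡ true →
                 start-by e < dl b → start-by e + δ ≤ dl b
      no-late  : ∀ {e} → e ∈ tasks → 0# < rem e → χ (id e) ≡ false → now + δ ≤ start-by e

  record Runnable (s : State) (χ : ℕ → Bool) : Set where
    open State s
    field
      only-pending : ∀ {e} → e ∈ tasks → χ (id e) ≡ true → 0# < rem e
      only-tasks   : ∀ k → χ k ≡ true → k ℕ.< length tasks
      few          : count tasks (χ ∘ id) ℕ.≤ m

  module Steadily {s : State} (sound : Sound s) {χ : ℕ → Bool} {δ : ℝ}
                  (runnable : Runnable s χ) (steady : Steady s χ δ) where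
    open State s
    open Sound sound
    open Runnable runnable
    open Steady steady
    open Flow s χ δ

    idle-rem : ∀ e → χ (id e) ≡ false → rem' e ≡ rem e
    idle-rem e eq = trans (rem'-eq e) (trans (cong (λ b → rem e - [ b ] * δ) eq)
      (arith 2 (λ r d → [] ⊢ r :- # 0 :* d ≈ r) refl))

    running-rem : ∀ e → χ (id e) ≡ true → rem' e ≡ rem e - δ
    running-rem e eq = trans (rem'-eq e) (trans (cong (λ b → rem e - [ b ] * δ) eq)
      (arith 2 (λ r d → [] ⊢ r :- # 1 :* d ≈ r :- d) refl))

    δ≤rem : ∀ {e} → e ∈ tasks → χ (id e) ≡ true → δ ≤ rem e
    δ≤rem {e} e∈ run = arith 3 (λ d r x → (d :- r :+ x ⊑ d ∷ []) ⊢ x ≼ r) refl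
      (no-cross e∈ e∈ run (<-diff⁻¹ (subst (0# <_)
        (arith 2 (λ d r → [] ⊢ r ≈ d :- (d :- r)) refl) (only-pending e∈ run))))

    0≤rem' : ∀ {e} → e ∈ tasks → 0# ≤ rem' e
    0≤rem' {e} e∈ with true-or-false (χ (id e))
    ... | inj₁ run  = subst (0# ≤_) (sym (running-rem e run)) (diff-nonneg (δ≤rem e∈ run))
    ... | inj₂ wait = subst (0# ≤_) (sym (idle-rem e wait)) (0≤rem e∈)

    start-by' : ∀ {e} → e ∈ tasks → χ (id e) ≡ true → dl e - rem' e ≡ start-by e + δ
    start-by' {e} e∈ run = arith 4 (λ d r r' x → (r :- x ≐ r' ∷ []) ⊢ d :- r' ≈ d :- r :+ x) refl
      (sym (running-rem e run))

    fresh-χ : ∀ k → length tasks ℕ.≤ k → χ k ≡ false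
    fresh-χ k n≤k with true-or-false (χ k)
    ... | inj₁ run  = contradiction (only-tasks k run) (ℕ.≤⇒≯ n≤k)
    ... | inj₂ wait = wait

    fresh-advance : ∀ w k → length tasks ℕ.≤ k → w k ≡ 0# → advance w k ≡ 0#
    fresh-advance w k n≤k eq = trans (cong₂ (λ x b → x + [ b ] * δ) eq (fresh-χ k n≤k))
      (arith 1 (λ d → [] ⊢ # 0 :+ # 0 :* d ≈ # 0) refl)

    0≤advance : ∀ {w} k → 0# ≤ w k → 0# ≤ advance w k
    0≤advance k 0≤w = +-nonneg 0≤w (*-nonNegative (0≤[] _) 0≤δ)

    near-yes : ∀ {b e} → χ (id e) ≡ true → start-by e < b → near b e ≡ true
    near-yes {b} {e} run ℓ<b rewrite run = true-does (start-by e <? b) ℓ<b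

    near-no : ∀ {b e} → χ (id e) ≡ false ⊎ ¬ start-by e < b → near b e ≡ false
    near-no {b} {e} (inj₁ wait) rewrite wait = refl
    near-no {b} {e} (inj₂ ℓ≮b) with χ (id e)
    ... | true  = false-does (start-by e <? b) ℓ≮b
    ... | false = refl

    share' : ∀ {b} → (∀ {e} → e ∈ tasks → χ (id e) ≡ true → start-by e < b → start-by e + δ ≤ b) →
             ∀ {e} → e ∈ tasks → share (rem' e) (dl e) b ≡ share (rem e) (dl e) b - [ near b e ] * δ
    share' {b} cross {e} e∈ with true-or-false (χ (id e))
    ... | inj₂ wait = trans (cong (λ r → share r (dl e) b) (idle-rem e wait))
      (trans (arith 2 (λ x d → [] ⊢ x ≈ x :- # 0 :* d) refl)
             (cong (λ y → share (rem e) (dl e) b - [ y ] * δ) (sym (near-no {b} {e} (inj₁ wait)))))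
    ... | inj₁ run with holds-or-not (start-by e <? b)
    ...   | inj₁ ℓ<b = trans (cong (λ r → share r (dl e) b) (running-rem e run))
      (trans (share-run (δ≤rem e∈ run) 0≤δ (cross e∈ run ℓ<b))
      (trans (arith 2 (λ x d → [] ⊢ x :- d ≈ x :- # 1 :* d) refl)
             (cong (λ y → share (rem e) (dl e) b - [ y ] * δ) (sym (near-yes {b} {e} run ℓ<b)))))
    ...   | inj₂ ℓ≮b = trans
      (share-early (≤-trans (≮⇒≥ ℓ≮b) (subst (start-by e ≤_) (sym (start-by' e∈ run))
        (arith 2 (λ l d → (# 0 ⊑ d ∷ []) ⊢ l ≼ l :+ d) refl 0≤δ))))
      (trans (sym (share-early (≮⇒≥ ℓ≮b)))
      (trans (arith 2 (λ x d → [] ⊢ x ≈ x :- # 0 :* d) refl)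
             (cong (λ y → share (rem e) (dl e) b - [ y ] * δ) (sym (near-no {b} {e} (inj₂ ℓ≮b))))))

    Vol-flow : ∀ {b} → (∀ {e} → e ∈ tasks → χ (id e) ≡ true → start-by e < b → start-by e + δ ≤ b) →
               Vol' b ≡ Vol b - active b * δ
    Vol-flow {b} cross = trans (∑-cong tasks (share' cross))
      (trans (∑-- tasks _ _) (cong (λ x → Vol b - x)
        (trans (∑-*ʳ tasks δ _) (cong (_* δ) (sym (natural-count tasks (near b)))))))

    start-by'-late : ∀ {e} → e ∈ tasks → rem' e ≡ 0# ⊎ now + δ ≤ dl e - rem' e
    start-by'-late {e} e∈ with true-or-false (χ (id e))
    ... | inj₁ run  = inj₂ (subst (now + δ ≤_) (sym (start-by' e∈ run))
      (+-monoˡ-≤ δ (now≤start-by e∈ (only-pending e∈ run))))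
    ... | inj₂ wait with pending-or-done e∈
    ...   | inj₁ 0<rem = inj₂ (subst (λ r → now + δ ≤ dl e - r) (sym (idle-rem e wait)) (no-late e∈ 0<rem wait))
    ...   | inj₂ rem≡0 = inj₁ (trans (idle-rem e wait) rem≡0)

    share'-bound : ∀ {e b} → e ∈ tasks → now + δ ≤ b → share (rem' e) (dl e) b ≤ b - (now + δ)
    share'-bound {e} {b} e∈ t'≤b with start-by'-late e∈
    ... | inj₁ rem≤0 = ≤-trans (share≤r b (0≤rem' e∈)) (≤-trans (≤-reflexive rem≤0) (diff-nonneg t'≤b))
    ... | inj₂ t'≤ℓ with total (dl e - rem' e) b
    ...   | inj₁ ℓ≤b = ≤-trans (share≤laxity ℓ≤b)
      (arith 3 (λ b t l → (t ⊑ l ∷ []) ⊢ b :- l ≼ b :- t) refl t'≤ℓ)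
    ...   | inj₂ b≤ℓ = ≤-trans (≤-reflexive (share-early b≤ℓ)) (diff-nonneg t'≤b)

    Vol'-now : Vol' (now + δ) ≡ 0#
    Vol'-now = ≤-antisym
      (∑-nonpos tasks (λ e∈ → ≤-trans (share'-bound e∈ ≤-refl) (≤-reflexive (-‿inverseʳ _))))
      (0≤V tasks rem' (now + δ))

    work-sum : ∀ w → ∑ tasks (advance w ∘ id) ≡ ∑ tasks (w ∘ id) + natural (count tasks (χ ∘ id)) * δ
    work-sum w = trans (∑-+ tasks _ _) (cong (∑ tasks (w ∘ id) +_)
      (trans (∑-*ʳ tasks δ _) (cong (_* δ) (sym (natural-count tasks (χ ∘ id))))))

module Flows (ℛ : Reals) (m : ℕ) (1≤m : 1 ℕ.≤ m) (ε : Reals.ℝ ℛ)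
               (0<ε : Reals._<_ ℛ (Reals.0# ℛ) ε)
               (ε≤1 : Reals._≤_ ℛ ε (Reals.1# ℛ)) where
  open OrderedField ℛ
  open Summation ℛ
  open Volumes ℛ
  open Parameters ℛ m 1≤m ε 0<ε ε≤1
  open Scheduling ℛ using (Schedule)
  open States ℛ m 1≤m ε 0<ε ε≤1

  record GapPhase (s : State) (χ : ℕ → Bool) : Set where
    open State s
    -- Earliest deadline first, except that jobs without slack come first.
    key : Task → ℝ
    key e = if does (start-by e ≤? now) then now else dl e
    field
      runnable : Runnable s χ
      open-gap : threshold ≡ now
      full     : (∀ {e} → e ∈ tasks → 0# < rem e → χ (id e) ≡ true) ⊎
                 count tasks (χ ∘ id) ≡ m ×
                 (∀ {e w} → e ∈ tasks → w ∈ tasks → χ (id e) ≡ true → 0# < rem w →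
                  χ (id w) ≡ false → key e ≤ key w)
      urgent   : ∀ {e} → e ∈ tasks → 0# < rem e → start-by e ≤ now → χ (id e) ≡ true

  record GapLimit (s : State) (χ : ℕ → Bool) (δ : ℝ) : Set where
    open State s
    field
      steady : Steady s χ δ
      guard  : ∀ {b} → b ∈ tasks → now < dl b →
               (c - Flow.active s χ δ (dl b)) * δ ≤ c * (dl b - now) - Vol (dl b)

  gap-flow : (s : State) (χ : ℕ → Bool) (δ : ℝ) → Schedule m → State
  gap-flow s χ δ new = record
    { now = now + δ ; threshold = now + δ ; used = used ; tasks = tasks
    ; work = advance work ; idle = advance idle ; segs = new }
    where
    open State s
    open Flow s χ δ

  record BlockPhase (s : State) (χ : ℕ → Bool) : Set where
    open State s
    field
      runnable  : Runnable s χ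
      only-near : ∀ {e} → e ∈ tasks → χ (id e) ≡ true → start-by e < threshold
      full      : (∀ {e} → e ∈ tasks → 0# < rem e → start-by e < threshold → χ (id e) ≡ true) ⊎
                  count tasks (χ ∘ id) ≡ m ×
                  (∀ {e w} → e ∈ tasks → w ∈ tasks → χ (id e) ≡ true → 0# < rem w →
                   start-by w < threshold → χ (id w) ≡ false → start-by e ≤ start-by w)

  record BlockLimit (s : State) (χ : ℕ → Bool) (δ : ℝ) : Set where
    open State s
    field
      steady   : Steady s χ δ
      in-block : now + δ ≤ threshold
      near-end : ∀ {e} → e ∈ tasks → χ (id e) ≡ true → start-by e + δ ≤ threshold

  block-flow : (s : State) (χ : ℕ → Bool) (δ : ℝ) → Schedule m → State
  block-flow s χ δ new = record
    { now = now + δ ; threshold = threshold ; used = used ; tasks = tasks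
    ; work = advance work ; idle = idle ; segs = new }
    where
    open State s
    open Flow s χ δ

  module _ {s : State} (sound : Sound s) {χ : ℕ → Bool} {δ : ℝ} where
    open State s
    open Sound sound
    open Flow s χ δ

    gap-sound : GapPhase s χ → GapLimit s χ δ → ∀ new → Sound (gap-flow s χ δ new)
    gap-sound phase limit new = record
      { now≤threshold = ≤-refl
      ; 0≤used        = 0≤used
      ; distinct      = distinct
      ; fresh         = fresh
      ; fresh-work    = λ k n≤k → fresh-advance work k n≤k (fresh-work k n≤k)
      ; fresh-idle    = λ k n≤k → fresh-advance idle k n≤k (fresh-idle k n≤k)
      ; 0≤work        = λ k → 0≤advance {work} k (0≤work k)
      ; 0≤rem         = 0≤rem'
      ; rel≤now       = λ e∈ → ≤-trans (rel≤now e∈) now≤now'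
      ; far-volume    = λ {D} t'≤D → ≤-trans (far t'≤D) (≤-reflexive (trans (sym (+-identityˡ _))
                          (cong (_+ c * (D - now')) (sym Vol'-now))))
      ; near-volume   = λ {k} {D} k≤m t'≤D D≤t' → ≤-reflexive (trans
          (cong Vol' (≤-antisym D≤t' t'≤D)) (trans Vol'-now (trans
          (arith 3 (λ t k z → [] ⊢ # 0 ≈ k :* (t :- t) :+ z :* (t :- t)) refl)
          (cong (λ x → natural k * (x - now') + σ k * (now' - now')) (≤-antisym t'≤D D≤t')))))
      ; far-task      = far-task'
      ; account       = trans (cong (c * used +_) (work-sum idle)) (trans
          (arith 6 (λ u a b v v' n → (u :+ a ≐ b :+ v ∷ v ≐ # 0 ∷ # 0 ≐ v' ∷ [])
            ⊢ u :+ (a :+ n) ≈ (b :+ n) :+ v') refl account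
            (trans (cong Vol open-gap) Vol-now) (sym Vol'-now))
          (cong (_+ Vol' now') (sym (work-sum work))))
      }
      where
      open GapPhase phase
      open GapLimit limit
      open Steadily sound runnable steady
      open Steady steady
      now' : ℝ
      now' = now + δ
      now≤now' : now ≤ now'
      now≤now' = arith 2 (λ t d → (# 0 ⊑ d ∷ []) ⊢ t ≼ t :+ d) refl 0≤δ
      total-rem W : ℝ
      total-rem = ∑ tasks rem'
      W = total-rem / c
      0≤W : 0# ≤ total-rem
      0≤W = ∑-nonneg tasks 0≤rem'
      at-deadline : ∀ {b} → b ∈ tasks → now' ≤ dl b → Vol' (dl b) ≤ c * dl b + (- (c * now'))
      at-deadline {b} b∈ t'≤b with holds-or-not (now <? dl b)
      ... | inj₁ t<b = subst (_≤ c * dl b + (- (c * now'))) (sym (Vol-flow (λ e∈ run → no-cross e∈ b∈ run)))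
        (arith 6 (λ c b t d v n → ((c :- n) :* d ⊑ c :* (b :- t) :- v ∷ [])
          ⊢ v :- n :* d ≼ c :* b :+ (:- (c :* (t :+ d)))) refl (guard b∈ t<b))
      ... | inj₂ t≮b = ≤-trans (V-mono tasks rem' (≤-trans (≮⇒≥ t≮b) now≤now')) (≤-trans (≤-reflexive Vol'-now)
        (arith 3 (λ c b t → (# 0 ⊑ c :* (b :- t) ∷ []) ⊢ # 0 ≼ c :* b :+ (:- (c :* t))) refl
          (*-nonNegative 0≤c (diff-nonneg t'≤b))))
      far : ∀ {D} → now' ≤ D → Vol' D ≤ c * (D - now')
      far {D} t'≤D = subst (Vol' D ≤_) (arith 3 (λ c D t → [] ⊢ c :* D :+ (:- (c :* t)) ≈ c :* (D :- t)) refl)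
        (V-linear-bound tasks rem' c (- (c * now')) 0≤rem' (map dl tasks) now' hi D t'≤D (x≤x⊔y _ _)
          (≤-reflexive (trans Vol'-now (sym (-‿inverseʳ _))))
          (≤-trans (∑-mono tasks (λ e∈ → share≤r hi (0≤rem' e∈)))
            (arith 4 (λ c h t w → (# 0 ⊑ c :* (h :- (t :+ w)) ∷ []) ⊢ c :* w ≼ c :* h :+ (:- (c :* t))) refl
              (*-nonNegative 0≤c (diff-nonneg (y≤x⊔y D (now' + W))))
              |> subst (_≤ c * hi + (- (c * now'))) (/-cancel 0<c)))
          (λ {b} b∈ → at (∈-map⁻ dl b∈))
          (λ e∈ → inj₁ (∈-map⁺ dl e∈)))
        where
        hi : ℝ
        hi = D ⊔ now' + W
        at : ∀ {b} → ∃[ e ] e ∈ tasks × b ≡ dl e → now' ≤ b → b ≤ hi → Vol' b ≤ c * b + (- (c * now'))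
        at (e , e∈ , refl) t'≤b _ = at-deadline e∈ t'≤b
      far-task' : ∀ {e} → e ∈ tasks → now' < dl e →
                  advance idle (id e) + rem' e ≡ size e ⊎ dl e - now' ≤ rem' e
      far-task' {e} e∈ t'<d with far-task e∈ (subst (_< dl e) (sym open-gap) (≤-<-trans now≤now' t'<d))
      ... | inj₁ eq = inj₁ (trans (arith 4 (λ g p w x → [] ⊢ g :+ x :+ (p :- (w :+ x)) ≈ g :+ (p :- w)) refl) eq)
      ... | inj₂ tight = inj₂ (subst (dl e - now' ≤_) (sym (running-rem e run))
        (arith 4 (λ d t x r → (d :- t ⊑ r ∷ []) ⊢ d :- (t :+ x) ≼ r :- x) refl tight'))
        where
        tight' : dl e - now ≤ rem e
        tight' = subst (λ h → dl e - h ≤ rem e) open-gap tight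
        run : χ (id e) ≡ true
        run = urgent e∈ (<-≤-trans (<-diff (≤-<-trans now≤now' t'<d)) tight')
          (arith 3 (λ d t r → (d :- t ⊑ r ∷ []) ⊢ d :- r ≼ t) refl tight')

    block-sound : BlockPhase s χ → BlockLimit s χ δ → ∀ new → Sound (block-flow s χ δ new)
    block-sound phase limit new = record
      { now≤threshold = in-block
      ; 0≤used        = 0≤used
      ; distinct      = distinct
      ; fresh         = fresh
      ; fresh-work    = λ k n≤k → fresh-advance work k n≤k (fresh-work k n≤k)
      ; fresh-idle    = fresh-idle
      ; 0≤work        = λ k → 0≤advance {work} k (0≤work k)
      ; 0≤rem         = 0≤rem'
      ; rel≤now       = λ e∈ → ≤-trans (rel≤now e∈) now≤now'
      ; far-volume    = λ {D} h≤D → subst₂ (λ x y → x ≤ y + c * (D - threshold))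
          (sym (flow-beyond h≤D)) (sym (flow-beyond ≤-refl))
          (arith 4 (λ v w n x → (v ⊑ w :+ x ∷ []) ⊢ v :- n ≼ (w :- n) :+ x) refl (far-volume h≤D))
      ; near-volume   = near-volume'
      ; far-task      = far-task'
      ; account       = trans account (trans
          (arith 4 (λ b v n x → [] ⊢ b :+ v ≈ (b :+ n :* x) :+ (v :- n :* x)) refl)
          (cong₂ _+_ (sym (work-sum work)) (sym (flow-beyond ≤-refl))))
      }
      where
      open BlockPhase phase
      open BlockLimit limit
      open Steadily sound runnable steady
      open Steady steady
      now' N : ℝ
      now' = now + δ
      N = natural (count tasks (χ ∘ id))
      now≤now' : now ≤ now'
      now≤now' = arith 2 (λ t d → (# 0 ⊑ d ∷ []) ⊢ t ≼ t :+ d) refl 0≤δ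
      flow-beyond : ∀ {D} → threshold ≤ D → Vol' D ≡ Vol D - N * δ
      flow-beyond {D} h≤D = trans (Vol-flow (λ e∈ run _ → ≤-trans (near-end e∈ run) h≤D))
        (cong (λ n → Vol D - natural n * δ) (count-cong tasks all-near))
        where
        all-near : ∀ {e} → e ∈ tasks → near D e ≡ χ (id e)
        all-near {e} e∈ with true-or-false (χ (id e))
        ... | inj₁ run  = trans (near-yes {D} {e} run (<-≤-trans (only-near e∈ run) h≤D)) (sym run)
        ... | inj₂ wait = trans (near-no {D} {e} (inj₁ wait)) (sym wait)
      far-task' : ∀ {e} → e ∈ tasks → threshold < dl e →
                  idle (id e) + rem' e ≡ size e ⊎ dl e - threshold ≤ rem' e
      far-task' {e} e∈ h<d with true-or-false (χ (id e))
      ... | inj₁ run = inj₂ (subst (dl e - threshold ≤_) (sym (running-rem e run))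
        (arith 4 (λ d h r x → (d :- r :+ x ⊑ h ∷ []) ⊢ d :- h ≼ r :- x) refl (near-end e∈ run)))
      ... | inj₂ wait = subst (λ r → idle (id e) + r ≡ size e ⊎ dl e - threshold ≤ r)
        (sym (idle-rem e wait)) (far-task e∈ h<d)

      busy : ∀ b → b ≤ threshold →
             (∀ {e} → e ∈ tasks → 0# < rem e → start-by e < b → χ (id e) ≡ true) ⊎ active b ≡ M
      busy b b≤h with full
      ... | inj₁ all = inj₁ (λ e∈ pending ℓ<b → all e∈ pending (<-≤-trans ℓ<b b≤h))
      ... | inj₂ (n≡m , ordered) with waiting tasks
        where
        waiting : ∀ es → (∀ {e} → e ∈ es → 0# < rem e → start-by e < b → χ (id e) ≡ true) ⊎
                  (∃[ w ] w ∈ es × 0# < rem w × start-by w < b × χ (id w) ≡ false)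
        waiting [] = inj₁ (λ ())
        waiting (e ∷ es) with waiting es
        ... | inj₂ (w , w∈ , rest) = inj₂ (w , there w∈ , rest)
        ... | inj₁ none with true-or-false (χ (id e)) | 0# <? rem e | start-by e <? b
        ...   | inj₂ wait | yes 0<rem | yes ℓ<b = inj₂ (e , here refl , 0<rem , ℓ<b , wait)
        ...   | inj₁ run  | _         | _       = inj₁ λ { (here refl) _ _ → run ; (there e∈) → none e∈ }
        ...   | inj₂ _    | no  ¬rem  | _       = inj₁ λ { (here refl) r _ → contradiction r ¬rem ; (there e∈) → none e∈ }
        ...   | inj₂ _    | yes _     | no  ℓ≮b = inj₁ λ { (here refl) _ l → contradiction l ℓ≮b ; (there e∈) → none e∈ }
      ...   | inj₁ none = inj₁ none
      ...   | inj₂ (w , w∈ , 0<rem , ℓ<b , wait) = inj₂ (cong natural (trans (count-cong tasks all-near) n≡m))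
        where
        all-near : ∀ {e} → e ∈ tasks → near b e ≡ χ (id e)
        all-near {e} e∈ with true-or-false (χ (id e))
        ... | inj₁ run = trans (near-yes {b} {e} run
          (≤-<-trans (ordered e∈ w∈ run 0<rem (<-≤-trans ℓ<b b≤h) wait) ℓ<b)) (sym run)
        ... | inj₂ wait' = trans (near-no {b} {e} (inj₁ wait')) (sym wait')

      at-point : ∀ {k b} → k ℕ.≤ m → now' ≤ b → b ≤ threshold →
        (∀ {e} → e ∈ tasks → χ (id e) ≡ true → start-by e < b → start-by e + δ ≤ b) →
        Vol' b ≤ natural k * (b - now') + σ k * (threshold - now')
      at-point {k} {b} k≤m t'≤b b≤h cross = cases (total (natural k + σ k) (active b))
        where
        fast : natural k + σ k ≤ active b → Vol' b ≤ natural k * (b - now') + σ k * (threshold - now')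
        fast k+σ≤n = subst (_≤ natural k * (b - now') + σ k * (threshold - now')) (sym (Vol-flow cross))
          (arith 8 (λ k s b t h v n d →
              (v ⊑ k :* (b :- t) :+ s :* (h :- t) ∷ # 0 ⊑ (n :- (k :+ s)) :* d ∷ [])
              ⊢ v :- n :* d ≼ k :* (b :- (t :+ d)) :+ s :* (h :- (t :+ d))) refl
            (near-volume k≤m (≤-trans now≤now' t'≤b) b≤h)
            (*-nonNegative (diff-nonneg k+σ≤n) 0≤δ))
        each : (∀ {e} → e ∈ tasks → 0# < rem e → start-by e < b → χ (id e) ≡ true) →
               ∀ {e} → e ∈ tasks → share (rem' e) (dl e) b ≤ [ near b e ] * (b - now')
        each all {e} e∈ with true-or-false (near b e)
        ... | inj₁ is-near = subst (share (rem' e) (dl e) b ≤_)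
          (trans (sym (*-identityˡ _)) (cong (λ y → [ y ] * (b - now')) (sym is-near))) (share'-bound e∈ t'≤b)
        ... | inj₂ not-near = subst (share (rem' e) (dl e) b ≤_)
          (trans (sym (zeroˡ _)) (cong (λ y → [ y ] * (b - now')) (sym not-near))) zero-share
          where
          zero-share : share (rem' e) (dl e) b ≤ 0#
          zero-share with pending-or-done e∈ | holds-or-not (start-by e <? b)
          ... | inj₂ rem≡0 | _ = ≤-trans (share≤r b (0≤rem' e∈)) (subst (_≤ 0#) (sym (rem'-eq e))
            (arith 2 (λ r y → (r ≗ # 0 ∷ # 0 ⊑ y ∷ []) ⊢ r :- y ≼ # 0) refl
              rem≡0 (*-nonNegative (0≤[] (χ (id e))) 0≤δ)))
          ... | inj₁ 0<rem | inj₁ ℓ<b = contradiction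
            (trans (sym not-near) (near-yes {b} {e} (all e∈ 0<rem ℓ<b) ℓ<b)) λ ()
          ... | inj₁ 0<rem | inj₂ ℓ≮b = ≤-trans (share-anti {rem e} {rem' e} {dl e} {b} rem'≤rem)
            (≤-reflexive (share-early (≮⇒≥ ℓ≮b)))
            where
            rem'≤rem : rem' e ≤ rem e
            rem'≤rem = subst (_≤ rem e) (sym (rem'-eq e))
              (arith 2 (λ r y → (# 0 ⊑ y ∷ []) ⊢ r :- y ≼ r) refl (*-nonNegative (0≤[] (χ (id e))) 0≤δ))
        slow : active b ≤ natural k + σ k →
               (∀ {e} → e ∈ tasks → 0# < rem e → start-by e < b → χ (id e) ≡ true) →
               Vol' b ≤ natural k * (b - now') + σ k * (threshold - now')
        slow n≤k+σ all = ≤-trans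
          (≤-trans (∑-mono tasks (each all)) (≤-reflexive (trans (∑-*ʳ tasks (b - now') _)
            (cong (_* (b - now')) (sym (natural-count tasks (near b)))))))
          (arith 6 (λ k s b t h n → (# 0 ⊑ (k :+ s :- n) :* (b :- t) ∷ # 0 ⊑ s :* (h :- b) ∷ [])
              ⊢ n :* (b :- t) ≼ k :* (b :- t) :+ s :* (h :- t)) refl
            (*-nonNegative (diff-nonneg n≤k+σ) (diff-nonneg t'≤b))
            (*-nonNegative (0≤σ k≤m) (diff-nonneg b≤h)))
        cases : natural k + σ k ≤ active b ⊎ active b ≤ natural k + σ k →
                Vol' b ≤ natural k * (b - now') + σ k * (threshold - now')
        cases (inj₁ k+σ≤n) = fast k+σ≤n
        cases (inj₂ n≤k+σ) with busy b b≤h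
        ... | inj₁ all = slow n≤k+σ all
        ... | inj₂ n≡M = fast (subst (natural k + σ k ≤_) (sym n≡M) (k+σ≤M k≤m))

      near-volume' : ∀ {k D} → k ℕ.≤ m → now' ≤ D → D ≤ threshold →
                     Vol' D ≤ natural k * (D - now') + σ k * (threshold - now')
      near-volume' {k} {D} k≤m t'≤D D≤h = subst (Vol' D ≤_) (linear D)
        (V-linear-bound tasks rem' (natural k) β 0≤rem' (map dl tasks) now' threshold D t'≤D D≤h
          (≤-trans (≤-reflexive Vol'-now) (subst (0# ≤_) (sym (linear now'))
            (+-nonneg (subst (0# ≤_) (sym (trans (cong (natural k *_) (-‿inverseʳ now')) (zeroʳ _))) ≤-refl)
              (*-nonNegative (0≤σ k≤m) (diff-nonneg in-block)))))
          (subst (Vol' threshold ≤_) (sym (linear threshold))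
            (at-point {k} k≤m in-block ≤-refl (λ e∈ run _ → near-end e∈ run)))
          (λ {b} b∈ t'≤b b≤h → subst (Vol' b ≤_) (sym (linear b)) (at (∈-map⁻ dl b∈) t'≤b b≤h))
          (λ e∈ → inj₁ (∈-map⁺ dl e∈)))
        where
        β : ℝ
        β = σ k * (threshold - now') - natural k * now'
        linear : ∀ x → natural k * x + β ≡ natural k * (x - now') + σ k * (threshold - now')
        linear x = arith 4 (λ k x t s → [] ⊢ k :* x :+ (s :- k :* t) ≈ k :* (x :- t) :+ s) refl
        at : ∀ {b} → ∃[ e ] e ∈ tasks × b ≡ dl e → now' ≤ b → b ≤ threshold →
             Vol' b ≤ natural k * (b - now') + σ k * (threshold - now')
        at (e , e∈ , refl) t'≤b b≤h = at-point {k} k≤m t'≤b b≤h (λ e'∈ run → no-cross e'∈ e∈ run)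

module Raises (ℛ : Reals) (m : ℕ) (1≤m : 1 ℕ.≤ m) (ε : Reals.ℝ ℛ)
               (0<ε : Reals._<_ ℛ (Reals.0# ℛ) ε)
               (ε≤1 : Reals._≤_ ℛ ε (Reals.1# ℛ)) where
  open OrderedField ℛ
  open Summation ℛ
  open Volumes ℛ
  open Parameters ℛ m 1≤m ε 0<ε ε≤1
  open States ℛ m 1≤m ε 0<ε ε≤1

  guard-raise : (s : State) (b : Task) → State
  guard-raise s b = record s { threshold = dl b ; used = used + (dl b - now) }
    where open State s

  module _ {s : State} (sound : Sound s) where
    open State s
    open Sound sound

    gap-volume : threshold ≡ now → ∀ {D} → now ≤ D → Vol D ≤ c * (D - now)
    gap-volume open-gap {D} t≤D = ≤-trans
      (subst (λ h → Vol D ≤ Vol h + c * (D - h)) open-gap (far-volume (subst (_≤ D) (sym open-gap) t≤D)))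
      (≤-reflexive (trans (cong (_+ c * (D - now)) Vol-now) (+-identityˡ _)))

    guard-sound : threshold ≡ now → ∀ {b} → b ∈ tasks → now < dl b → c * (dl b - now) ≤ Vol (dl b) →
                  Sound (guard-raise s b)
    guard-sound open-gap {b} b∈ t<b full = record
      { now≤threshold = <⇒≤ t<b
      ; 0≤used        = +-nonneg 0≤used (diff-nonneg (<⇒≤ t<b))
      ; distinct      = distinct
      ; fresh         = fresh
      ; fresh-work    = fresh-work
      ; fresh-idle    = fresh-idle
      ; 0≤work        = 0≤work
      ; 0≤rem         = 0≤rem
      ; rel≤now       = rel≤now
      ; far-volume    = λ {D} b≤D → arith 6
          (λ v w c D t b → (v ⊑ c :* (D :- t) ∷ c :* (b :- t) ⊑ w ∷ []) ⊢ v ≼ w :+ c :* (D :- b)) refl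
          (gap-volume open-gap (≤-trans (<⇒≤ t<b) b≤D)) full
      ; near-volume   = λ {k} {D} k≤m t≤D D≤b → arith 7
          (λ v c g k D t b → (v ⊑ c :* (D :- t) ∷ # 0 ⊑ (k :- g) :* (D :- t) ∷ # 0 ⊑ (c :- g) :* (b :- D) ∷ [])
            ⊢ v ≼ k :* (D :- t) :+ (c :- g) :* (b :- t)) refl
          (gap-volume open-gap t≤D) (*-nonNegative (diff-nonneg (G≤ k)) (diff-nonneg t≤D))
          (*-nonNegative (0≤σ k≤m) (diff-nonneg D≤b))
      ; far-task      = λ {e} e∈ b<d → weaken {e} (far-task e∈ (subst (_< dl e) (sym open-gap) (≤-<-trans (<⇒≤ t<b) b<d)))
      ; account       = arith 8 (λ c u b t i w v v' →
          (c :* u :+ i ≐ w :+ v ∷ v ≐ # 0 ∷ c :* (b :- t) ≐ v' ∷ [])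
          ⊢ c :* (u :+ (b :- t)) :+ i ≈ w :+ v') refl account (trans (cong Vol open-gap) Vol-now)
          (≤-antisym full (gap-volume open-gap (<⇒≤ t<b)))
      }
      where
      weaken : ∀ {e} → idle (id e) + rem e ≡ size e ⊎ dl e - threshold ≤ rem e →
               idle (id e) + rem e ≡ size e ⊎ dl e - dl b ≤ rem e
      weaken (inj₁ eq) = inj₁ eq
      weaken {e} (inj₂ le) = inj₂ (arith 4 (λ d b h r → (d :- h ⊑ r ∷ h ⊑ b ∷ []) ⊢ d :- b ≼ r) refl
        le (subst (_≤ dl b) (sym open-gap) (<⇒≤ t<b)))

  module Arrival {s : State} (sound : Sound s) (n : Task)
                 (id-n : id n ≡ length (State.tasks s)) (rel-n : rel n ≡ State.now s) where
    open State s
    open Sound sound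

    rem-n : rem n ≡ size n
    rem-n = trans (cong (λ w → size n - w) (fresh-work (id n) (ℕ.≤-reflexive (sym id-n))))
      (arith 1 (λ p → [] ⊢ p :- # 0 ≈ p) refl)

    distinct' : AllPairs (λ e e' → id e ≢ id e') (n ∷ tasks)
    distinct' = All.tabulate (λ e∈ eq → ℕ.<-irrefl (trans (sym eq) id-n) (fresh e∈)) ∷ distinct

    fresh' : ∀ {e} → e ∈ n ∷ tasks → id e ℕ.< length (n ∷ tasks)
    fresh' (here refl) = s≤s (ℕ.≤-reflexive id-n)
    fresh' (there e∈)  = ℕ.m≤n⇒m≤1+n (fresh e∈)

    rel≤now' : ∀ {e} → e ∈ n ∷ tasks → rel e ≤ now
    rel≤now' (here refl) = ≤-reflexive rel-n
    rel≤now' (there e∈)  = rel≤now e∈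

    no-work : work (id n) ≡ 0#
    no-work = fresh-work (id n) (ℕ.≤-reflexive (sym id-n))

    no-idle : idle (id n) ≡ 0#
    no-idle = fresh-idle (id n) (ℕ.≤-reflexive (sym id-n))

    reject : State
    reject = record s { tasks = n ∷ tasks }

    reject-sound : size n ≡ 0# → dl n < threshold → Sound reject
    reject-sound size≡0 d<h = record
      { now≤threshold = now≤threshold
      ; 0≤used        = 0≤used
      ; distinct      = distinct'
      ; fresh         = fresh'
      ; fresh-work    = λ k n<k → fresh-work k (ℕ.<⇒≤ n<k)
      ; fresh-idle    = λ k n<k → fresh-idle k (ℕ.<⇒≤ n<k)
      ; 0≤work        = 0≤work
      ; 0≤rem         = λ { (here refl) → ≤-reflexive (sym rem≡0) ; (there e∈) → 0≤rem e∈ }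
      ; rel≤now       = rel≤now'
      ; far-volume    = λ {D} h≤D → subst₂ (λ x y → x ≤ y + c * (D - threshold)) (sym (same D)) (sym (same _)) (far-volume h≤D)
      ; near-volume   = λ {k} {D} k≤m t≤D D≤h → subst (_≤ natural k * (D - now) + σ k * (threshold - now)) (sym (same D)) (near-volume k≤m t≤D D≤h)
      ; far-task      = λ { (here refl) h<d → contradiction (<⇒≤ d<h) (<⇒≱ h<d) ; (there e∈) h<d → far-task e∈ h<d }
      ; account       = trans (cong (λ x → c * used + (x + ∑ tasks (idle ∘ id))) no-idle)
          (arith 6 (λ a i w v x v' → (a :+ i ≐ w :+ v ∷ # 0 ≐ x ∷ v ≐ v' ∷ [])
              ⊢ a :+ (# 0 :+ i) ≈ (x :+ w) :+ v') refl account (sym no-work) (sym (same threshold)))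
      }
      where
      rem≡0 : rem n ≡ 0#
      rem≡0 = trans rem-n size≡0
      same : ∀ D → V (n ∷ tasks) rem D ≡ Vol D
      same D = trans (cong (_+ Vol D) (≤-antisym
          (≤-trans (share≤r D (≤-reflexive (sym rem≡0))) (≤-reflexive rem≡0)) (0≤share D)))
        (+-identityˡ _)

    module Accept (0<p : 0# < size n) (slack-n : (1# + ε) * size n ≤ dl n - now)
                  (h≤d : threshold ≤ dl n) where

      private
        p d ℓ : ℝ
        p = size n
        d = dl n
        ℓ = d - p
        new : ℝ → ℝ
        new = share p d
        Vol' : ℝ → ℝ
        Vol' = V (n ∷ tasks) rem
        Vol'-eq : ∀ D → Vol' D ≡ new D + Vol D
        Vol'-eq D = cong (λ r → share r d D + Vol D) rem-n
        0≤p : 0# ≤ p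
        0≤p = <⇒≤ 0<p
        0≤rem' : ∀ {e} → e ∈ n ∷ tasks → 0# ≤ rem e
        0≤rem' (here refl) = subst (0# ≤_) (sym rem-n) 0≤p
        0≤rem' (there e∈)  = 0≤rem e∈
        εp≤ : ε * p ≤ ℓ - now
        εp≤ = arith 4 (λ e p d t → ((# 1 :+ e) :* p ⊑ d :- t ∷ []) ⊢ e :* p ≼ d :- p :- t) refl slack-n

      Full : ℝ → Set
      Full D = threshold ≤ D × Vol threshold + c * (D - threshold) ≤ Vol' D

      private
        total-rem : ℝ
        total-rem = ∑ (n ∷ tasks) rem

        nonempty : ∃ Full
        nonempty = threshold , ≤-refl , subst (Vol threshold + c * (threshold - threshold) ≤_) (sym (Vol'-eq threshold))
          (arith 4 (λ v c h x → (# 0 ⊑ x ∷ []) ⊢ v :+ c :* (h :- h) ≼ x :+ v) refl (0≤share threshold))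

        bounded : UpperBound Full (threshold + total-rem / c)
        bounded D (h≤D , full) = *-cancelˡ-≤ c 0<c
          (arith 6 (λ c D h v w y → (v :+ c :* (D :- h) ⊑ w ∷ # 0 ⊑ v ∷ c :* y ≗˘ w ∷ []) ⊢ c :* D ≼ c :* (h :+ y)) refl
            (≤-trans full (∑-mono (n ∷ tasks) (λ e∈ → share≤r D (0≤rem' e∈)))) (0≤V tasks rem threshold) (/-cancel 0<c))

      -- The largest point of time up to which the machines are filled to
      -- the extent that justifies rejecting further jobs.
      raised : ℝ
      raised = sup Full

      private
        below : ∀ {D} → Full D → D ≤ raised
        below {D} = sup-upper Full nonempty (threshold + total-rem / c , bounded) D

      h≤raised : threshold ≤ raised
      h≤raised = below (proj₂ nonempty)

      private
        filled : Vol threshold + c * (raised - threshold) ≤ Vol' raised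
        filled = ≤-by-< λ gap → contradiction (shrink gap) (<⇒≱ (/-pos (<-diff gap) 0<c))
          where
          module _ (gap : Vol' raised < Vol threshold + c * (raised - threshold)) where
            g y : ℝ
            g = Vol threshold + c * (raised - threshold) - Vol' raised
            y = g / c
            least : UpperBound Full (raised - y)
            least D (h≤D , full) = *-cancelˡ-≤ c 0<c
              (arith 7 (λ c D r v h w y → (v :+ c :* (D :- h) ⊑ w ∷ c :* y ≗ v :+ c :* (r :- h) :- w ∷ [])
                ⊢ c :* D ≼ c :* (r :- y)) refl
                (≤-trans full (V-mono (n ∷ tasks) rem (below (h≤D , full)))) (/-cancel 0<c))
            shrink : y ≤ 0#
            shrink = arith 2 (λ r y → (r ⊑ r :- y ∷ []) ⊢ y ≼ # 0) refl
              (sup-least Full nonempty (raised - y) least)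

        not-overfilled : Vol' raised ≤ Vol threshold + c * (raised - threshold)
        not-overfilled = ≤-by-< λ gap → contradiction (grow gap) (<⇒≱ (/-pos (<-diff gap) 0<c))
          where
          module _ (gap : Vol threshold + c * (raised - threshold) < Vol' raised) where
            y : ℝ
            y = (Vol' raised - (Vol threshold + c * (raised - threshold))) / c
            0≤y : 0# ≤ y
            0≤y = <⇒≤ (/-pos (<-diff gap) 0<c)
            grow : y ≤ 0#
            grow = arith 2 (λ r y → (r :+ y ⊑ r ∷ []) ⊢ y ≼ # 0) refl (below
              ( ≤-trans h≤raised (arith 2 (λ r y → (# 0 ⊑ y ∷ []) ⊢ r ≼ r :+ y) refl 0≤y)
              , ≤-trans (≤-reflexive (arith 6 (λ v c r y h w → (c :* y ≐ w :- (v :+ c :* (r :- h)) ∷ [])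
                  ⊢ v :+ c :* (r :+ y :- h) ≈ w) refl (/-cancel 0<c)))
                  (V-mono (n ∷ tasks) rem (arith 2 (λ r y → (# 0 ⊑ y ∷ []) ⊢ r ≼ r :+ y) refl 0≤y))))

      Vol-raised : Vol' raised ≡ Vol threshold + c * (raised - threshold)
      Vol-raised = ≤-antisym not-overfilled filled

      accept : State
      accept = record s { tasks = n ∷ tasks ; threshold = raised ; used = used + (raised - threshold) }

      private
        far-volume' : ∀ {D} → raised ≤ D → Vol' D ≤ Vol' raised + c * (D - raised)
        far-volume' {D} r≤D with D ≤? raised
        ... | yes D≤r = ≤-trans (V-mono (n ∷ tasks) rem D≤r)
          (arith 4 (λ v c D r → (# 0 ⊑ c :* (D :- r) ∷ []) ⊢ v ≼ v :+ c :* (D :- r)) refl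
            (*-nonNegative 0≤c (diff-nonneg r≤D)))
        ... | no  D≰r = ≤-trans (≤-by-< λ h → contradiction (below (≤-trans h≤raised r≤D , <⇒≤ h)) D≰r)
          (≤-reflexive (arith 6 (λ v c D h w r → (v :+ c :* (r :- h) ≐ w ∷ [])
            ⊢ v :+ c :* (D :- h) ≈ w :+ c :* (D :- r)) refl (sym Vol-raised)))

        -- An arriving job that needs less than its share of the time left
        -- keeps the volumes below the profile: first before the old
        -- threshold, then between the old and the new one.
        early : ∀ {k D} → suc k ℕ.≤ m → now ≤ D → D ≤ threshold → ℓ < D →
                Vol' D ≤ natural (suc k) * (D - now) + σ (suc k) * (raised - now)
        early {k} {D} k<m t≤D D≤h ℓ<D = subst₂ (λ x y → x ≤ y * (D - now) + σ (suc k) * (raised - now))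
          (sym (Vol'-eq D)) (sym (natural-suc k))
          (arith 10 (λ x v k D t g q h l r →
              (x ⊑ D :- l ∷ v ⊑ k :* (D :- t) :+ g :* (h :- t) ∷ g :* (h :- t) :- (l :- t) ⊑ q :* (r :- t) ∷ [])
              ⊢ x :+ v ≼ (# 1 :+ k) :* (D :- t) :+ q :* (r :- t)) refl
            (share≤laxity (<⇒≤ ℓ<D)) (near-volume (ℕ.<⇒≤ k<m) t≤D D≤h) main)
          where
          P : ℝ
          P = new raised
          ℓ≤r : ℓ ≤ raised
          ℓ≤r = ≤-trans (<⇒≤ ℓ<D) (≤-trans D≤h h≤raised)
          P≤growth : P ≤ c * (raised - threshold)
          P≤growth = arith 4 (λ x v w z → (x :+ w ⊑ v :+ z ∷ v ⊑ w ∷ []) ⊢ x ≼ z) refl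
            (subst (_≤ Vol threshold + c * (raised - threshold)) (Vol'-eq raised) not-overfilled)
            (V-mono tasks rem h≤raised)
          h≤ℓ+P : threshold ≤ ℓ + P
          h≤ℓ+P with total d raised
          ... | inj₁ d≤r = ≤-trans h≤d (≤-reflexive (trans
            (arith 2 (λ d p → [] ⊢ d ≈ d :- p :+ p) refl) (cong (ℓ +_) (sym (share-late 0≤p d≤r)))))
          ... | inj₂ r≤d = ≤-trans h≤raised (≤-reflexive (trans
            (arith 2 (λ r l → [] ⊢ r ≈ l :+ (r :- l)) refl) (cong (ℓ +_) (sym (share-middle ℓ≤r r≤d)))))
          εP≤ : ε * P ≤ ℓ - now
          εP≤ = ≤-trans (*-monoʳ-≤ ε 0≤ε (share≤r raised 0≤p)) εp≤
          Q : ℝ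
          Q = q ^ suc k
          main : σ k * (threshold - now) - (ℓ - now) ≤ σ (suc k) * (raised - now)
          main = *-cancelˡ-≤ c 0<c (arith 9 (λ c g Q h t l r P e →
              (# 0 ⊑ (e :* c :* (# 1 :- Q) :- (c :* Q :- (c :- (g :+ Q)))) :* P
              ∷ # 0 ⊑ c :* (# 1 :- Q) :* (l :- t :- e :* P)
              ∷ # 0 ⊑ c :* Q :* (l :+ P :- h)
              ∷ # 0 ⊑ (c :- (g :+ Q)) :* (c :* (r :- h) :- P) ∷ [])
              ⊢ c :* ((c :- g) :* (h :- t) :- (l :- t)) ≼ c :* ((c :- (g :+ Q)) :* (r :- t))) refl
            (*-nonNegative (diff-nonneg (fact₂ (suc k))) (0≤share raised))
            (*-nonNegative (*-nonNegative 0≤c (diff-nonneg (q^≤1 (suc k)))) (diff-nonneg εP≤))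
            (*-nonNegative (*-nonNegative 0≤c (0≤q^ (suc k))) (diff-nonneg h≤ℓ+P))
            (*-nonNegative (0≤σ k<m) (diff-nonneg P≤growth)))

        late : ∀ {k D} → k ℕ.≤ m → threshold ≤ D → D ≤ raised →
               Vol' D ≤ natural k * (D - now) + σ k * (raised - now)
        late {k} {D} k≤m h≤D D≤r = *-cancelˡ-≤ (c * (1# + ε)) (*-pos 0<c 0<1+ε)
          (arith 9 (λ c e v g k D t Y r →
              (# 0 ⊑ c :* (# 1 :+ e) :* (Y :- v)
              ∷ # 0 ⊑ (# 1 :+ e) :* (c :- g) :* (c :* (r :- t) :- Y)
              ∷ # 0 ⊑ g :* ((c :* (# 1 :+ e) :+ # 1) :* (D :- t) :- (# 1 :+ e) :* Y)
              ∷ # 0 ⊑ (k :* (c :* (# 1 :+ e)) :- g :* (c :* (# 1 :+ e) :+ # 1)) :* (D :- t) ∷ [])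
              ⊢ c :* (# 1 :+ e) :* v ≼ c :* (# 1 :+ e) :* (k :* (D :- t) :+ (c :- g) :* (r :- t))) refl
            (*-nonNegative (*-nonNegative 0≤c (<⇒≤ 0<1+ε)) (diff-nonneg v≤Y))
            (*-nonNegative (*-nonNegative (<⇒≤ 0<1+ε) (0≤σ k≤m)) (diff-nonneg Y≤))
            (*-nonNegative (0≤G k) (diff-nonneg Y≤'))
            (*-nonNegative (diff-nonneg (fact₃ k)) (diff-nonneg t≤D)))
          where
          t≤D : now ≤ D
          t≤D = ≤-trans now≤threshold h≤D
          Y : ℝ
          Y = Vol' D - Vol threshold + c * (threshold - now)
          Vol≤ : Vol threshold ≤ c * (threshold - now)
          Vol≤ = ≤-trans (near-volume {0} z≤n now≤threshold ≤-refl) (≤-reflexive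
            (arith 3 (λ c h t → [] ⊢ # 0 :* (h :- t) :+ (c :- # 0) :* (h :- t) ≈ c :* (h :- t)) refl))
          v≤Y : Vol' D ≤ Y
          v≤Y = arith 3 (λ v w x → (w ⊑ x ∷ []) ⊢ v ≼ v :- w :+ x) refl Vol≤
          Y≤ : Y ≤ c * (raised - now)
          Y≤ = arith 6 (λ v w c h t r → (v ⊑ w :+ c :* (r :- h) ∷ []) ⊢ v :- w :+ c :* (h :- t) ≼ c :* (r :- t)) refl
            (≤-trans (V-mono (n ∷ tasks) rem D≤r) not-overfilled)
          new≤ : (1# + ε) * new D ≤ D - now
          new≤ with total ℓ D
          ... | inj₁ ℓ≤D = arith 5 (λ e x D l t → (x ⊑ D :- l ∷ e :* x ⊑ l :- t ∷ []) ⊢ (# 1 :+ e) :* x ≼ D :- t) refl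
            (share≤laxity ℓ≤D) (≤-trans (*-monoʳ-≤ ε 0≤ε (share≤r D 0≤p)) εp≤)
          ... | inj₂ D≤ℓ = ≤-trans (≤-reflexive (trans (cong ((1# + ε) *_) (share-early D≤ℓ)) (zeroʳ _)))
            (diff-nonneg t≤D)
          Y≤' : (1# + ε) * Y ≤ (c * (1# + ε) + 1#) * (D - now)
          Y≤' = subst (λ v → (1# + ε) * (v - Vol threshold + c * (threshold - now)) ≤ (c * (1# + ε) + 1#) * (D - now))
            (sym (Vol'-eq D))
            (arith 8 (λ e x v w c h t D → (# 0 ⊑ (# 1 :+ e) :* (w :+ c :* (D :- h) :- v) ∷ (# 1 :+ e) :* x ⊑ D :- t ∷ [])
              ⊢ (# 1 :+ e) :* (x :+ v :- w :+ c :* (h :- t)) ≼ (c :* (# 1 :+ e) :+ # 1) :* (D :- t)) refl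
              (*-nonNegative (<⇒≤ 0<1+ε) (diff-nonneg (far-volume h≤D))) new≤)

        before-start : ∀ {k D} → k ℕ.≤ m → now ≤ D → D ≤ threshold → D ≤ ℓ →
                       Vol' D ≤ natural k * (D - now) + σ k * (raised - now)
        before-start {k} {D} k≤m t≤D D≤h D≤ℓ = subst (_≤ natural k * (D - now) + σ k * (raised - now)) (sym (Vol'-eq D))
          (arith 6 (λ x v a g h r → (x ≗ # 0 ∷ v ⊑ a :+ g :* h ∷ # 0 ⊑ g :* (r :- h) ∷ [])
            ⊢ x :+ v ≼ a :+ g :* r) refl
            (share-early D≤ℓ) (near-volume k≤m t≤D D≤h)
            (*-nonNegative (0≤σ k≤m) (diff-nonneg (+-monoˡ-≤ (- now) h≤raised))))

        near-volume' : ∀ {k D} → k ℕ.≤ m → now ≤ D → D ≤ raised →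
                       Vol' D ≤ natural k * (D - now) + σ k * (raised - now)
        near-volume' {k} {D} k≤m t≤D D≤r with total threshold D
        ... | inj₁ h≤D = late k≤m h≤D D≤r
        near-volume' {k} {D} k≤m t≤D D≤r | inj₂ D≤h with D ≤? ℓ
        near-volume' {k} {D} k≤m t≤D D≤r | inj₂ D≤h | yes D≤ℓ = before-start k≤m t≤D D≤h D≤ℓ
        near-volume' {suc k} {D} k≤m t≤D D≤r | inj₂ D≤h | no D≰ℓ = early k≤m t≤D D≤h (≰⇒> D≰ℓ)
        near-volume' {zero} {D} k≤m t≤D D≤r | inj₂ D≤h | no D≰ℓ = ≤-trans
          (V-mono (n ∷ tasks) rem D≤h)
          (≤-trans (late {0} z≤n ≤-refl h≤raised) (≤-reflexive
            (arith 4 (λ h D t g → [] ⊢ # 0 :* (h :- t) :+ g ≈ # 0 :* (D :- t) :+ g) refl)))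

      private
        account' : c * (used + (raised - threshold)) + ∑ (n ∷ tasks) (idle ∘ id) ≡ ∑ (n ∷ tasks) (work ∘ id) + Vol' raised
        account' = trans (arith 8 (λ c u x i w v y z →
            (c :* u :+ i ≐ w :+ v ∷ y ≐ # 0 ∷ # 0 ≐ z ∷ [])
            ⊢ c :* (u :+ x) :+ (y :+ i) ≈ (z :+ w) :+ (v :+ c :* x)) refl account no-idle (sym no-work))
          (cong ((work (id n) + ∑ tasks (work ∘ id)) +_) (sym Vol-raised))

        far-task' : ∀ {e} → e ∈ n ∷ tasks → raised < dl e →
                    idle (id e) + rem e ≡ size e ⊎ dl e - raised ≤ rem e
        far-task' (here refl) _ = inj₁ (trans (cong₂ _+_ no-idle rem-n) (+-identityˡ _))
        far-task' (there e∈) r<d = weaken (far-task e∈ (≤-<-trans h≤raised r<d))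
          where
          weaken : ∀ {A d r} → A ⊎ d - threshold ≤ r → A ⊎ d - raised ≤ r
          weaken (inj₁ eq) = inj₁ eq
          weaken (inj₂ le) = inj₂ (arith 4 (λ d h r x → (d :- h ⊑ x ∷ h ⊑ r ∷ []) ⊢ d :- r ≼ x) refl le h≤raised)

      accept-sound : Sound accept
      accept-sound = record
        { now≤threshold = ≤-trans now≤threshold h≤raised
        ; 0≤used        = +-nonneg 0≤used (diff-nonneg h≤raised)
        ; distinct      = distinct'
        ; fresh         = fresh'
        ; fresh-work    = λ k n<k → fresh-work k (ℕ.<⇒≤ n<k)
        ; fresh-idle    = λ k n<k → fresh-idle k (ℕ.<⇒≤ n<k)
        ; 0≤work        = 0≤work
        ; 0≤rem         = 0≤rem'
        ; rel≤now       = rel≤now'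
        ; far-volume    = far-volume'
        ; near-volume   = near-volume'
        ; far-task      = far-task'
        ; account       = account'
        }

module Competition (ℛ : Reals) (m : ℕ) (1≤m : 1 ℕ.≤ m) (ε : Reals.ℝ ℛ)
               (0<ε : Reals._<_ ℛ (Reals.0# ℛ) ε)
               (ε≤1 : Reals._≤_ ℛ ε (Reals.1# ℛ)) where
  open OrderedField ℛ
  open Summation ℛ
  open Volumes ℛ
  open Parameters ℛ m 1≤m ε 0<ε ε≤1
  open Weighting ℛ m 1≤m
  open States ℛ m 1≤m ε 0<ε ε≤1
  open Flows ℛ m 1≤m ε 0<ε ε≤1
  open Raises ℛ m 1≤m ε 0<ε ε≤1

  above : List Task → (Task → Bool) → ℝ → ℕ
  above es S y = count es (λ x → S x ∧ does (y ≤? dl x))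

  ∧-true : ∀ {a b} → a ∧ b ≡ true → a ≡ true × b ≡ true
  ∧-true {true} {true} _ = refl , refl

  above-anti : ∀ es S {x y} → x ≤ y → above es S y ℕ.≤ above es S x
  above-anti es S {x} {y} x≤y = count-≤ es λ {z} _ p →
    cong₂ _∧_ (proj₁ (∧-true p)) (true-does (x ≤? dl z) (≤-trans x≤y (does-true {d = y ≤? dl z} (proj₂ (∧-true {S z} p)))))

  weight : List Task → (C S : Task → Bool) → Task → ℝ
  weight es C S e = if C e ∨ S e then 1# else 1# - ψ (above es S (dl e))

  weighted : List Task → (C S : Task → Bool) → (Task → ℝ) → ℝ
  weighted es C S ω = ∑ es (λ e → weight es C S e * ω e)

  module _ (es : List Task) (C S : Task → Bool) {e : Task} where

    weight-one : C e ≡ true ⊎ S e ≡ true → weight es C S e ≡ 1#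
    weight-one (inj₁ c) rewrite c = refl
    weight-one (inj₂ s) with C e
    ... | true  = refl
    ... | false rewrite s = refl

    weight-φ : C e ≡ false → S e ≡ false → weight es C S e ≡ 1# - ψ (above es S (dl e))
    weight-φ c s rewrite c | s = refl

  -- Increasing the weights to 1 on the jobs in C' amounts to enlarging S by
  -- those among them that satisfy P, provided that this is harmless for
  -- the others.
  widened : (C C' S P : Task → Bool) → Task → Bool
  widened C C' S P e = S e ∨ (P e ∧ (C' e ∧ not (C e)))

  closing : ∀ es (C C' S P : Task → Bool) (ω : Task → ℝ) →
    (∀ {e} → e ∈ es → C e ≡ true → C' e ≡ true) →
    (∀ {x y} → x ∈ es → y ∈ es → C' x ≡ true → dl y ≤ dl x → C' y ≡ true) →
    (∀ {e} → e ∈ es → C' e ≡ true → C e ≡ false → P e ≡ false → ω e ≤ 0#) →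
    weighted es C' S ω ≤ weighted es C (widened C C' S P) ω
  closing es C C' S P ω grows down harmless = ∑-mono es term
    where
    F : Task → Bool
    F = widened C C' S P
    F-S : ∀ {e} → S e ≡ true → F e ≡ true
    F-S s rewrite s = refl
    term : ∀ {e} → e ∈ es → weight es C' S e * ω e ≤ weight es C F e * ω e
    term {e} e∈ with true-or-false (C e) | true-or-false (S e)
    ... | inj₁ c | _ = ≤-reflexive (cong (_* ω e)
      (trans (weight-one es C' S (inj₁ (grows e∈ c))) (sym (weight-one es C F (inj₁ c)))))
    ... | inj₂ _ | inj₁ s = ≤-reflexive (cong (_* ω e)
      (trans (weight-one es C' S (inj₂ s)) (sym (weight-one es C F (inj₂ (F-S s))))))
    ... | inj₂ ¬c | inj₂ ¬s with true-or-false (C' e) | true-or-false (P e)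
    ...   | inj₁ c' | inj₁ p = ≤-reflexive (cong (_* ω e)
      (trans (weight-one es C' S (inj₁ c')) (sym (weight-one es C F (inj₂ in-F)))))
      where
      in-F : F e ≡ true
      in-F rewrite ¬s | p | c' | ¬c = refl
    ...   | inj₁ c' | inj₂ ¬p = subst₂ (λ x y → x * ω e ≤ y * ω e)
      (sym (weight-one es C' S (inj₁ c'))) (sym (weight-φ es C F ¬c ¬f))
      (arith 2 (λ w y → (# 0 ⊑ y :* (# 0 :- w) ∷ []) ⊢ # 1 :* w ≼ (# 1 :- y) :* w) refl
        (*-nonNegative (0≤ψ (above es F (dl e))) (diff-nonneg (harmless e∈ c' ¬c ¬p))))
      where
      ¬f : F e ≡ false
      ¬f rewrite ¬s | ¬p = refl
    ...   | inj₂ ¬c' | _ = ≤-reflexive (cong (_* ω e)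
      (trans (weight-φ es C' S ¬c' ¬s) (trans (cong (λ k → 1# - ψ k) (count-cong es same)) (sym (weight-φ es C F ¬c ¬f)))))
      where
      ¬f : F e ≡ false
      ¬f rewrite ¬s | ¬c' with P e
      ... | true  = refl
      ... | false = refl
      same : ∀ {x} → x ∈ es → S x ∧ does (dl e ≤? dl x) ≡ F x ∧ does (dl e ≤? dl x)
      same {x} x∈ with true-or-false (S x)
      ... | inj₁ s rewrite s = refl
      ... | inj₂ ¬sx with holds-or-not (dl e ≤? dl x)
      ...   | inj₂ e≰x rewrite ¬sx | false-does (dl e ≤? dl x) e≰x with P x ∧ (C' x ∧ not (C x))
      ...     | true  = refl
      ...     | false = refl
      same {x} x∈ | inj₂ ¬sx | inj₁ e≤x with true-or-false (C' x)
      ...     | inj₁ c'x = contradiction (trans (sym ¬c') (down x∈ e∈ c'x e≤x)) λ ()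
      ...     | inj₂ ¬c'x rewrite ¬sx | ¬c'x with P x
      ...       | true  = refl
      ...       | false = refl

  0≤weight : ∀ es C S e → 0# ≤ weight es C S e
  0≤weight es C S e with C e ∨ S e
  ... | true  = 0≤1
  ... | false = diff-nonneg (ψ≤1 (above es S (dl e)))

  weighted-+ : ∀ es C S (ω ω' : Task → ℝ) →
    weighted es C S (λ e → ω e + ω' e) ≡ weighted es C S ω + weighted es C S ω'
  weighted-+ es C S ω ω' = trans (∑-cong es (λ {e} _ → arith 3 (λ w a b → [] ⊢ w :* (a :+ b) ≈ w :* a :+ w :* b) refl))
    (∑-+ es (λ e → weight es C S e * ω e) (λ e → weight es C S e * ω' e))

  count-split : ∀ (es : List Task) (p r : Task → Bool) →
    count es p ≡ count es (λ e → r e ∧ p e) ℕ.+ count es (λ e → not (r e) ∧ p e)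
  count-split []       p r = refl
  count-split (e ∷ es) p r with r e | p e
  ... | true  | true  = cong suc (count-split es p r)
  ... | true  | false = count-split es p r
  ... | false | true  = trans (cong suc (count-split es p r)) (sym (ℕ.+-suc _ _))
  ... | false | false = count-split es p r

  -- While the jobs in run are processed for a time δ, the competing
  -- schedule does D e on job e.
  module _ (es : List Task) (C run F : Task → Bool) (D : Task → ℝ) {δ : ℝ}
           (0≤δ : 0# ≤ δ) (0≤D : ∀ {e} → e ∈ es → 0# ≤ D e) (D≤δ : ∀ {e} → e ∈ es → D e ≤ δ)
           (D≤Mδ : ∑ es D ≤ M * δ)
           (over : ∀ {e} → e ∈ es → C e ≡ true → D e ≤ 0# × run e ≡ false) where

    private
      Q q₁ q₂ N : ℕ
      Q  = count es F
      q₁ = count es (λ e → run e ∧ F e)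
      q₂ = count es (λ e → not (run e) ∧ F e)
      N  = count es run

      gain : weighted es C F D ≤ (1# - ψ Q) * (M * δ) + ψ Q * ∑ es (λ e → [ F e ] * D e)
      gain = ≤-trans (∑-mono es term) (≤-trans (≤-reflexive
          (trans (∑-+ es _ _) (cong₂ _+_ (∑-*ˡ es (1# - ψ Q) D) (∑-*ˡ es (ψ Q) (λ e → [ F e ] * D e)))))
        (+-monoˡ-≤ _ (*-monoʳ-≤ (1# - ψ Q) (diff-nonneg (ψ≤1 Q)) D≤Mδ)))
        where
        term : ∀ {e} → e ∈ es → weight es C F e * D e ≤ (1# - ψ Q) * D e + ψ Q * ([ F e ] * D e)
        term {e} e∈ with true-or-false (F e) | true-or-false (C e)
        ... | inj₁ f | _ = ≤-reflexive (trans (cong (_* D e) (weight-one es C F (inj₂ f)))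
          (trans (arith 2 (λ y d → [] ⊢ # 1 :* d ≈ (# 1 :- y) :* d :+ y :* (# 1 :* d)) refl)
            (cong (λ b → (1# - ψ Q) * D e + ψ Q * ([ b ] * D e)) (sym f))))
        ... | inj₂ _ | inj₁ c rewrite ≤-antisym (proj₁ (over e∈ c)) (0≤D e∈) =
          ≤-reflexive (arith 3 (λ w y x → [] ⊢ w :* # 0 ≈ (# 1 :- y) :* # 0 :+ y :* (x :* # 0)) refl)
        ... | inj₂ ¬f | inj₂ ¬c = subst₂ (λ w b → w * D e ≤ (1# - ψ Q) * D e + ψ Q * ([ b ] * D e))
          (sym (weight-φ es C F ¬c ¬f)) (sym ¬f)
          (arith 3 (λ x y d → (# 0 ⊑ (y :- x) :* d ∷ []) ⊢ (# 1 :- y) :* d ≼ (# 1 :- x) :* d :+ x :* (# 0 :* d)) refl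
            (*-nonNegative (diff-nonneg (ψ-anti above≤Q)) (0≤D e∈)))
          where
          above≤Q : above es F (dl e) ℕ.≤ Q
          above≤Q = count-≤ es (λ {x} _ p → proj₁ (∧-true p))

      few-gain : ∑ es (λ e → [ F e ] * D e) ≤ natural Q * δ
      few-gain = ≤-trans (∑-mono es (λ {e} e∈ → *-monoʳ-≤ [ F e ] (0≤[] (F e)) (D≤δ e∈)))
        (≤-reflexive (trans (∑-*ʳ es δ _) (cong (_* δ) (sym (natural-count es F)))))

      whole-gain : ∑ es (λ e → [ F e ] * D e) ≤ M * δ
      whole-gain = ≤-trans (∑-mono es (λ {e} e∈ → ≤-trans (*-monoˡ-≤ (D e) (0≤D e∈) ([]≤1 (F e)))
        (≤-reflexive (*-identityˡ (D e))))) D≤Mδ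

      Loss : Set
      Loss = (1# - ψ Q) * (M * δ) + ψ Q * ∑ es (λ e → [ F e ] * D e)
               ≤ weighted es C F (λ e → [ run e ] * δ) + κ * (natural N * δ)

      nonneg-term : ∀ e → 0# ≤ weight es C F e * [ run e ]
      nonneg-term e = *-nonNegative (0≤weight es C F e) (0≤[] (run e))

      factor : weighted es C F (λ e → [ run e ] * δ) ≡ ∑ es (λ e → weight es C F e * [ run e ]) * δ
      factor = trans (∑-cong es (λ _ → sym (*-assoc _ _ _))) (∑-*ʳ es δ _)

      narrow : N ℕ.≤ m → (∀ {e} → e ∈ es → F e ≡ true → run e ≡ true) → Loss
      narrow N≤m all = subst (λ x → (1# - ψ Q) * (M * δ) + ψ Q * ∑ es (λ e → [ F e ] * D e) ≤ x + κ * (natural N * δ)) (sym factor)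
        (arith 8 (λ y M d g Q N k w →
            (# 0 ⊑ y :* (Q :* d :- g) ∷ # 0 ⊑ (k :* Q :- (# 1 :- y) :* (M :- Q)) :* d ∷ # 0 ⊑ k :* (N :- Q) :* d ∷ # 0 ⊑ (w :- Q) :* d ∷ [])
            ⊢ (# 1 :- y) :* (M :* d) :+ y :* g ≼ w :* d :+ k :* (N :* d)) refl
          (*-nonNegative (0≤ψ Q) (diff-nonneg few-gain))
          (*-nonNegative (diff-nonneg (ψ-narrow (ℕ.≤-trans Q≤N N≤m))) 0≤δ)
          (*-nonNegative (*-nonNegative 0≤κ (diff-nonneg (natural-mono Q≤N))) 0≤δ)
          (*-nonNegative (diff-nonneg (subst (_≤ ∑ es (λ e → weight es C F e * [ run e ])) (sym (natural-count es F)) (∑-mono es term))) 0≤δ))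
        where
        Q≤N : Q ℕ.≤ N
        Q≤N = count-≤ es all
        term : ∀ {e} → e ∈ es → [ F e ] ≤ weight es C F e * [ run e ]
        term {e} e∈ with true-or-false (F e)
        ... | inj₁ f  = ≤-reflexive (trans (cong [_] f) (trans (sym (*-identityˡ 1#))
          (cong₂ (λ w b → w * [ b ]) (sym (weight-one es C F (inj₂ f))) (sym (all e∈ f)))))
        ... | inj₂ ¬f = subst (λ b → [ b ] ≤ weight es C F e * [ run e ]) (sym ¬f) (nonneg-term e)

      wide : N ≡ m →
             (∀ {e x} → e ∈ es → x ∈ es → run e ≡ true → F e ≡ false → C e ≡ false → F x ≡ true → run x ≡ false → dl e ≤ dl x) →
             Loss
      wide N≡m ordered = subst (λ x → (1# - ψ Q) * (M * δ) + ψ Q * ∑ es (λ e → [ F e ] * D e) ≤ x + κ * (natural N * δ)) (sym factor)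
        (subst (λ n → (1# - ψ Q) * (M * δ) + ψ Q * ∑ es (λ e → [ F e ] * D e)
                    ≤ ∑ es (λ e → weight es C F e * [ run e ]) * δ + κ * (n * δ)) (sym (cong natural N≡m)) bound)
        where
        q₁≤m : q₁ ℕ.≤ m
        q₁≤m = subst (q₁ ℕ.≤_) N≡m (count-≤ es (λ {x} _ p → proj₁ (∧-true p)))
        Q≡ : Q ≡ q₁ ℕ.+ q₂
        Q≡ = count-split es F run
        term : ∀ {e} → e ∈ es → (1# - ψ q₂) * [ run e ] + ψ q₂ * [ run e ∧ F e ] ≤ weight es C F e * [ run e ]
        term {e} e∈ with true-or-false (run e) | true-or-false (F e)
        ... | inj₂ ¬r | _ rewrite ¬r = ≤-reflexive (arith 2 (λ y w → [] ⊢ (# 1 :- y) :* # 0 :+ y :* # 0 ≈ w :* # 0) refl)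
        ... | inj₁ r | inj₁ f = subst (λ w → (1# - ψ q₂) * [ run e ] + ψ q₂ * [ run e ∧ F e ] ≤ w * [ run e ])
          (sym (weight-one es C F (inj₂ f))) (lemma (run e) (F e) r f)
          where
          lemma : ∀ a b → a ≡ true → b ≡ true → (1# - ψ q₂) * [ a ] + ψ q₂ * [ a ∧ b ] ≤ 1# * [ a ]
          lemma true true _ _ = ≤-reflexive (arith 1 (λ y → [] ⊢ (# 1 :- y) :* # 1 :+ y :* # 1 ≈ # 1 :* # 1) refl)
        ... | inj₁ r | inj₂ ¬f with true-or-false (C e)
        ...   | inj₁ c = contradiction (trans (sym r) (proj₂ (over e∈ c))) λ ()
        ...   | inj₂ ¬c = subst (λ w → (1# - ψ q₂) * [ run e ] + ψ q₂ * [ run e ∧ F e ] ≤ w * [ run e ])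
          (sym (weight-φ es C F ¬c ¬f)) (lemma (run e) (F e) r ¬f (ψ-anti q₂≤))
          where
          lemma : ∀ a b → a ≡ true → b ≡ false → ψ (above es F (dl e)) ≤ ψ q₂ →
                  (1# - ψ q₂) * [ a ] + ψ q₂ * [ a ∧ b ] ≤ (1# - ψ (above es F (dl e))) * [ a ]
          lemma true false _ _ = arith 2 (λ x y → (y ⊑ x ∷ []) ⊢ (# 1 :- x) :* # 1 :+ x :* # 0 ≼ (# 1 :- y) :* # 1) refl
          q₂≤ : q₂ ℕ.≤ above es F (dl e)
          q₂≤ = count-≤ es λ {x} x∈ p → cong₂ _∧_ (proj₂ (∧-true {not (run x)} p))
            (true-does (dl e ≤? dl x) (ordered e∈ x∈ r ¬f ¬c (proj₂ (∧-true {not (run x)} p)) (not-true (proj₁ (∧-true {not (run x)} p)))))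
            where
            not-true : ∀ {b} → not b ≡ true → b ≡ false
            not-true {false} _ = refl
        W : ℝ
        W = ∑ es (λ e → weight es C F e * [ run e ])
        loss : (1# - ψ q₂) * M + ψ q₂ * natural q₁ ≤ W
        loss = ≤-trans (≤-reflexive (sym (trans (∑-+ es _ _) (cong₂ _+_
            (trans (∑-*ˡ es (1# - ψ q₂) _) (cong ((1# - ψ q₂) *_) (trans (sym (natural-count es run)) (cong natural N≡m))))
            (trans (∑-*ˡ es (ψ q₂) _) (cong (ψ q₂ *_) (sym (natural-count es (λ e → run e ∧ F e)))))))))
          (∑-mono es term)
        bound : (1# - ψ Q) * (M * δ) + ψ Q * ∑ es (λ e → [ F e ] * D e) ≤ W * δ + κ * (M * δ)
        bound with ℕ.≤-total (q₁ ℕ.+ q₂) m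
        ... | inj₁ Q≤m = arith 9 (λ y M d g Q w k z q →
            (# 0 ⊑ y :* (Q :* d :- g)
            ∷ # 0 ⊑ ((M :- Q) :* y :+ k :* M :- (M :- q) :* z) :* d
            ∷ # 0 ⊑ (w :- ((# 1 :- z) :* M :+ z :* q)) :* d ∷ [])
            ⊢ (# 1 :- y) :* (M :* d) :+ y :* g ≼ w :* d :+ k :* (M :* d)) refl
          (*-nonNegative (0≤ψ Q) (diff-nonneg few-gain))
          (*-nonNegative (diff-nonneg (subst (λ n → (M - natural q₁) * ψ q₂ ≤ (M - natural n) * ψ n + κ * M) (sym Q≡) (ψ-wide {q₁} {q₂} Q≤m))) 0≤δ)
          (*-nonNegative (diff-nonneg loss) 0≤δ)
        ... | inj₂ m≤Q = arith 8 (λ y M d g w k z q →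
            (# 0 ⊑ y :* (M :* d :- g)
            ∷ # 0 ⊑ (k :* M :- (M :- q) :* z) :* d
            ∷ # 0 ⊑ (w :- ((# 1 :- z) :* M :+ z :* q)) :* d ∷ [])
            ⊢ (# 1 :- y) :* (M :* d) :+ y :* g ≼ w :* d :+ k :* (M :* d)) refl
          (*-nonNegative (0≤ψ Q) (diff-nonneg whole-gain))
          (*-nonNegative (diff-nonneg (ψ-total {q₁} {q₂} q₁≤m m≤Q)) 0≤δ)
          (*-nonNegative (diff-nonneg loss) 0≤δ)

    rate : N ℕ.≤ m →
      (∀ {e} → e ∈ es → F e ≡ true → run e ≡ true) ⊎
      N ≡ m ×
      (∀ {e x} → e ∈ es → x ∈ es → run e ≡ true → F e ≡ false → C e ≡ false → F x ≡ true → run x ≡ false → dl e ≤ dl x) →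
      weighted es C F (λ e → D e - [ run e ] * δ) ≤ κ * (natural N * δ)
    rate N≤m full = subst (_≤ κ * (natural N * δ)) (sym difference)
      (arith 4 (λ a b g k → (a ⊑ g ∷ g ⊑ b :+ k ∷ []) ⊢ a :- b ≼ k) refl gain (cases full))
      where
      difference : weighted es C F (λ e → D e - [ run e ] * δ) ≡ weighted es C F D - weighted es C F (λ e → [ run e ] * δ)
      difference = trans (∑-cong es (λ {e} _ → arith 3 (λ w a b → [] ⊢ w :* (a :- b) ≈ w :* a :- w :* b) refl)) (∑-- es _ _)
      cases : (∀ {e} → e ∈ es → F e ≡ true → run e ≡ true) ⊎ N ≡ m ×
        (∀ {e x} → e ∈ es → x ∈ es → run e ≡ true → F e ≡ false → C e ≡ false → F x ≡ true → run x ≡ false → dl e ≤ dl x) → Loss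
      cases (inj₁ all)             = narrow N≤m all
      cases (inj₂ (N≡m , ordered)) = wide N≡m ordered

  due : ℝ → Task → Bool
  due y e = does (dl e ≤? y)

  due-grows : ∀ {x y} → x ≤ y → ∀ {e} → due x e ≡ true → due y e ≡ true
  due-grows {x} {y} x≤y {e} d = true-does (dl e ≤? y) (≤-trans (does-true {d = dl e ≤? x} d) x≤y)

  due-down : ∀ {y e e'} → due y e ≡ true → dl e' ≤ dl e → due y e' ≡ true
  due-down {y} {e} {e'} d le = true-does (dl e' ≤? y) (≤-trans le (does-true {d = dl e ≤? y} d))

  due-yes : ∀ {y e} → dl e ≤ y → due y e ≡ true
  due-yes {y} {e} = true-does (dl e ≤? y)

  due-no : ∀ {y e} → y < dl e → due y e ≡ false
  due-no {y} {e} y<d = false-does (dl e ≤? y) (<⇒≱ y<d)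

  due-no⁻¹ : ∀ {y e} → due y e ≡ false → y < dl e
  due-no⁻¹ {y} {e} d = ≰⇒> (does-false {d = dl e ≤? y} d)

  record Legal (s : State) (S : Task → Bool) : Set where
    open State s
    field
      unexpired : ∀ {e} → e ∈ tasks → S e ≡ true → threshold < dl e
      pending   : ∀ {e} → e ∈ tasks → S e ≡ true → 0# < rem e
      tight     : ∀ {e} → e ∈ tasks → threshold < dl e → 0# < rem e → start-by e ≤ threshold → S e ≡ true

  -- O k t is the amount of work that a competing schedule has done on job
  -- k by time t.
  record Opponent (O : ℕ → ℝ → ℝ) : Set where
    field
      nonneg    : ∀ k x → 0# ≤ O k x
      mono      : ∀ k {x y} → x ≤ y → O k x ≤ O k y
      lipschitz : ∀ k {x y} → x ≤ y → O k y ≤ O k x + (y - x)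
      capacity  : ∀ es → AllPairs (λ e e' → id e ≢ id e') es → ∀ {x y} → x ≤ y →
                  ∑ es (λ e → O (id e) y) ≤ ∑ es (λ e → O (id e) x) + M * (y - x)

  record Knows (O : ℕ → ℝ → ℝ) (e : Task) : Set where
    field
      before : ∀ {x} → x ≤ rel e → O (id e) x ≡ 0#
      after  : ∀ {x y} → dl e ≤ x → x ≤ y → O (id e) y ≤ O (id e) x

  -- o k is the part of O k that was done while the threshold was equal to
  -- the current time.
  record Rival (O : ℕ → ℝ → ℝ) (s : State) (o : ℕ → ℝ) : Set where
    open State s
    field
      knows   : ∀ {e} → e ∈ tasks → Knows O e
      within  : ∀ {e} → e ∈ tasks → threshold < dl e → ∀ x → O (id e) x ≤ size e
      0≤o     : ∀ k → 0# ≤ o k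
      o≤O     : ∀ k → o k ≤ O k now
      bulk    : ∑ tasks (λ e → O (id e) now) ≤ M * (used - (threshold - now)) + ∑ tasks (o ∘ id)
      -- Once all jobs are due this says ∑ o ≤ (1 + κ) ∑ idle.  Before that, S
      -- ranges over the sets of pending jobs that may yet be delayed beyond
      -- the next raise of the threshold; a job outside S counts the less,
      -- the fewer jobs of S are due after it.
      balance : ∀ S → Legal s S →
                weighted tasks (due threshold) S (λ e → o (id e) - idle (id e)) ≤ κ * ∑ tasks (idle ∘ id)

  is-pending : State → Task → Bool
  is-pending s e = does (0# <? State.rem s e)

  Settled : State → Set
  Settled s = ∀ {e} → e ∈ tasks → threshold < dl e → ¬ 0# < rem e → size e ≤ idle (id e)
    where open State s

  module _ {s : State} (sound : Sound s) where
    open State s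
    open Sound sound

    settled : Settled s
    settled {e} e∈ h<d done with far-task e∈ h<d
    ... | inj₁ eq = arith 3 (λ i r p → (i :+ r ≗˘ p ∷ r ⊑ # 0 ∷ []) ⊢ p ≼ i) refl eq (≮⇒≥ done)
    ... | inj₂ le = contradiction (<-≤-trans (<-diff h<d) le) done

  module _ {s : State} (settled : Settled s) {O : ℕ → ℝ → ℝ} {o : ℕ → ℝ} (rival : Rival O s o) where
    open State s
    open Rival rival

    raise-balance : ∀ {h'} → threshold ≤ h' → ∀ S →
      (∀ {e} → e ∈ tasks → S e ≡ true → h' < dl e) →
      (∀ {e} → e ∈ tasks → S e ≡ true → 0# < rem e) →
      (∀ {e} → e ∈ tasks → h' < dl e → 0# < rem e → start-by e ≤ h' → S e ≡ true) →
      weighted tasks (due h') S (λ e → o (id e) - idle (id e)) ≤ κ * ∑ tasks (idle ∘ id)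
    raise-balance {h'} h≤h' S unexpired pending tight = ≤-trans
      (closing tasks (due threshold) (due h') S (is-pending s) _
        (λ {e} _ → due-grows h≤h' {e}) (λ {x} {y} _ _ → due-down {h'} {x} {y})
        (λ {e} e∈ _ h<d done → arith 4 (λ o O p i → (o ⊑ O ∷ O ⊑ p ∷ p ⊑ i ∷ []) ⊢ o :- i ≼ # 0) refl
          (o≤O (id e)) (within e∈ (due-no⁻¹ {threshold} {e} h<d) now)
          (settled e∈ (due-no⁻¹ {threshold} {e} h<d) (does-false {d = 0# <? rem e} done))))
      (balance F legal)
      where
      F : Task → Bool
      F = widened (due threshold) (due h') S (is-pending s)
      split : ∀ {e} → F e ≡ true → S e ≡ true ⊎ 0# < rem e × threshold < dl e
      split {e} f with S e
      ... | true  = inj₁ refl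
      ... | false with does-true {d = 0# <? rem e} (proj₁ (∧-true f)) | proj₂ (∧-true {due h' e} (proj₂ (∧-true {is-pending s e} f)))
      ...   | 0<rem | h<d with true-or-false (due threshold e)
      ...     | inj₂ d = inj₂ (0<rem , due-no⁻¹ {threshold} {e} d)
      ...     | inj₁ d = contradiction (trans (cong not (sym d)) h<d) λ ()
      legal : Legal s F
      legal = record
        { unexpired = λ e∈ f → unexpired' e∈ (split f)
        ; pending   = λ e∈ f → pending' e∈ (split f)
        ; tight     = λ {e} e∈ h<d 0<rem ℓ≤h → tight' e∈ h<d 0<rem ℓ≤h (dl e ≤? h')
        }
        where
        unexpired' : ∀ {e} → e ∈ tasks → S e ≡ true ⊎ 0# < rem e × threshold < dl e → threshold < dl e
        unexpired' e∈ (inj₁ s)       = ≤-<-trans h≤h' (unexpired e∈ s)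
        unexpired' e∈ (inj₂ (_ , l)) = l
        pending' : ∀ {e} → e ∈ tasks → S e ≡ true ⊎ 0# < rem e × threshold < dl e → 0# < rem e
        pending' e∈ (inj₁ s)       = pending e∈ s
        pending' e∈ (inj₂ (r , _)) = r
        tight' : ∀ {e} → e ∈ tasks → threshold < dl e → 0# < rem e → start-by e ≤ threshold → Dec (dl e ≤ h') → F e ≡ true
        tight' {e} e∈ h<d 0<rem ℓ≤h (yes d≤h')
          rewrite true-does (0# <? rem e) 0<rem | due-yes {h'} {e} d≤h' | due-no {threshold} {e} h<d with S e
        ... | true  = refl
        ... | false = refl
        tight' {e} e∈ h<d 0<rem ℓ≤h (no d≰h') rewrite tight e∈ (≰⇒> d≰h') 0<rem (≤-trans ℓ≤h h≤h') = refl

  module _ {s : State} (sound : Sound s) {O : ℕ → ℝ → ℝ} (opponent : Opponent O) {o : ℕ → ℝ} (rival : Rival O s o) where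
    open State s
    open Sound sound
    open Opponent opponent
    open Rival rival

    guard-rival : ∀ {b} → threshold ≡ now → b ∈ tasks → now < dl b → Rival O (guard-raise s b) o
    guard-rival {b} open-gap b∈ t<b = record
      { knows   = knows
      ; within  = λ e∈ b<d → within e∈ (≤-<-trans h≤b b<d)
      ; 0≤o     = 0≤o
      ; o≤O     = o≤O
      ; bulk    = subst (∑ tasks (λ e → O (id e) now) ≤_) (cong (_+ ∑ tasks (o ∘ id))
          (trans (cong (λ h → M * (used - (h - now))) open-gap)
            (arith 4 (λ M u t b → [] ⊢ M :* (u :- (t :- t)) ≈ M :* ((u :+ (b :- t)) :- (b :- t))) refl))) bulk
      ; balance = λ S legal → raise-balance (settled sound) rival h≤b S (Legal.unexpired legal) (Legal.pending legal) (Legal.tight legal)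
      }
      where
      h≤b : threshold ≤ dl b
      h≤b = subst (_≤ dl b) (sym open-gap) (<⇒≤ t<b)

    module _ {χ : ℕ → Bool} {δ : ℝ} (phase : BlockPhase s χ) (limit : BlockLimit s χ δ) where
      open BlockPhase phase
      open BlockLimit limit
      open Steadily sound runnable steady
      open Steady steady
      open Flow s χ δ

      block-rival : ∀ new → Rival O (block-flow s χ δ new) o
      block-rival new = record
        { knows   = knows
        ; within  = within
        ; 0≤o     = 0≤o
        ; o≤O     = λ k → ≤-trans (o≤O k) (mono k now≤now')
        ; bulk    = ≤-trans (capacity tasks distinct now≤now')
            (arith 7 (λ x y M u h t d → (x ⊑ M :* (u :- (h :- t)) :+ y ∷ [])
              ⊢ x :+ M :* ((t :+ d) :- t) ≼ M :* (u :- (h :- (t :+ d))) :+ y) refl bulk)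
        ; balance = λ S legal → balance S (back S legal)
        }
        where
        now≤now' : now ≤ now + δ
        now≤now' = arith 2 (λ t d → (# 0 ⊑ d ∷ []) ⊢ t ≼ t :+ d) refl 0≤δ
        back : ∀ S → Legal (block-flow s χ δ new) S → Legal s S
        back S legal = record
          { unexpired = Legal.unexpired legal
          ; pending   = λ {e} e∈ y → <-≤-trans (Legal.pending legal e∈ y) (subst (_≤ rem e) (sym (rem'-eq e))
              (arith 2 (λ r y → (# 0 ⊑ y ∷ []) ⊢ r :- y ≼ r) refl (*-nonNegative (0≤[] (χ (id e))) 0≤δ)))
          ; tight     = tight'
          }
          where
          tight' : ∀ {e} → e ∈ tasks → threshold < dl e → 0# < rem e → start-by e ≤ threshold → S e ≡ true
          tight' {e} e∈ h<d 0<rem ℓ≤h with true-or-false (χ (id e))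
          ... | inj₁ run = Legal.tight legal e∈ h<d
            (subst (0# <_) (sym (running-rem e run)) (<-≤-trans (<-diff h<d)
              (arith 4 (λ d h r x → (d :- r :+ x ⊑ h ∷ []) ⊢ d :- h ≼ r :- x) refl (near-end e∈ run))))
            (subst (_≤ threshold) (sym (start-by' e∈ run)) (near-end e∈ run))
          ... | inj₂ wait = Legal.tight legal e∈ h<d (subst (0# <_) (sym (idle-rem e wait)) 0<rem)
            (subst (λ r → dl e - r ≤ threshold) (sym (idle-rem e wait)) ℓ≤h)

module Rivalry (ℛ : Reals) (m : ℕ) (1≤m : 1 ℕ.≤ m) (ε : Reals.ℝ ℛ)
               (0<ε : Reals._<_ ℛ (Reals.0# ℛ) ε)
               (ε≤1 : Reals._≤_ ℛ ε (Reals.1# ℛ)) where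
  open OrderedField ℛ
  open Summation ℛ
  open Volumes ℛ
  open Parameters ℛ m 1≤m ε 0<ε ε≤1
  open Weighting ℛ m 1≤m
  open States ℛ m 1≤m ε 0<ε ε≤1
  open Flows ℛ m 1≤m ε 0<ε ε≤1
  open Competition ℛ m 1≤m ε 0<ε ε≤1

  module _ {s : State} (sound : Sound s) {O : ℕ → ℝ → ℝ} (opponent : Opponent O)
           {o : ℕ → ℝ} (rival : Rival O s o)
           {χ : ℕ → Bool} {δ : ℝ} (phase : GapPhase s χ) (limit : GapLimit s χ δ) where
    open State s
    open Sound sound
    open Opponent opponent
    open Rival rival
    open GapPhase phase
    open GapLimit limit
    open Runnable runnable
    open Steadily sound runnable steady
    open Steady steady
    open Flow s χ δ

    gained : ℕ → ℝ
    gained k = o k + (O k (now + δ) - O k now)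

    private
      now' : ℝ
      now' = now + δ
      now≤now' : now ≤ now'
      now≤now' = arith 2 (λ t d → (# 0 ⊑ d ∷ []) ⊢ t ≼ t :+ d) refl 0≤δ
      h≤now : threshold ≤ now
      h≤now = ≤-reflexive open-gap

      module _ (S : Task → Bool)
        (unexpired : ∀ {e} → e ∈ tasks → S e ≡ true → now' < dl e)
        (pending : ∀ {e} → e ∈ tasks → S e ≡ true → 0# < rem' e)
        (tight : ∀ {e} → e ∈ tasks → now' < dl e → 0# < rem' e → dl e - rem' e ≤ now' → S e ≡ true) where

        F : Task → Bool
        F = widened (due threshold) (due now') S (is-pending s)

        rem'≤rem : ∀ e → rem' e ≤ rem e
        rem'≤rem e = subst (_≤ rem e) (sym (rem'-eq e))
          (arith 2 (λ r y → (# 0 ⊑ y ∷ []) ⊢ r :- y ≼ r) refl (*-nonNegative (0≤[] (χ (id e))) 0≤δ))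

        F-inv : ∀ {e} → e ∈ tasks → F e ≡ true → threshold < dl e × 0# < rem e
        F-inv {e} e∈ f with true-or-false (S e)
        ... | inj₁ s = ≤-<-trans (≤-trans h≤now now≤now') (unexpired e∈ s) , <-≤-trans (pending e∈ s) (rem'≤rem e)
        ... | inj₂ ¬s with trans (cong (_∨ (is-pending s e ∧ (due now' e ∧ not (due threshold e)))) (sym ¬s)) f
        ...   | f' = subst (_< dl e) (sym open-gap) (now<dl e∈ 0<rem) , 0<rem
          where
          0<rem : 0# < rem e
          0<rem = does-true {d = 0# <? rem e} (proj₁ (∧-true f'))

        F-tight : ∀ {e} → e ∈ tasks → threshold < dl e → 0# < rem e → start-by e ≤ now → F e ≡ true
        F-tight {e} e∈ h<d 0<rem ℓ≤t with holds-or-not (dl e ≤? now')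
        ... | inj₁ d≤t' rewrite true-does (0# <? rem e) 0<rem | due-yes {now'} {e} d≤t' | due-no {threshold} {e} h<d with S e
        ...   | true  = refl
        ...   | false = refl
        F-tight {e} e∈ h<d 0<rem ℓ≤t | inj₂ d≰t' = cong (_∨ (is-pending s e ∧ (due now' e ∧ not (due threshold e)))) in-S
          where
          run : χ (id e) ≡ true
          run = urgent e∈ 0<rem ℓ≤t
          in-S : S e ≡ true
          in-S = tight e∈ (≰⇒> d≰t')
            (<-≤-trans (<-diff (≰⇒> d≰t')) (subst (dl e - now' ≤_) (sym (running-rem e run))
              (arith 4 (λ d t r x → (d :- r ⊑ t ∷ []) ⊢ d :- (t :+ x) ≼ r :- x) refl ℓ≤t)))
            (subst (_≤ now') (sym (start-by' e∈ run)) (+-monoˡ-≤ δ ℓ≤t))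

        F-legal : Legal s F
        F-legal = record
          { unexpired = λ e∈ f → proj₁ (F-inv e∈ f)
          ; pending   = λ e∈ f → proj₂ (F-inv e∈ f)
          ; tight     = λ e∈ h<d 0<rem ℓ≤h → F-tight e∈ h<d 0<rem (≤-trans ℓ≤h h≤now)
          }

        D : Task → ℝ
        D e = O (id e) now' - O (id e) now

        late : ∀ {e} → e ∈ tasks → due threshold e ≡ true → D e ≤ 0# × χ (id e) ≡ false
        late {e} e∈ d =
          ( arith 2 (λ x y → (x ⊑ y ∷ []) ⊢ x :- y ≼ # 0) refl (Knows.after (knows e∈) d≤t now≤now')
          , wait (true-or-false (χ (id e))))
          where
          d≤t : dl e ≤ now
          d≤t = ≤-trans (does-true {d = dl e ≤? threshold} d) h≤now
          wait : χ (id e) ≡ true ⊎ χ (id e) ≡ false → χ (id e) ≡ false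
          wait (inj₁ run) = contradiction d≤t (<⇒≱ (now<dl e∈ (only-pending e∈ run)))
          wait (inj₂ w)   = w

        ordered : (∀ {e w} → e ∈ tasks → w ∈ tasks → χ (id e) ≡ true → 0# < rem w → χ (id w) ≡ false → key e ≤ key w) →
          ∀ {e x} → e ∈ tasks → x ∈ tasks → χ (id e) ≡ true → F e ≡ false → due threshold e ≡ false →
          F x ≡ true → χ (id x) ≡ false → dl e ≤ dl x
        ordered by-key {e} {x} e∈ x∈ run ¬f ¬d fx wait = subst₂ _≤_ (slack-key {e} e∉) (slack-key {x} x∉)
          (by-key e∈ x∈ run (proj₂ (F-inv x∈ fx)) wait)
          where
          slack-key : ∀ {y} → ¬ start-by y ≤ now → key y ≡ dl y
          slack-key {y} no-rush = cong (λ b → if b then now else dl y) (false-does (start-by y ≤? now) no-rush)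
          e∉ : ¬ start-by e ≤ now
          e∉ ℓ≤t = contradiction (trans (sym ¬f)
            (F-tight e∈ (due-no⁻¹ {threshold} {e} ¬d) (only-pending e∈ run) ℓ≤t)) λ ()
          x∉ : ¬ start-by x ≤ now
          x∉ ℓ≤t = contradiction (trans (sym wait) (urgent x∈ (proj₂ (F-inv x∈ fx)) ℓ≤t)) λ ()

        gap-rate : weighted tasks (due threshold) F (λ e → D e - [ χ (id e) ] * δ)
                     ≤ κ * (natural (count tasks (χ ∘ id)) * δ)
        gap-rate = rate tasks (due threshold) (χ ∘ id) F D 0≤δ
          (λ {e} _ → diff-nonneg (mono (id e) now≤now'))
          (λ {e} _ → arith 4 (λ x y t d → (x ⊑ y :+ ((t :+ d) :- t) ∷ []) ⊢ x :- y ≼ d) refl (lipschitz (id e) now≤now'))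
          (subst (_≤ M * δ) (sym (∑-- tasks _ _))
            (arith 5 (λ x y M t d → (x ⊑ y :+ M :* ((t :+ d) :- t) ∷ []) ⊢ x :- y ≼ M :* d) refl (capacity tasks distinct now≤now')))
          late few (cases full)
          where
          cases : (∀ {e} → e ∈ tasks → 0# < rem e → χ (id e) ≡ true) ⊎
                  count tasks (χ ∘ id) ≡ m ×
                  (∀ {e w} → e ∈ tasks → w ∈ tasks → χ (id e) ≡ true → 0# < rem w →
                  χ (id w) ≡ false → key e ≤ key w) →
                  (∀ {e} → e ∈ tasks → F e ≡ true → χ (id e) ≡ true) ⊎
                  count tasks (χ ∘ id) ≡ m ×
                  (∀ {e x} → e ∈ tasks → x ∈ tasks → χ (id e) ≡ true → F e ≡ false → due threshold e ≡ false →
                   F x ≡ true → χ (id x) ≡ false → dl e ≤ dl x)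
          cases (inj₁ all)            = inj₁ (λ e∈ f → all e∈ (proj₂ (F-inv e∈ f)))
          cases (inj₂ (n≡m , by-key)) = inj₂ (n≡m , ordered by-key)

        ω ω' : Task → ℝ
        ω e = o (id e) - idle (id e)
        ω' e = gained (id e) - advance idle (id e)

        gap-balance : weighted tasks (due now') S ω' ≤ κ * ∑ tasks (advance idle ∘ id)
        gap-balance = ≤-trans
          (closing tasks (due threshold) (due now') S (is-pending s) ω'
            (λ {e} _ → due-grows (≤-trans h≤now now≤now') {e}) (λ {x} {y} _ _ → due-down {now'} {x} {y})
            (λ {e} e∈ _ h<d done → harmless e∈ (due-no⁻¹ {threshold} {e} h<d) (does-false {d = 0# <? rem e} done)))
          (≤-trans (≤-reflexive (trans (∑-cong tasks (λ {e} _ → cong (weight tasks (due threshold) F e *_)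
              (arith 5 (λ o x y i z → [] ⊢ (o :+ (x :- y)) :- (i :+ z) ≈ (o :- i) :+ ((x :- y) :- z)) refl)))
            (weighted-+ tasks (due threshold) F ω (λ e → D e - [ χ (id e) ] * δ))))
          (≤-trans (arith 5 (λ a b k i n → (a ⊑ k :* i ∷ b ⊑ k :* n ∷ []) ⊢ a :+ b ≼ k :* (i :+ n)) refl
              (balance F F-legal) gap-rate)
            (≤-reflexive (cong (κ *_) (sym (work-sum idle))))))
          where
          harmless : ∀ {e} → e ∈ tasks → threshold < dl e → ¬ 0# < rem e → ω' e ≤ 0#
          harmless {e} e∈ h<d done = arith 6
            (λ o O O' i p y → (o ⊑ O ∷ O' ⊑ p ∷ p ⊑ i ∷ # 0 ⊑ y ∷ []) ⊢ (o :+ (O' :- O)) :- (i :+ y) ≼ # 0) refl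
            (o≤O (id e)) (within e∈ h<d now') (settled sound e∈ h<d done)
            (*-nonNegative (0≤[] (χ (id e))) 0≤δ)

    gap-rival : ∀ new → Rival O (gap-flow s χ δ new) gained
    gap-rival new = record
      { knows   = knows
      ; within  = λ e∈ t'<d → within e∈ (≤-<-trans (≤-trans h≤now now≤now') t'<d)
      ; 0≤o     = λ k → +-nonneg (0≤o k) (diff-nonneg (mono k now≤now'))
      ; o≤O     = λ k → arith 3 (λ o x y → (o ⊑ x ∷ []) ⊢ o :+ (y :- x) ≼ y) refl (o≤O k)
      ; bulk    = subst₂ (λ x y → ∑ tasks (λ e → O (id e) now') ≤ x + y)
          (trans (cong (λ h → M * (used - (h - now))) open-gap)
            (arith 4 (λ M u t t' → [] ⊢ M :* (u :- (t :- t)) ≈ M :* (u :- (t' :- t'))) refl))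
          (sym (trans (∑-+ tasks _ _) (cong (∑ tasks (o ∘ id) +_) (∑-- tasks _ _))))
          (arith 4 (λ x y b c → (y ⊑ b :+ c ∷ []) ⊢ x ≼ b :+ (c :+ (x :- y))) refl bulk)
      ; balance = λ S legal → gap-balance S (Legal.unexpired legal) (Legal.pending legal) (Legal.tight legal)
      }

module Newcomers (ℛ : Reals) (m : ℕ) (1≤m : 1 ℕ.≤ m) (ε : Reals.ℝ ℛ)
               (0<ε : Reals._<_ ℛ (Reals.0# ℛ) ε)
               (ε≤1 : Reals._≤_ ℛ ε (Reals.1# ℛ)) where
  open OrderedField ℛ
  open Summation ℛ
  open Volumes ℛ
  open Parameters ℛ m 1≤m ε 0<ε ε≤1
  open Weighting ℛ m 1≤m
  open States ℛ m 1≤m ε 0<ε ε≤1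
  open Raises ℛ m 1≤m ε 0<ε ε≤1
  open Competition ℛ m 1≤m ε 0<ε ε≤1

  above-skip : ∀ es (S : Task → Bool) {n y} → S n ≡ false ⊎ dl n < y → above (n ∷ es) S y ≡ above es S y
  above-skip es S {n} {y} (inj₁ ¬s) rewrite ¬s = refl
  above-skip es S {n} {y} (inj₂ d<y) with S n
  ... | false = refl
  ... | true rewrite false-does (y ≤? dl n) (<⇒≱ d<y) = refl

  above-add : ∀ es (S : Task → Bool) {n y} → S n ≡ true → y ≤ dl n → above (n ∷ es) S y ≡ suc (above es S y)
  above-add es S {n} {y} s y≤d rewrite s | true-does (y ≤? dl n) y≤d = refl

  module _ (es : List Task) (C S : Task → Bool) (n : Task) (ω : Task → ℝ) where

    rank : Task → ℕ
    rank e = above es S (dl e)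

    -- A new member n of S raises the weights of the jobs due before n.
    rise : Task → ℝ
    rise e = [ not (C e ∨ S e) ∧ does (dl e ≤? dl n) ] * (ψ (rank e) * ω e)

    extended : ℕ → Task → Bool
    extended k e = C e ∨ (does (dl e ≤? dl n) ∧ (k ℕ.≤ᵇ rank e))

    weighted-extended : ∀ k → weighted es (extended k) S ω ≡ weighted es C S ω + ∑ es (λ e → [ k ℕ.≤ᵇ rank e ] * rise e)
    weighted-extended k = trans
      (∑-cong es (λ {e} _ → pointwise (C e) (S e) (does (dl e ≤? dl n)) (k ℕ.≤ᵇ rank e) (ψ (rank e)) (ω e)))
      (∑-+ es _ _)
      where
      pointwise : ∀ c s d r y w → (if (c ∨ (d ∧ r)) ∨ s then 1# else 1# - y) * w
        ≡ (if c ∨ s then 1# else 1# - y) * w + [ r ] * ([ not (c ∨ s) ∧ d ] * (y * w))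
      pointwise true  s     d     r     y w = arith 3 (λ r y w → [] ⊢ # 1 :* w ≈ # 1 :* w :+ r :* (# 0 :* (y :* w))) refl
      pointwise false true  d     true  y w with d
      ... | true  = arith 2 (λ y w → [] ⊢ # 1 :* w ≈ # 1 :* w :+ # 1 :* (# 0 :* (y :* w))) refl
      ... | false = arith 2 (λ y w → [] ⊢ # 1 :* w ≈ # 1 :* w :+ # 1 :* (# 0 :* (y :* w))) refl
      pointwise false true  d     false y w with d
      ... | true  = arith 2 (λ y w → [] ⊢ # 1 :* w ≈ # 1 :* w :+ # 0 :* (# 0 :* (y :* w))) refl
      ... | false = arith 2 (λ y w → [] ⊢ # 1 :* w ≈ # 1 :* w :+ # 0 :* (# 0 :* (y :* w))) refl
      pointwise false false true  true  y w = arith 2 (λ y w → [] ⊢ # 1 :* w ≈ (# 1 :- y) :* w :+ # 1 :* (# 1 :* (y :* w))) refl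
      pointwise false false true  false y w = arith 2 (λ y w → [] ⊢ (# 1 :- y) :* w ≈ (# 1 :- y) :* w :+ # 0 :* (# 1 :* (y :* w))) refl
      pointwise false false false r     y w = arith 3 (λ r y w → [] ⊢ (# 1 :- y) :* w ≈ (# 1 :- y) :* w :+ r :* (# 0 :* (y :* w))) refl

    weighted-newcomer : S n ≡ true → ω n ≡ 0# →
      weighted (n ∷ es) C S ω ≡ weighted es C S ω + ∑ es (λ e → γ (rank e) * rise e)
    weighted-newcomer sn ω≡0 = trans (cong (_+ ∑ es (λ e → weight (n ∷ es) C S e * ω e))
        (trans (cong (weight (n ∷ es) C S n *_) ω≡0) (zeroʳ _)))
      (trans (+-identityˡ _) (trans (∑-cong es (λ {e} _ → term e)) (∑-+ es _ _)))
      where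
      term : ∀ e → weight (n ∷ es) C S e * ω e ≡ weight es C S e * ω e + γ (rank e) * rise e
      term e with C e ∨ S e
      ... | true  = arith 3 (λ g y w → [] ⊢ # 1 :* w ≈ # 1 :* w :+ g :* (# 0 :* (y :* w))) refl
      ... | false with holds-or-not (dl e ≤? dl n)
      ...   | inj₁ d≤ = trans (cong (λ k → (1# - ψ k) * ω e) (above-add es S sn d≤)) (trans
        (arith 4 (λ y y' g w → ((# 1 :- g) :* y :* w ≐ y' :* w ∷ []) ⊢ (# 1 :- y') :* w ≈ (# 1 :- y) :* w :+ g :* (# 1 :* (y :* w))) refl
          (cong (_* ω e) (sym (ψ-suc (rank e)))))
        (cong (λ b → (1# - ψ (rank e)) * ω e + γ (rank e) * ([ b ] * (ψ (rank e) * ω e))) (sym (true-does (dl e ≤? dl n) d≤))))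
      ...   | inj₂ d≰ = trans (cong (λ k → (1# - ψ k) * ω e) (above-skip es S {n} {dl e} (inj₂ (≰⇒> d≰)))) (trans
        (arith 3 (λ g y w → [] ⊢ (# 1 :- y) :* w ≈ (# 1 :- y) :* w :+ g :* (# 0 :* (y :* w))) refl)
        (cong (λ b → (1# - ψ (rank e)) * ω e + γ (rank e) * ([ b ] * (ψ (rank e) * ω e))) (sym (false-does (dl e ≤? dl n) d≰))))

    weighted-skip : S n ≡ false → ω n ≡ 0# → weighted (n ∷ es) C S ω ≡ weighted es C S ω
    weighted-skip ¬sn ω≡0 = trans (cong (_+ ∑ es (λ e → weight (n ∷ es) C S e * ω e))
        (trans (cong (weight (n ∷ es) C S n *_) ω≡0) (zeroʳ _)))
      (trans (+-identityˡ _) (∑-cong es (λ {e} _ → cong (_* ω e)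
        (cong (λ k → if C e ∨ S e then 1# else 1# - ψ k) (above-skip es S {n} {dl e} (inj₁ ¬sn))))))

  module _ {s : State} (sound : Sound s) {O : ℕ → ℝ → ℝ} (opponent : Opponent O) {o : ℕ → ℝ} (rival : Rival O s o)
           (n : Task) (id-n : id n ≡ length (State.tasks s)) (rel-n : rel n ≡ State.now s) (knows-n : Knows O n) where
    open State s
    open Sound sound
    open Opponent opponent
    open Rival rival
    open Arrival sound n id-n rel-n

    private
      O-n : O (id n) now ≡ 0#
      O-n = Knows.before knows-n (≤-reflexive (sym rel-n))

      o-n : o (id n) ≡ 0#
      o-n = ≤-antisym (≤-trans (o≤O (id n)) (≤-reflexive O-n)) (0≤o (id n))

      ω : Task → ℝ
      ω e = o (id e) - idle (id e)

      ω-n : ω n ≡ 0#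
      ω-n = trans (cong₂ _-_ o-n no-idle) (-‿inverseʳ 0#)

      bulk' : ∑ (n ∷ tasks) (λ e → O (id e) now) ≤ M * (used - (threshold - now)) + ∑ (n ∷ tasks) (o ∘ id)
      bulk' = arith 5 (λ x y a z b → (x ≗ # 0 ∷ z ≗˘ # 0 ∷ y ⊑ a :+ b ∷ []) ⊢ x :+ y ≼ a :+ (z :+ b)) refl O-n o-n bulk

      idle-sum : ∑ (n ∷ tasks) (idle ∘ id) ≡ ∑ tasks (idle ∘ id)
      idle-sum = trans (cong (_+ ∑ tasks (idle ∘ id)) no-idle) (+-identityˡ _)

      knows' : ∀ {e} → e ∈ n ∷ tasks → Knows O e
      knows' (here refl) = knows-n
      knows' (there e∈)  = knows e∈

      legal-tail : ∀ {S} → Legal reject S → Legal s S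
      legal-tail legal = record
        { unexpired = λ e∈ → Legal.unexpired legal (there e∈)
        ; pending   = λ e∈ → Legal.pending legal (there e∈)
        ; tight     = λ e∈ → Legal.tight legal (there e∈)
        }

      outsider : ∀ S → Legal reject S → S n ≡ false →
                 weighted (n ∷ tasks) (due threshold) S ω ≤ κ * ∑ (n ∷ tasks) (idle ∘ id)
      outsider S legal ¬sn = subst₂ _≤_ (sym (weighted-skip tasks (due threshold) S n ω ¬sn ω-n))
        (cong (κ *_) (sym idle-sum)) (balance S (legal-tail legal))

      insider : ∀ S → Legal reject S → S n ≡ true →
                weighted (n ∷ tasks) (due threshold) S ω ≤ κ * ∑ (n ∷ tasks) (idle ∘ id)
      insider S legal sn = subst₂ _≤_ (sym (weighted-newcomer tasks C S n ω sn ω-n)) (cong (κ *_) (sym idle-sum))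
        (arith 3 (λ a b k → (b ⊑ k :- a ∷ []) ⊢ a :+ b ≼ k) refl
          (by-parts tasks (rank tasks C S n ω) (rise tasks C S n ω) γ γ-mono γ≤1 0≤γ _
            (diff-nonneg (balance S (legal-tail legal))) partial))
        where
        C : Task → Bool
        C = due threshold
        partial : ∀ k → ∑ tasks (λ e → [ k ℕ.≤ᵇ rank tasks C S n ω e ] * rise tasks C S n ω e)
                    ≤ κ * ∑ tasks (idle ∘ id) - weighted tasks C S ω
        partial k = arith 3 (λ a b k → (a :+ b ⊑ k ∷ []) ⊢ b ≼ k :- a) refl
          (subst (_≤ κ * ∑ tasks (idle ∘ id)) (weighted-extended tasks C S n ω k)
            (≤-trans (closing tasks C C' S (is-pending s) ω grows down harmless) (balance F F-legal)))
          where
          C' F : Task → Bool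
          C' = extended tasks C S n ω k
          F  = widened C C' S (is-pending s)
          grows : ∀ {e} → e ∈ tasks → C e ≡ true → C' e ≡ true
          grows {e} _ c = cong (_∨ (does (dl e ≤? dl n) ∧ (k ℕ.≤ᵇ rank tasks C S n ω e))) c
          down : ∀ {x y} → x ∈ tasks → y ∈ tasks → C' x ≡ true → dl y ≤ dl x → C' y ≡ true
          down {x} {y} _ _ c' y≤x with true-or-false (C x)
          ... | inj₁ c = cong (_∨ (does (dl y ≤? dl n) ∧ (k ℕ.≤ᵇ rank tasks C S n ω y))) (due-down {threshold} {x} {y} c y≤x)
          ... | inj₂ ¬c with trans (cong (_∨ (does (dl x ≤? dl n) ∧ (k ℕ.≤ᵇ rank tasks C S n ω x))) (sym ¬c)) c'
          ...   | c'' with C y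
          ...     | true  = refl
          ...     | false = cong₂ _∧_
            (true-does (dl y ≤? dl n) (≤-trans y≤x (does-true {d = dl x ≤? dl n} (proj₁ (∧-true c'')))))
            (≤ᵇ-yes (ℕ.≤-trans (≤ᵇ-true {k} (proj₂ (∧-true {does (dl x ≤? dl n)} c''))) (above-anti tasks S y≤x)))
            where
            ≤ᵇ-yes : ∀ {i j} → i ℕ.≤ j → (i ℕ.≤ᵇ j) ≡ true
            ≤ᵇ-yes {i} {j} i≤j with true-or-false (i ℕ.≤ᵇ j)
            ... | inj₁ yes' = yes'
            ... | inj₂ no'  = contradiction i≤j (ℕ.<⇒≱ (≤ᵇ-false {i} {j} no'))
          harmless : ∀ {e} → e ∈ tasks → C' e ≡ true → C e ≡ false → is-pending s e ≡ false → ω e ≤ 0#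
          harmless {e} e∈ _ ¬c done = arith 4 (λ o O p i → (o ⊑ O ∷ O ⊑ p ∷ p ⊑ i ∷ []) ⊢ o :- i ≼ # 0) refl
            (o≤O (id e)) (within e∈ h<d now) (settled sound e∈ h<d (does-false {d = 0# <? rem e} done))
            where
            h<d : threshold < dl e
            h<d = due-no⁻¹ {threshold} {e} ¬c
          F-inv : ∀ {e} → e ∈ tasks → F e ≡ true → threshold < dl e × 0# < rem e
          F-inv {e} e∈ fe with true-or-false (S e)
          ... | inj₁ se = Legal.unexpired legal (there e∈) se , Legal.pending legal (there e∈) se
          ... | inj₂ ¬se with trans (cong (_∨ (is-pending s e ∧ (C' e ∧ not (C e)))) (sym ¬se)) fe
          ...   | f' with true-or-false (C e)
          ...     | inj₂ ¬c = due-no⁻¹ {threshold} {e} ¬c , does-true {d = 0# <? rem e} (proj₁ (∧-true f'))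
          ...     | inj₁ c with proj₂ (∧-true {C' e} (proj₂ (∧-true {is-pending s e} f')))
          ...       | nc = contradiction (trans (cong not (sym c)) nc) λ ()
          F-legal : Legal s F
          F-legal = record
            { unexpired = λ e∈ fe → proj₁ (F-inv e∈ fe)
            ; pending   = λ e∈ fe → proj₂ (F-inv e∈ fe)
            ; tight     = λ {e} e∈ h<d 0<r ℓ≤h → cong (_∨ (is-pending s e ∧ (C' e ∧ not (C e))))
                            (Legal.tight legal (there e∈) h<d 0<r ℓ≤h)
            }

      arrival-balance : ∀ S → Legal reject S → weighted (n ∷ tasks) (due threshold) S ω ≤ κ * ∑ (n ∷ tasks) (idle ∘ id)
      arrival-balance S legal with true-or-false (S n)
      ... | inj₁ sn  = insider S legal sn
      ... | inj₂ ¬sn = outsider S legal ¬sn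

      arrival-rival : (threshold < dl n → ∀ x → O (id n) x ≤ size n) → Rival O reject o
      arrival-rival within-n = record
        { knows   = knows'
        ; within  = λ { (here refl) → within-n ; (there e∈) → within e∈ }
        ; 0≤o     = 0≤o
        ; o≤O     = o≤O
        ; bulk    = bulk'
        ; balance = arrival-balance
        }

    reject-rival : dl n < threshold → Rival O reject o
    reject-rival d<h = arrival-rival λ h<d → contradiction (<⇒≤ d<h) (<⇒≱ h<d)

    accept-rival : (0<p : 0# < size n) (slack-n : (1# + ε) * size n ≤ dl n - now) (h≤d : threshold ≤ dl n) →
                   (∀ x → O (id n) x ≤ size n) → Rival O (Accept.accept 0<p slack-n h≤d) o
    accept-rival 0<p slack-n h≤d within-n = record
      { knows   = knows'
      ; within  = λ { (here refl) _ → within-n ; (there e∈) r<d → within e∈ (≤-<-trans h≤raised r<d) }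
      ; 0≤o     = 0≤o
      ; o≤O     = o≤O
      ; bulk    = subst (λ u → ∑ (n ∷ tasks) (λ e → O (id e) now) ≤ M * u + ∑ (n ∷ tasks) (o ∘ id))
          (arith 4 (λ u h t r → [] ⊢ u :- (h :- t) ≈ (u :+ (r :- h)) :- (r :- t)) refl) bulk'
      ; balance = λ S legal → raise-balance settled' (arrival-rival (λ _ → within-n)) h≤raised S
          (Legal.unexpired legal) (Legal.pending legal) (Legal.tight legal)
      }
      where
      open Accept 0<p slack-n h≤d
      settled' : Settled reject
      settled' (here refl) _ done = contradiction (subst (0# <_) (sym rem-n) 0<p) done
      settled' (there e∈)         = settled sound e∈

module Plans (ℛ : Reals) (m : ℕ) where
  open OrderedField ℛ
  open Summation ℛ
  open Volumes ℛ
  open Scheduling ℛ using (Segment; Schedule; machine; job; start; end; NoConflict; processed; Runs)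

  seg : Fin m → ℕ → ℝ → ℝ → Segment m
  seg i k t t' = record { machine = i ; job = k ; start = t ; end = t' }

  processed-∷ : ∀ (g : Segment m) σ k →
    processed (g ∷ σ) k ≡ [ does (job g ℕ.≟ k) ] * (end g - start g) + processed σ k
  processed-∷ g σ k with job g ℕ.≡ᵇ k
  ... | true  = cong (_+ processed σ k) (sym (*-identityˡ _))
  ... | false = arith 2 (λ p x → [] ⊢ p ≈ # 0 :* x :+ p) refl

  processed-++ : ∀ (σ τ : Schedule m) k → processed (σ ++ τ) k ≡ processed σ k + processed τ k
  processed-++ []      τ k = sym (+-identityˡ _)
  processed-++ (g ∷ σ) τ k = trans (processed-∷ g (σ ++ τ) k)
    (trans (cong ([ does (job g ℕ.≟ k) ] * (end g - start g) +_) (processed-++ σ τ k))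
    (trans (sym (+-assoc _ _ _)) (cong (_+ processed τ k) (sym (processed-∷ g σ k)))))

  module _ (χ : ℕ → Bool) (t t' : ℝ) where

    phase : List (Fin m) → List Task → Schedule m
    phase is       []       = []
    phase []       (e ∷ es) = []
    phase (i ∷ is) (e ∷ es) = if χ (id e) then seg i (id e) t t' ∷ phase is es else phase (i ∷ is) es

    phase-∈ : ∀ is es {g} → g ∈ phase is es →
      machine g ∈ is × start g ≡ t × end g ≡ t' × (∃[ e ] e ∈ es × id e ≡ job g × χ (id e) ≡ true)
    phase-∈ (i ∷ is) (e ∷ es) g∈ with χ (id e) in run
    phase-∈ (i ∷ is) (e ∷ es) (here refl) | true = here refl , refl , refl , e , here refl , refl , run
    phase-∈ (i ∷ is) (e ∷ es) (there g∈)  | true with phase-∈ is es g∈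
    ... | i∈ , s , t , e' , e'∈ , rest = there i∈ , s , t , e' , there e'∈ , rest
    phase-∈ (i ∷ is) (e ∷ es) g∈          | false with phase-∈ (i ∷ is) es g∈
    ... | i∈ , s , t , e' , e'∈ , rest = i∈ , s , t , e' , there e'∈ , rest

    phase-apart : ∀ is es → Unique is → AllPairs (λ e e' → id e ≢ id e') es →
                  AllPairs NoConflict (phase is es)
    phase-apart is       []       _ _ = []
    phase-apart []       (e ∷ es) _ _ = []
    phase-apart (i ∷ is) (e ∷ es) (i∉ ∷ u) (e∉ ∷ d) with χ (id e)
    ... | false = phase-apart (i ∷ is) es (i∉ ∷ u) d
    ... | true  = All.tabulate apart ∷ phase-apart is es u d
      where
      apart : ∀ {g} → g ∈ phase is es → NoConflict (seg i (id e) t t') g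
      apart g∈ clash with phase-∈ is es g∈
      apart g∈ (inj₁ refl) | i∈ , _ = contradiction refl (All.lookup i∉ i∈)
      apart g∈ (inj₂ refl) | _ , _ , _ , e' , e'∈ , eq , _ = contradiction (sym eq) (All.lookup e∉ e'∈)

    private
      padded : ∀ d {y} → y ≡ 0# * d + y
      padded d = arith 2 (λ d y → [] ⊢ y ≈ # 0 :* d :+ y) refl

    phase-processed : ∀ is es k → count es (χ ∘ id) ℕ.≤ length is →
      processed (phase is es) k ≡ ∑ es (λ e → [ χ (id e) ∧ does (id e ℕ.≟ k) ] * (t' - t))
    phase-processed is [] k _ = refl
    phase-processed [] (e ∷ es) k h with χ (id e)
    ... | false = trans (phase-processed′ es h) (padded (t' - t))
      where
      phase-processed′ : ∀ es → count es (χ ∘ id) ℕ.≤ 0 → 0# ≡ ∑ es (λ e → [ χ (id e) ∧ does (id e ℕ.≟ k) ] * (t' - t))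
      phase-processed′ []       _ = refl
      phase-processed′ (e ∷ es) h with χ (id e)
      ... | false = trans (phase-processed′ es h) (padded (t' - t))
    phase-processed (i ∷ is) (e ∷ es) k h with χ (id e)
    phase-processed (i ∷ is) (e ∷ es) k (s≤s h) | true = trans (processed-∷ (seg i (id e) t t') (phase is es) k)
      (cong ([ does (id e ℕ.≟ k) ] * (t' - t) +_) (phase-processed is es k h))
    phase-processed (i ∷ is) (e ∷ es) k h | false = trans (phase-processed (i ∷ is) es k h)
      (padded (t' - t))

  phase-runs : ∀ χ {t t' t'' i x k} is es → x < t'' → Runs (phase χ t t' is es) i x k → Runs (phase χ t t'' is es) i x k
  phase-runs χ (i ∷ is) (e ∷ es) x<t'' r with χ (id e)
  phase-runs χ (i ∷ is) (e ∷ es) x<t'' (here (a , b , c , _)) | true = here (a , b , c , x<t'')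
  phase-runs χ (i ∷ is) (e ∷ es) x<t'' (there r)              | true = there (phase-runs χ is es x<t'' r)
  phase-runs χ (i ∷ is) (e ∷ es) x<t'' r                      | false = phase-runs χ (i ∷ is) es x<t'' r

  once : ∀ es → AllPairs (λ e e' → id e ≢ id e') es → ∀ (χ : ℕ → Bool) d {e} → e ∈ es →
         ∑ es (λ x → [ χ (id x) ∧ does (id x ℕ.≟ id e) ] * d) ≡ [ χ (id e) ] * d
  once (x ∷ es) (x∉ ∷ _) χ d (here refl) = trans
    (cong₂ _+_ (cong (λ b → [ b ] * d) same) (trans (∑-cong es (λ {y} y∈ → trans
      (cong (λ b → [ b ] * d) (other y∈)) (zeroˡ d))) (∑-zero es)))
    (+-identityʳ _)
    where
    same : χ (id x) ∧ does (id x ℕ.≟ id x) ≡ χ (id x)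
    same rewrite true-does (id x ℕ.≟ id x) refl with χ (id x)
    ... | true  = refl
    ... | false = refl
    other : ∀ {y} → y ∈ es → χ (id y) ∧ does (id y ℕ.≟ id x) ≡ false
    other {y} y∈ rewrite false-does (id y ℕ.≟ id x) (All.lookup x∉ y∈ ∘ sym) with χ (id y)
    ... | true  = refl
    ... | false = refl
  once (x ∷ es) (x∉ ∷ u) χ d {e} (there e∈) = trans
    (cong₂ _+_ (trans (cong (λ b → [ b ] * d) other) (zeroˡ d)) (once es u χ d e∈)) (+-identityˡ _)
    where
    other : χ (id x) ∧ does (id x ℕ.≟ id e) ≡ false
    other rewrite false-does (id x ℕ.≟ id e) (All.lookup x∉ e∈) with χ (id x)
    ... | true  = refl
    ... | false = refl

  record Fits (tasks : List Task) (g : Segment m) : Set where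
    field
      owner       : Task
      member      : owner ∈ tasks
      own         : id owner ≡ job g
      after-rel   : rel owner ≤ start g
      forward     : start g ≤ end g
      before-dl   : end g ≤ dl owner
      substantial : 0# < size owner

  record Planned (now : ℝ) (tasks : List Task) (work : ℕ → ℝ) (σ : Schedule m) : Set where
    field
      fits  : ∀ {g} → g ∈ σ → Fits tasks g
      past  : ∀ {g} → g ∈ σ → end g ≤ now
      apart : AllPairs NoConflict σ
      exact : ∀ {e} → e ∈ tasks → processed σ (id e) ≡ work (id e)

  more-fits : ∀ {n tasks g} → Fits tasks g → Fits (n ∷ tasks) g
  more-fits fit = record { Fits fit ; member = there (Fits.member fit) }

  absent : ∀ {k} (σ : Schedule m) → (∀ {g} → g ∈ σ → job g ≢ k) → processed σ k ≡ 0#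
  absent         []      h = refl
  absent {k} (g ∷ σ) h = trans (processed-∷ g σ k) (trans
    (cong₂ (λ b p → [ b ] * (end g - start g) + p) (false-does (job g ℕ.≟ k) (h (here refl))) (absent σ (h ∘ there)))
    (arith 1 (λ x → [] ⊢ # 0 :* x :+ # 0 ≈ # 0) refl))

  planned-arrival : ∀ {now tasks work σ} → Planned now tasks work σ → (n : Task) →
    (∀ {e} → e ∈ tasks → id e ≢ id n) → work (id n) ≡ 0# → Planned now (n ∷ tasks) work σ
  planned-arrival {tasks = tasks} {work} {σ} planned n new no-work = record
    { fits  = more-fits ∘ fits
    ; past  = past
    ; apart = apart
    ; exact = λ { (here refl) → trans (absent σ λ g∈ eq →
                    new (Fits.member (fits g∈)) (trans (Fits.own (fits g∈)) eq)) (sym no-work)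
                ; (there e∈) → exact e∈ }
    }
    where open Planned planned

  planned-flow : ∀ {now tasks work σ} → Planned now tasks work σ → ∀ χ {δ} → 0# ≤ δ →
    AllPairs (λ e e' → id e ≢ id e') tasks → count tasks (χ ∘ id) ℕ.≤ m →
    (∀ {e} → e ∈ tasks → χ (id e) ≡ true → rel e ≤ now × now + δ ≤ dl e × 0# < size e) →
    Planned (now + δ) tasks (λ k → work k + [ χ k ] * δ) (phase χ now (now + δ) (allFin m) tasks ++ σ)
  planned-flow {now} {tasks} {work} {σ} planned χ {δ} 0≤δ distinct few runs = record
    { fits  = λ g∈ → fits' (∈-++⁻ new g∈)
    ; past  = λ g∈ → past' (∈-++⁻ new g∈)
    ; apart = AllPairs.++⁺ (phase-apart χ now (now + δ) (allFin m) tasks (allFin⁺ m) distinct) apart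
                (All.tabulate λ {g} g∈ → All.tabulate λ {g'} g'∈ _ → inj₂ (separate g∈ g'∈))
    ; exact = λ {e} e∈ → trans (processed-++ new σ (id e)) (trans
        (cong₂ _+_ (trans (phase-processed χ now (now + δ) (allFin m) tasks (id e)
            (subst (count tasks (χ ∘ id) ℕ.≤_) (sym (length-tabulate {n = m} (λ i → i))) few))
          (once tasks distinct χ (now + δ - now) e∈)) (exact e∈))
        (arith 4 (λ x t d w → [] ⊢ x :* (t :+ d :- t) :+ w ≈ w :+ x :* d) refl))
    }
    where
    open Planned planned
    new : Schedule m
    new = phase χ now (now + δ) (allFin m) tasks
    now≤now' : now ≤ now + δ
    now≤now' = arith 2 (λ t d → (# 0 ⊑ d ∷ []) ⊢ t ≼ t :+ d) refl 0≤δ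
    separate : ∀ {g g'} → g ∈ new → g' ∈ σ → end g' ≤ start g
    separate g∈ g'∈ with phase-∈ χ now (now + δ) (allFin m) tasks g∈
    ... | _ , eq , _ = subst (_ ≤_) (sym eq) (past g'∈)
    fits' : ∀ {g} → g ∈ new ⊎ g ∈ σ → Fits tasks g
    fits' (inj₂ g∈) = fits g∈
    fits' (inj₁ g∈) with phase-∈ χ now (now + δ) (allFin m) tasks g∈
    ... | _ , start≡ , end≡ , e , e∈ , own , run with runs e∈ run
    ...   | rel≤ , ≤dl , 0<p = record
      { owner = e ; member = e∈ ; own = own ; after-rel = subst (rel e ≤_) (sym start≡) rel≤
      ; forward = subst₂ _≤_ (sym start≡) (sym end≡) now≤now'
      ; before-dl = subst (_≤ dl e) (sym end≡) ≤dl ; substantial = 0<p }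
    past' : ∀ {g} → g ∈ new ⊎ g ∈ σ → end g ≤ now + δ
    past' (inj₁ g∈) with phase-∈ χ now (now + δ) (allFin m) tasks g∈
    ... | _ , _ , end≡ , _ = ≤-reflexive end≡
    past' (inj₂ g∈) = ≤-trans (past g∈) now≤now'

module Selection (ℛ : Reals) where
  open OrderedField ℛ
  open Volumes ℛ

  private variable
    A : Set

  least : (top : ℝ) (xs : List A) (P : A → Set) → (∀ x → Dec (P x)) → (f : A → ℝ) →
    ∃[ δ ] δ ≤ top × (∀ {x} → x ∈ xs → P x → δ ≤ f x) ×
           (δ ≡ top ⊎ ∃[ x ] x ∈ xs × P x × δ ≡ f x)
  least top []       P P? f = top , ≤-refl , (λ ()) , inj₁ refl
  least top (x ∷ xs) P P? f with least top xs P P? f | P? x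
  ... | δ , δ≤ , bound , from | no ¬p = δ , δ≤
    , (λ { (here refl) p → contradiction p ¬p ; (there x∈) p → bound x∈ p })
    , later from
    where
    later : δ ≡ top ⊎ (∃[ y ] y ∈ xs × P y × δ ≡ f y) → δ ≡ top ⊎ (∃[ y ] y ∈ x ∷ xs × P y × δ ≡ f y)
    later (inj₁ eq)                = inj₁ eq
    later (inj₂ (y , y∈ , rest)) = inj₂ (y , there y∈ , rest)
  ... | δ , δ≤ , bound , from | yes p with total δ (f x)
  ...   | inj₁ δ≤f = δ , δ≤
    , (λ { (here refl) _ → δ≤f ; (there x∈) p → bound x∈ p })
    , later from
    where
    later : δ ≡ top ⊎ (∃[ y ] y ∈ xs × P y × δ ≡ f y) → δ ≡ top ⊎ (∃[ y ] y ∈ x ∷ xs × P y × δ ≡ f y)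
    later (inj₁ eq)                = inj₁ eq
    later (inj₂ (y , y∈ , rest)) = inj₂ (y , there y∈ , rest)
  ...   | inj₂ f≤δ = f x , ≤-trans f≤δ δ≤
    , (λ { (here refl) _ → ≤-refl ; (there x∈) p → ≤-trans f≤δ (bound x∈ p) })
    , inj₂ (x , here refl , p , refl)

  find : (xs : List A) (P : A → Set) → (∀ x → Dec (P x)) →
         (∃[ x ] x ∈ xs × P x) ⊎ (∀ {x} → x ∈ xs → ¬ P x)
  find []       P P? = inj₂ λ ()
  find (x ∷ xs) P P? with P? x | find xs P P?
  ... | yes p | _                    = inj₁ (x , here refl , p)
  ... | no ¬p | inj₁ (y , y∈ , p)    = inj₁ (y , there y∈ , p)
  ... | no ¬p | inj₂ none            = inj₂ λ { (here refl) → ¬p ; (there y∈) → none y∈ }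

  argmin : (xs : List A) (P : A → Set) → (∀ x → Dec (P x)) → (f : A → ℝ) →
    (∃[ x ] x ∈ xs × P x × (∀ {y} → y ∈ xs → P y → f x ≤ f y)) ⊎ (∀ {x} → x ∈ xs → ¬ P x)
  argmin xs P P? f with find xs P P?
  ... | inj₂ none = inj₂ none
  ... | inj₁ (x , x∈ , p) with least (f x) xs P P? f
  ...   | δ , _ , bound , inj₁ refl                = inj₁ (x , x∈ , p , bound)
  ...   | δ , _ , bound , inj₂ (y , y∈ , q , refl) = inj₁ (y , y∈ , q , bound)

  count-insert : ∀ (es : List Task) (χ : ℕ → Bool) → AllPairs (λ e e' → id e ≢ id e') es →
    ∀ {w} → w ∈ es → χ (id w) ≡ false →
    count es (λ e → χ (id e) ∨ does (id e ℕ.≟ id w)) ≡ suc (count es (χ ∘ id))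
  count-insert (x ∷ es) χ (x∉ ∷ u) (here refl) wait
    rewrite wait | true-does (id x ℕ.≟ id x) refl = cong suc (count-cong es same)
    where
    same : ∀ {y} → y ∈ es → χ (id y) ∨ does (id y ℕ.≟ id x) ≡ χ (id y)
    same {y} y∈ rewrite false-does (id y ℕ.≟ id x) (All.lookup x∉ y∈ ∘ sym) with χ (id y)
    ... | true  = refl
    ... | false = refl
  count-insert (x ∷ es) χ (x∉ ∷ u) {w} (there w∈) wait
    rewrite false-does (id x ℕ.≟ id w) (All.lookup x∉ w∈) with χ (id x)
  ... | true  = cong suc (count-insert es χ u w∈ wait)
  ... | false = count-insert es χ u w∈ wait

  record Chosen (es : List Task) (P : Task → Set) (key : Task → ℝ) (n : ℕ) : Set where
    field
      χ        : ℕ → Bool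
      known    : ∀ k → χ k ≡ true → ∃[ e ] e ∈ es × id e ≡ k
      eligible : ∀ {e} → e ∈ es → χ (id e) ≡ true → P e
      few      : count es (χ ∘ id) ℕ.≤ n
      full     : (∀ {e} → e ∈ es → P e → χ (id e) ≡ true) ⊎
                 count es (χ ∘ id) ≡ n ×
                 (∀ {e w} → e ∈ es → w ∈ es → χ (id e) ≡ true → P w → χ (id w) ≡ false → key e ≤ key w)

  same-task : ∀ {es} → AllPairs (λ e e' → id e ≢ id e') es →
              ∀ {e e'} → e ∈ es → e' ∈ es → id e ≡ id e' → e ≡ e'
  same-task (x∉ ∷ u) (here refl) (here refl) eq = refl
  same-task (x∉ ∷ u) (here refl) (there e'∈) eq = contradiction eq (All.lookup x∉ e'∈)
  same-task (x∉ ∷ u) (there e∈)  (here refl) eq = contradiction (sym eq) (All.lookup x∉ e∈)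
  same-task (x∉ ∷ u) (there e∈)  (there e'∈) eq = same-task u e∈ e'∈ eq

  ∨-inv : ∀ {a b} → a ∨ b ≡ true → a ≡ true ⊎ b ≡ true
  ∨-inv {true}  _ = inj₁ refl
  ∨-inv {false} e = inj₂ e

  ∨-false : ∀ {a b} → a ∨ b ≡ false → a ≡ false × b ≡ false
  ∨-false {false} {false} _ = refl , refl

  choose : ∀ es → AllPairs (λ e e' → id e ≢ id e') es → (P : Task → Set) → (∀ e → Dec (P e)) →
           (key : Task → ℝ) → ∀ n → Chosen es P key n
  choose es distinct P P? key zero = record
    { χ = λ _ → false ; known = λ _ () ; eligible = λ _ ()
    ; few = ℕ.≤-reflexive (none es) ; full = inj₂ (none es , λ _ _ ()) }
    where
    none : ∀ es → count es (λ _ → false) ≡ 0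
    none []       = refl
    none (e ∷ es) = none es
  choose es distinct P P? key (suc n) = extend (choose es distinct P P? key n)
    where
    extend : Chosen es P key n → Chosen es P key (suc n)
    extend chosen = cases full
      where
      open Chosen chosen
      Next : Task → Set
      Next e = P e × χ (id e) ≡ false
      next? : ∀ e → Dec (Next e)
      next? e with P? e | χ (id e)
      ... | yes p | false = yes (p , refl)
      ... | yes p | true  = no λ ()
      ... | no ¬p | _     = no (¬p ∘ proj₁)
      complete : (∀ {e} → e ∈ es → P e → χ (id e) ≡ true) → Chosen es P key (suc n)
      complete all = record { Chosen chosen ; few = ℕ.m≤n⇒m≤1+n few ; full = inj₁ all }
      cases : (∀ {e} → e ∈ es → P e → χ (id e) ≡ true) ⊎
              count es (χ ∘ id) ≡ n ×
              (∀ {e w} → e ∈ es → w ∈ es → χ (id e) ≡ true → P w → χ (id w) ≡ false → key e ≤ key w) →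
              Chosen es P key (suc n)
      cases (inj₁ all) = complete all
      cases (inj₂ (n≡ , ordered)) with argmin es Next next? key
      ... | inj₂ none = complete λ {e} e∈ p → selected e∈ p (true-or-false (χ (id e)))
        where
        selected : ∀ {e} → e ∈ es → P e → χ (id e) ≡ true ⊎ χ (id e) ≡ false → χ (id e) ≡ true
        selected e∈ p (inj₁ run)  = run
        selected e∈ p (inj₂ wait) = contradiction (p , wait) (none e∈)
      ... | inj₁ (w , w∈ , (p , wait) , minimal) = record
        { χ = χ' ; known = λ k run → known' k (∨-inv run)
        ; eligible = λ e∈ run → eligible' e∈ (∨-inv run)
        ; few = ℕ.≤-reflexive size' ; full = inj₂ (size' , λ e∈ y∈ run q wait' →
            ordered' e∈ y∈ (∨-inv run) q (∨-false wait')) }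
        where
        χ' : ℕ → Bool
        χ' k = χ k ∨ does (k ℕ.≟ id w)
        size' : count es (χ' ∘ id) ≡ suc n
        size' = trans (count-insert es χ distinct w∈ wait) (cong suc n≡)
        known' : ∀ k → χ k ≡ true ⊎ does (k ℕ.≟ id w) ≡ true → ∃[ e ] e ∈ es × id e ≡ k
        known' k (inj₁ run) = known k run
        known' k (inj₂ eq)  = w , w∈ , sym (does-true {d = k ℕ.≟ id w} eq)
        eligible' : ∀ {e} → e ∈ es → χ (id e) ≡ true ⊎ does (id e ℕ.≟ id w) ≡ true → P e
        eligible' e∈ (inj₁ run) = eligible e∈ run
        eligible' {e} e∈ (inj₂ eq) = subst P (same-task distinct w∈ e∈ (sym (does-true {d = id e ℕ.≟ id w} eq))) p
        ordered' : ∀ {e y} → e ∈ es → y ∈ es → χ (id e) ≡ true ⊎ does (id e ℕ.≟ id w) ≡ true → P y →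
                   χ (id y) ≡ false × does (id y ℕ.≟ id w) ≡ false → key e ≤ key y
        ordered' e∈ y∈ (inj₁ run) q (wait' , _) = ordered e∈ y∈ run q wait'
        ordered' {e} {y} e∈ y∈ (inj₂ eq) q (wait' , _) =
          subst (λ x → key x ≤ key y) (same-task distinct w∈ e∈ (sym (does-true {d = id e ℕ.≟ id w} eq))) (minimal y∈ (q , wait'))

module Steps (ℛ : Reals) (m : ℕ) (1≤m : 1 ℕ.≤ m) (ε : Reals.ℝ ℛ)
               (0<ε : Reals._<_ ℛ (Reals.0# ℛ) ε)
               (ε≤1 : Reals._≤_ ℛ ε (Reals.1# ℛ)) where
  open OrderedField ℛ
  open Summation ℛ
  open Volumes ℛ
  open Parameters ℛ m 1≤m ε 0<ε ε≤1
  open States ℛ m 1≤m ε 0<ε ε≤1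
  open Flows ℛ m 1≤m ε 0<ε ε≤1
  open Raises ℛ m 1≤m ε 0<ε ε≤1
  open Selection ℛ

  ∧-yes : {P Q : Set} (p? : Dec P) (q? : Dec Q) → P → Q → does p? ∧ does q? ≡ true
  ∧-yes p? q? p q rewrite true-does p? p | true-does q? q = refl

  ∧-yes⁻¹ : {P Q : Set} (p? : Dec P) (q? : Dec Q) → does p? ∧ does q? ≡ true → P × Q
  ∧-yes⁻¹ (yes p) (yes q) _ = p , q

  ∧-no : {P Q : Set} (p? : Dec P) (q? : Dec Q) → ¬ (P × Q) → does p? ∧ does q? ≡ false
  ∧-no (yes p) (yes q) h = contradiction (p , q) h
  ∧-no (yes p) (no _)  h = refl
  ∧-no (no _)  q?      h = refl

  module _ {s : State} (sound : Sound s) where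
    open State s
    open Sound sound

    rushed : Task → Bool
    rushed e = does (0# <? rem e) ∧ does (start-by e ≤? now)

    rushed-few : ∀ {end} → now < end → (∀ {D} → now ≤ D → D ≤ end → Vol D ≤ M * (D - now)) →
                 count tasks rushed ℕ.≤ m
    rushed-few {end} t<end bound with least end tasks (λ e → 0# < rem e) (λ e → 0# <? rem e) dl
    ... | D , D≤end , D≤dl , from = natural-cancel-≤ (*-cancelˡ-≤ (D - now) (<-diff (later from))
      (subst₂ _≤_ (*-comm _ _) (*-comm _ _) (≤-trans
        (subst (_≤ Vol D) (trans (∑-*ʳ tasks (D - now) _) (cong (_* (D - now)) (sym (natural-count tasks rushed))))
          (∑-mono tasks each))
        (bound (<⇒≤ (later from)) D≤end))))
      where
      later : D ≡ end ⊎ (∃[ e ] e ∈ tasks × 0# < rem e × D ≡ dl e) → now < D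
      later (inj₁ refl)                 = t<end
      later (inj₂ (e , e∈ , r , refl)) = now<dl e∈ r
      each : ∀ {e} → e ∈ tasks → [ rushed e ] * (D - now) ≤ share (rem e) (dl e) D
      each {e} e∈ with 0# <? rem e | start-by e ≤? now
      ... | no _  | _     = ≤-trans (≤-reflexive (zeroˡ _)) (0≤share D)
      ... | yes _ | no _  = ≤-trans (≤-reflexive (zeroˡ _)) (0≤share D)
      ... | yes r | yes l = ≤-trans
        (arith 3 (λ D t l → (l ⊑ t ∷ []) ⊢ # 1 :* (D :- t) ≼ D :- l) refl l) (laxity≤share (D≤dl e∈ r))

    -- At most m jobs are without slack, so those that are given priority
    -- include all of them.
    no-rushed-waiting : ∀ {χ : ℕ → Bool} → count tasks rushed ℕ.≤ m → count tasks (χ ∘ id) ≡ m →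
      ∀ {w} → w ∈ tasks → 0# < rem w → χ (id w) ≡ false →
      (∀ {e} → e ∈ tasks → χ (id e) ≡ true → 0# < rem e × start-by e ≤ now) → ¬ start-by w ≤ now
    no-rushed-waiting {χ} few n≡m {w} w∈ r wait all l = ℕ.<-irrefl n≡m (ℕ.≤-trans
      (count-< tasks {χ ∘ id} {rushed}
        (λ {e} e∈ run → ∧-yes (0# <? rem e) (start-by e ≤? now) (proj₁ (all e∈ run)) (proj₂ (all e∈ run)))
        w∈ wait (∧-yes (0# <? rem w) (start-by w ≤? now) r l)) few)

    gap-phase : threshold ≡ now → ∃[ χ ] GapPhase s χ
    gap-phase open-gap = χ , record
      { runnable = record { only-pending = eligible ; only-tasks = only ; few = few }
      ; open-gap = open-gap
      ; full     = full
      ; urgent   = λ e∈ r l → urgent e∈ r l full (true-or-false _)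
      }
      where
      key : Task → ℝ
      key e = if does (start-by e ≤? now) then now else dl e
      key-rushed : ∀ {e} → start-by e ≤ now → key e ≡ now
      key-rushed {e} l = cong (λ b → if b then now else dl e) (true-does (start-by e ≤? now) l)
      key≤now : ∀ {e} → e ∈ tasks → 0# < rem e → key e ≤ now → start-by e ≤ now
      key≤now {e} e∈ r k≤ with start-by e ≤? now
      ... | yes l = l
      ... | no  _ = contradiction k≤ (<⇒≱ (now<dl e∈ r))
      open Chosen (choose tasks distinct (λ e → 0# < rem e) (λ e → 0# <? rem e) key m)
      only : ∀ k → χ k ≡ true → k ℕ.< length tasks
      only k run with known k run
      ... | e , e∈ , refl = fresh e∈
      few-rushed : count tasks rushed ℕ.≤ m
      few-rushed = rushed-few {now + 1#} (<-diff⁻¹ (subst (0# <_) (arith 2 (λ t o → [] ⊢ o ≈ (t :+ o) :- t) refl) 0<1))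
        (λ {D} t≤D _ → ≤-trans (gap-volume sound open-gap t≤D) (*-monoˡ-≤ (D - now) (diff-nonneg t≤D) c≤M))
      urgent : ∀ {w} → w ∈ tasks → 0# < rem w → start-by w ≤ now →
        (∀ {e} → e ∈ tasks → 0# < rem e → χ (id e) ≡ true) ⊎
        count tasks (χ ∘ id) ≡ m ×
        (∀ {e w} → e ∈ tasks → w ∈ tasks → χ (id e) ≡ true → 0# < rem w → χ (id w) ≡ false → key e ≤ key w) →
        χ (id w) ≡ true ⊎ χ (id w) ≡ false → χ (id w) ≡ true
      urgent w∈ r l _ (inj₁ run) = run
      urgent w∈ r l (inj₁ all) (inj₂ _) = all w∈ r
      urgent {w} w∈ r l (inj₂ (n≡m , ordered)) (inj₂ wait) = contradiction l
        (no-rushed-waiting {χ} few-rushed n≡m w∈ r wait λ {e} e∈ run → eligible e∈ run ,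
          key≤now e∈ (eligible e∈ run) (subst (key e ≤_) (key-rushed {w} l) (ordered e∈ w∈ run r wait)))

    block-phase : now < threshold → ∃[ χ ] BlockPhase s χ ×
                  (∀ {w} → w ∈ tasks → 0# < rem w → χ (id w) ≡ false → now < start-by w)
    block-phase t<h = χ , record
      { runnable  = record { only-pending = λ e∈ run → proj₁ (eligible e∈ run) ; only-tasks = only ; few = few }
      ; only-near = λ e∈ run → proj₂ (eligible e∈ run)
      ; full      = full'
      } , relaxed
      where
      open Chosen (choose tasks distinct (λ e → 0# < rem e × start-by e < threshold)
        (λ e → (0# <? rem e) ×-dec (start-by e <? threshold)) start-by m)
      only : ∀ k → χ k ≡ true → k ℕ.< length tasks
      only k run with known k run
      ... | e , e∈ , refl = fresh e∈
      full' : (∀ {e} → e ∈ tasks → 0# < rem e → start-by e < threshold → χ (id e) ≡ true) ⊎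
              count tasks (χ ∘ id) ≡ m ×
              (∀ {e w} → e ∈ tasks → w ∈ tasks → χ (id e) ≡ true → 0# < rem w →
               start-by w < threshold → χ (id w) ≡ false → start-by e ≤ start-by w)
      full' with full
      ... | inj₁ all             = inj₁ λ e∈ r l → all e∈ (r , l)
      ... | inj₂ (n≡m , ordered) = inj₂ (n≡m , λ e∈ w∈ run r l wait → ordered e∈ w∈ run (r , l) wait)
      relaxed : ∀ {w} → w ∈ tasks → 0# < rem w → χ (id w) ≡ false → now < start-by w
      relaxed {w} w∈ r wait with now <? start-by w | full'
      ... | yes t<l | _ = t<l
      ... | no  t≮l | inj₁ all = contradiction (trans (sym (all w∈ r (≤-<-trans (≮⇒≥ t≮l) t<h))) wait) λ ()
      ... | no  t≮l | inj₂ (n≡m , ordered) = contradiction (≮⇒≥ t≮l)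
        (no-rushed-waiting {χ} (rushed-few t<h Vol≤k) n≡m w∈ r wait λ e∈ run → proj₁ (eligible e∈ run) ,
          ≤-trans (ordered e∈ w∈ run r (≤-<-trans (≮⇒≥ t≮l) t<h) wait) (≮⇒≥ t≮l))

  module _ (es : List Task) (rem : Task → ℝ) where

    crossings : ℕ
    crossings = count (cartesianProduct es es) (λ p → does ((dl (proj₁ p) - rem (proj₁ p)) <? dl (proj₂ p)))

    nears relaxations : ℝ → ℕ
    nears h       = count es (λ e → does (0# <? rem e) ∧ does ((dl e - rem e) <? h))
    relaxations t = count es (λ e → does (t <? (dl e - rem e)))

  beyonds : List Task → ℝ → ℕ
  beyonds es h = count es (λ e → does (h <? dl e))

  module _ (s : State) where
    open State s

    Overfull : Task → Set
    Overfull b = now < dl b × c * (dl b - now) ≤ Vol (dl b)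

    overfull? : ∀ b → Dec (Overfull b)
    overfull? b = (now <? dl b) ×-dec (c * (dl b - now) ≤? Vol (dl b))

    mode measure : ℕ
    mode with now <? threshold | find tasks Overfull overfull?
    ... | yes _ | _      = 2
    ... | no _  | inj₁ _ = 0
    ... | no _  | inj₂ _ = 1
    measure = crossings tasks rem ℕ.+ nears tasks rem threshold ℕ.+ relaxations tasks rem now
              ℕ.+ (3 ℕ.+ length tasks) ℕ.* beyonds tasks threshold ℕ.+ mode

    mode≤2 : mode ℕ.≤ 2
    mode≤2 with now <? threshold | find tasks Overfull overfull?
    ... | yes _ | _      = ℕ.≤-refl
    ... | no _  | inj₁ _ = z≤n
    ... | no _  | inj₂ _ = s≤s z≤n

    mode-block : now < threshold → mode ≡ 2
    mode-block t<h with now <? threshold | find tasks Overfull overfull?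
    ... | yes _  | _ = refl
    ... | no t≮h | _ = contradiction t<h t≮h

    mode-gap : ¬ now < threshold → mode ℕ.≤ 1
    mode-gap t≮h with now <? threshold | find tasks Overfull overfull?
    ... | yes t<h | _      = contradiction t<h t≮h
    ... | no _    | inj₁ _ = z≤n
    ... | no _    | inj₂ _ = s≤s z≤n

    mode-overfull : ¬ now < threshold → ∀ {b} → b ∈ tasks → Overfull b → mode ≡ 0
    mode-overfull t≮h b∈ over with now <? threshold | find tasks Overfull overfull?
    ... | yes t<h | _         = contradiction t<h t≮h
    ... | no _    | inj₁ _    = refl
    ... | no _    | inj₂ none = contradiction over (none b∈)

    mode-calm : ¬ now < threshold → (∀ {b} → b ∈ tasks → ¬ Overfull b) → mode ≡ 1
    mode-calm t≮h calm with now <? threshold | find tasks Overfull overfull?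
    ... | yes t<h | _                   = contradiction t<h t≮h
    ... | no _    | inj₁ (b , b∈ , over) = contradiction over (calm b∈)
    ... | no _    | inj₂ _              = refl

  descent : ∀ k {a a' b b' c c' d d' e e'} → a' ℕ.≤ a → b' ℕ.≤ b → c' ℕ.≤ c → d' ℕ.≤ d → e' ℕ.≤ e →
    a' ℕ.< a ⊎ b' ℕ.< b ⊎ c' ℕ.< c ⊎ d' ℕ.< d ⊎ e' ℕ.< e →
    a' ℕ.+ b' ℕ.+ c' ℕ.+ suc k ℕ.* d' ℕ.+ e' ℕ.< a ℕ.+ b ℕ.+ c ℕ.+ suc k ℕ.* d ℕ.+ e
  descent k a b c d e (inj₁ a<) =
    ℕ.+-mono-<-≤ (ℕ.+-mono-<-≤ (ℕ.+-mono-<-≤ (ℕ.+-mono-<-≤ a< b) c) (ℕ.*-monoʳ-≤ (suc k) d)) e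
  descent k a b c d e (inj₂ (inj₁ b<)) =
    ℕ.+-mono-<-≤ (ℕ.+-mono-<-≤ (ℕ.+-mono-<-≤ (ℕ.+-mono-≤-< a b<) c) (ℕ.*-monoʳ-≤ (suc k) d)) e
  descent k a b c d e (inj₂ (inj₂ (inj₁ c<))) =
    ℕ.+-mono-<-≤ (ℕ.+-mono-<-≤ (ℕ.+-mono-≤-< (ℕ.+-mono-≤ a b) c<) (ℕ.*-monoʳ-≤ (suc k) d)) e
  descent k a b c d e (inj₂ (inj₂ (inj₂ (inj₁ d<)))) =
    ℕ.+-mono-<-≤ (ℕ.+-mono-≤-< (ℕ.+-mono-≤ (ℕ.+-mono-≤ a b) c) (ℕ.*-monoʳ-< (suc k) d<)) e
  descent k a b c d e (inj₂ (inj₂ (inj₂ (inj₂ e<)))) =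
    ℕ.+-mono-≤-< (ℕ.+-mono-≤ (ℕ.+-mono-≤ (ℕ.+-mono-≤ a b) c) (ℕ.*-monoʳ-≤ (suc k) d)) e<

  ≤?⇒ : {P Q : Set} (p? : Dec P) (q? : Dec Q) → (P → Q) → does p? ≡ true → does q? ≡ true
  ≤?⇒ p? q? f eq = true-does q? (f (does-true {d = p?} eq))

  beyonds-≤ : ∀ es {h h'} → h ≤ h' → beyonds es h' ℕ.≤ beyonds es h
  beyonds-≤ es {h} {h'} h≤h' = count-≤ es λ {e} _ → ≤?⇒ (h' <? dl e) (h <? dl e) (≤-<-trans h≤h')

  beyonds-< : ∀ es {h h'} → h ≤ h' → ∀ {b} → b ∈ es → h < dl b → dl b ≤ h' → beyonds es h' ℕ.< beyonds es h
  beyonds-< es {h} {h'} h≤h' {b} b∈ h<b b≤h' = count-< es (λ {e} _ → ≤?⇒ (h' <? dl e) (h <? dl e) (≤-<-trans h≤h'))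
    b∈ (false-does (h' <? dl b) (λ l → <⇒≱ l b≤h')) (true-does (h <? dl b) h<b)

  module _ {s : State} (sound : Sound s) {χ : ℕ → Bool} {δ : ℝ}
           (runnable : Runnable s χ) (steady : Steady s χ δ) where
    open State s
    open Sound sound
    open Runnable runnable
    open Steady steady
    open Flow s χ δ
    open Steadily sound runnable steady

    private
      later-start : ∀ {e} → e ∈ tasks → start-by e ≤ dl e - rem' e
      later-start {e} e∈ with true-or-false (χ (id e))
      ... | inj₁ run  = subst (start-by e ≤_) (sym (start-by' e∈ run)) (arith 2 (λ l d → (# 0 ⊑ d ∷ []) ⊢ l ≼ l :+ d) refl 0≤δ)
      ... | inj₂ wait = ≤-reflexive (cong (λ r → dl e - r) (sym (idle-rem e wait)))

      less-rem : ∀ e → 0# < rem' e → 0# < rem e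
      less-rem e r = <-≤-trans r (subst (_≤ rem e) (sym (rem'-eq e))
        (arith 2 (λ r y → (# 0 ⊑ y ∷ []) ⊢ r :- y ≼ r) refl (*-nonNegative (0≤[] (χ (id e))) 0≤δ)))

      earlier : ∀ {e} → e ∈ tasks → now + δ < dl e - rem' e → now < start-by e
      earlier {e} e∈ l with true-or-false (χ (id e))
      ... | inj₁ run  = <-diff⁻¹ (subst (0# <_) (arith 3 (λ x t d → [] ⊢ (x :+ d) :- (t :+ d) ≈ x :- t) refl)
        (<-diff (subst (now + δ <_) (start-by' e∈ run) l)))
      ... | inj₂ wait = ≤-<-trans (arith 2 (λ t d → (# 0 ⊑ d ∷ []) ⊢ t ≼ t :+ d) refl 0≤δ)
        (subst (λ r → now + δ < dl e - r) (idle-rem e wait) l)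

    crossings-≤ : crossings tasks rem' ℕ.≤ crossings tasks rem
    crossings-≤ = count-≤ (cartesianProduct tasks tasks) λ {p} p∈ →
      ≤?⇒ ((dl (proj₁ p) - rem' (proj₁ p)) <? dl (proj₂ p)) (start-by (proj₁ p) <? dl (proj₂ p))
        (≤-<-trans (later-start (proj₁ (∈-cartesianProduct⁻ tasks tasks p∈))))

    crossings-< : ∀ {e b} → e ∈ tasks → b ∈ tasks → χ (id e) ≡ true → start-by e < dl b → δ ≡ dl b - start-by e →
                  crossings tasks rem' ℕ.< crossings tasks rem
    crossings-< {e} {b} e∈ b∈ run l eq = count-< (cartesianProduct tasks tasks) (λ {p} p∈ →
      ≤?⇒ ((dl (proj₁ p) - rem' (proj₁ p)) <? dl (proj₂ p)) (start-by (proj₁ p) <? dl (proj₂ p))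
        (≤-<-trans (later-start (proj₁ (∈-cartesianProduct⁻ tasks tasks p∈)))))
      (∈-cartesianProduct⁺ e∈ b∈)
      (false-does ((dl e - rem' e) <? dl b) (λ l' → <⇒≱ l' (≤-reflexive
        (sym (trans (start-by' e∈ run) (trans (cong (start-by e +_) eq) (arith 2 (λ l b → [] ⊢ l :+ (b :- l) ≈ b) refl)))))))
      (true-does (start-by e <? dl b) l)

    relaxations-≤ : relaxations tasks rem' (now + δ) ℕ.≤ relaxations tasks rem now
    relaxations-≤ = count-≤ tasks λ {e} e∈ → ≤?⇒ ((now + δ) <? (dl e - rem' e)) (now <? start-by e) (earlier e∈)

    relaxations-< : ∀ {e} → e ∈ tasks → χ (id e) ≡ false → now < start-by e → δ ≡ start-by e - now →
                    relaxations tasks rem' (now + δ) ℕ.< relaxations tasks rem now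
    relaxations-< {e} e∈ wait l eq = count-< tasks
      (λ {e} e∈ → ≤?⇒ ((now + δ) <? (dl e - rem' e)) (now <? start-by e) (earlier e∈)) e∈
      (false-does ((now + δ) <? (dl e - rem' e)) (λ l' → <⇒≱ l' (≤-reflexive (trans (cong (λ r → dl e - r) (idle-rem e wait))
        (trans (arith 2 (λ l t → [] ⊢ l ≈ t :+ (l :- t)) refl) (cong (now +_) (sym eq)))))))
      (true-does (now <? start-by e) l)

    nears-≤ : ∀ h → nears tasks rem' h ℕ.≤ nears tasks rem h
    nears-≤ h = count-≤ tasks λ {e} e∈ eq → let r , l = ∧-yes⁻¹ (0# <? rem' e) ((dl e - rem' e) <? h) eq in
      ∧-yes (0# <? rem e) (start-by e <? h) (less-rem e r) (≤-<-trans (later-start e∈) l)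

    nears-< : ∀ {h e} → e ∈ tasks → χ (id e) ≡ true → start-by e < h → δ ≡ h - start-by e →
              nears tasks rem' h ℕ.< nears tasks rem h
    nears-< {h} {e} e∈ run l eq = count-< tasks (λ {e} e∈ eq → let r , l = ∧-yes⁻¹ (0# <? rem' e) ((dl e - rem' e) <? h) eq in
      ∧-yes (0# <? rem e) (start-by e <? h) (less-rem e r) (≤-<-trans (later-start e∈) l)) e∈
      (∧-no (0# <? rem' e) ((dl e - rem' e) <? h) (λ { (_ , l') → <⇒≱ l' (≤-reflexive
        (sym (trans (start-by' e∈ run) (trans (cong (start-by e +_) eq) (arith 2 (λ l b → [] ⊢ l :+ (b :- l) ≈ b) refl))))) }))
      (∧-yes (0# <? rem e) (start-by e <? h) (only-pending e∈ run) l)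

  nears-gap : ∀ {s} → Sound s → nears (State.tasks s) (State.rem s) (State.now s) ≡ 0
  nears-gap {s} sound = ℕ.n≤0⇒n≡0 (subst (nears tasks rem now ℕ.≤_) (none tasks) (count-≤ tasks λ {e} e∈ eq →
      let r , l = ∧-yes⁻¹ (0# <? rem e) (start-by e <? now) eq in contradiction (now≤start-by e∈ r) (<⇒≱ l)))
    where
    open State s
    open Sound sound
    none : ∀ (es : List Task) → count es (λ _ → false) ≡ 0
    none []       = refl
    none (e ∷ es) = none es

  data Next (s : State) : Set where
    stop  : State.threshold s ≡ State.now s → (∀ {e} → e ∈ State.tasks s → dl e ≤ State.now s) → Next s
    raise : State.threshold s ≡ State.now s → ∀ {b} → b ∈ State.tasks s → Overfull s b →
            measure (guard-raise s b) ℕ.< measure s → Next s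
    gap   : ∀ {χ δ} → GapPhase s χ → GapLimit s χ δ →
            (∀ new → measure (gap-flow s χ δ new) ℕ.< measure s) → Next s
    block : ∀ {χ δ} → BlockPhase s χ → BlockLimit s χ δ →
            (∀ new → measure (block-flow s χ δ new) ℕ.< measure s) → Next s

  least-pos : ∀ {A : Set} {top : ℝ} {xs : List A} {P : A → Set} {f : A → ℝ} {δ} → 0# < top →
              (∀ {x} → x ∈ xs → P x → 0# < f x) → δ ≡ top ⊎ (∃[ x ] x ∈ xs × P x × δ ≡ f x) → 0# < δ
  least-pos 0<top each (inj₁ refl)                = 0<top
  least-pos 0<top each (inj₂ (x , x∈ , p , refl)) = each x∈ p

  module _ {s : State} (sound : Sound s) where
    open State s
    open Sound sound

    raise-measure : threshold ≡ now → ∀ {b} → b ∈ tasks → now < dl b → measure (guard-raise s b) ℕ.< measure s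
    raise-measure open-gap {b} b∈ t<b = ℕ.≤-<-trans
      (ℕ.+-mono-≤ (ℕ.+-monoˡ-≤ _ (ℕ.+-monoˡ-≤ _ (ℕ.+-monoʳ-≤ X (count≤length tasks)))) (mode≤2 (guard-raise s b)))
      (ℕ.≤-trans (bound X n (relaxations tasks rem now) (beyonds tasks (dl b)) (beyonds tasks threshold)
        (beyonds-< tasks (subst (_≤ dl b) (sym open-gap) (<⇒≤ t<b)) b∈ (subst (_< dl b) (sym open-gap) t<b) ≤-refl))
        (ℕ.≤-trans (ℕ.+-monoˡ-≤ _ (ℕ.+-monoˡ-≤ _ (ℕ.m≤m+n X (nears tasks rem threshold)))) (ℕ.m≤m+n _ (mode s))))
      where
      X n : ℕ
      X = crossings tasks rem
      n = length tasks
      bound : ∀ X n r b' b → b' ℕ.< b → X ℕ.+ n ℕ.+ r ℕ.+ (3 ℕ.+ n) ℕ.* b' ℕ.+ 2 ℕ.< X ℕ.+ r ℕ.+ (3 ℕ.+ n) ℕ.* b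
      bound X n r b' b b'<b = ℕ.≤-trans (ℕ.≤-reflexive (solve X n r b'))
        (ℕ.+-monoʳ-≤ (X ℕ.+ r) (ℕ.*-monoʳ-≤ (3 ℕ.+ n) b'<b))
        where
        open +-*-Solver using (_:=_) renaming (solve to solve′; _:+_ to _⊕_; _:*_ to _⊛_; con to con′)
        solve : ∀ X n r b' → suc (X ℕ.+ n ℕ.+ r ℕ.+ (3 ℕ.+ n) ℕ.* b' ℕ.+ 2) ≡ X ℕ.+ r ℕ.+ (3 ℕ.+ n) ℕ.* suc b'
        solve = solve′ 4 (λ X n r b → con′ 1 ⊕ (X ⊕ n ⊕ r ⊕ (con′ 3 ⊕ n) ⊛ b ⊕ con′ 2) := X ⊕ r ⊕ (con′ 3 ⊕ n) ⊛ (con′ 1 ⊕ b)) refl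

    next-block : now < threshold → Next s
    next-block t<h with block-phase sound t<h
    ... | χ , phase , relaxed
      with least (threshold - now) (cartesianProduct tasks tasks)
             (λ p → χ (id (proj₁ p)) ≡ true × start-by (proj₁ p) < dl (proj₂ p))
             (λ p → (χ (id (proj₁ p)) Bool.≟ true) ×-dec (start-by (proj₁ p) <? dl (proj₂ p)))
             (λ p → dl (proj₂ p) - start-by (proj₁ p))
    ...   | δ₁ , δ₁≤top , δ₁≤ , from₁
      with least δ₁ tasks (λ e → χ (id e) ≡ true) (λ e → χ (id e) Bool.≟ true) (λ e → threshold - start-by e)
    ...     | δ₂ , δ₂≤δ₁ , δ₂≤ , from₂
      with least δ₂ tasks (λ e → χ (id e) ≡ false × 0# < rem e) (λ e → (χ (id e) Bool.≟ false) ×-dec (0# <? rem e))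
             (λ e → start-by e - now)
    ...       | δ , δ≤δ₂ , δ≤ , from₃ = block phase limit drop
      where
      open BlockPhase phase
      0<δ : 0# < δ
      0<δ = least-pos (least-pos (least-pos (<-diff t<h) (λ _ → <-diff ∘ proj₂) from₁)
              (λ e∈ run → <-diff (only-near e∈ run)) from₂)
              (λ { e∈ (wait , r) → <-diff (relaxed e∈ r wait) }) from₃
      δ≤δ₁ : δ ≤ δ₁
      δ≤δ₁ = ≤-trans δ≤δ₂ δ₂≤δ₁
      steady : Steady s χ δ
      steady = record
        { 0≤δ      = <⇒≤ 0<δ
        ; no-cross = λ e∈ b∈ run l → arith 3 (λ l d b → (d ⊑ b :- l ∷ []) ⊢ l :+ d ≼ b) refl
                       (≤-trans δ≤δ₁ (δ₁≤ (∈-cartesianProduct⁺ e∈ b∈) (run , l)))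
        ; no-late  = λ e∈ r wait → arith 3 (λ t d l → (d ⊑ l :- t ∷ []) ⊢ t :+ d ≼ l) refl (δ≤ e∈ (wait , r))
        }
      limit : BlockLimit s χ δ
      limit = record
        { steady   = steady
        ; in-block = arith 3 (λ t d h → (d ⊑ h :- t ∷ []) ⊢ t :+ d ≼ h) refl (≤-trans δ≤δ₁ δ₁≤top)
        ; near-end = λ e∈ run → arith 3 (λ l d h → (d ⊑ h :- l ∷ []) ⊢ l :+ d ≼ h) refl (≤-trans δ≤δ₂ (δ₂≤ e∈ run))
        }
      drop : ∀ new → measure (block-flow s χ δ new) ℕ.< measure s
      drop new = descent (2 ℕ.+ length tasks)
        (crossings-≤ sound runnable steady) (nears-≤ sound runnable steady threshold)
        (relaxations-≤ sound runnable steady) ℕ.≤-refl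
        (subst (mode s' ℕ.≤_) (sym (mode-block s t<h)) (mode≤2 s')) (event from₃)
        where
        s' : State
        s' = block-flow s χ δ new
        Strict : Set
        Strict = crossings tasks (State.rem s') ℕ.< crossings tasks rem
          ⊎ nears tasks (State.rem s') threshold ℕ.< nears tasks rem threshold
          ⊎ relaxations tasks (State.rem s') (now + δ) ℕ.< relaxations tasks rem now
          ⊎ beyonds tasks threshold ℕ.< beyonds tasks threshold
          ⊎ mode s' ℕ.< mode s
        event₁ : δ ≡ δ₁ → δ₁ ≡ threshold - now ⊎ _ → Strict
        event₁ eq (inj₁ top) = inj₂ (inj₂ (inj₂ (inj₂ (subst (mode s' ℕ.<_) (sym (mode-block s t<h))
          (s≤s (mode-gap s' (λ l → <⇒≱ l (≤-reflexive (sym (trans (cong (now +_) (trans eq top))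
            (arith 2 (λ t h → [] ⊢ t :+ (h :- t) ≈ h) refl)))))))))))
        event₁ eq (inj₂ (p , p∈ , (run , l) , eq₁)) = inj₁ (crossings-< sound runnable steady
          (proj₁ (∈-cartesianProduct⁻ tasks tasks p∈)) (proj₂ (∈-cartesianProduct⁻ tasks tasks p∈)) run l (trans eq eq₁))
        event₂ : δ ≡ δ₂ → δ₂ ≡ δ₁ ⊎ _ → Strict
        event₂ eq (inj₁ eq₂) = event₁ (trans eq eq₂) from₁
        event₂ eq (inj₂ (e , e∈ , run , eq₂)) = inj₂ (inj₁ (nears-< sound runnable steady e∈ run (only-near e∈ run) (trans eq eq₂)))
        event : δ ≡ δ₂ ⊎ _ → Strict
        event (inj₁ eq) = event₂ eq from₂
        event (inj₂ (e , e∈ , (wait , r) , eq)) = inj₂ (inj₂ (inj₁ (relaxations-< sound runnable steady e∈ wait (relaxed e∈ r wait) eq)))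

    next-gap : threshold ≡ now → (∀ {b} → b ∈ tasks → ¬ Overfull s b) → ∀ {b₀} → b₀ ∈ tasks → now < dl b₀ → Next s
    next-gap open-gap calm {b₀} b₀∈ t<b₀ with gap-phase sound open-gap
    ... | χ , phase
      with least (dl b₀ - now) (cartesianProduct tasks tasks)
             (λ p → χ (id (proj₁ p)) ≡ true × start-by (proj₁ p) < dl (proj₂ p))
             (λ p → (χ (id (proj₁ p)) Bool.≟ true) ×-dec (start-by (proj₁ p) <? dl (proj₂ p)))
             (λ p → dl (proj₂ p) - start-by (proj₁ p))
    ...   | δ₁ , δ₁≤top , δ₁≤ , from₁
      with least δ₁ tasks (λ e → χ (id e) ≡ false × 0# < rem e) (λ e → (χ (id e) Bool.≟ false) ×-dec (0# <? rem e))
             (λ e → start-by e - now)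
    ...     | δ₂ , δ₂≤δ₁ , δ₂≤ , from₂
      with least δ₂ tasks (λ b → now < dl b × Flow.active s χ 0# (dl b) < c)
             (λ b → (now <? dl b) ×-dec (Flow.active s χ 0# (dl b) <? c))
             (λ b → (c * (dl b - now) - Vol (dl b)) / (c - Flow.active s χ 0# (dl b)))
    ...       | δ , δ≤δ₂ , δ≤ , from₃ = gap phase limit drop
      where
      open GapPhase phase using (urgent; runnable)
      active : ℝ → ℝ
      active = Flow.active s χ 0#
      slow : Task → ℝ
      slow b = c - active (dl b)
      room : Task → ℝ
      room b = c * (dl b - now) - Vol (dl b)
      relaxed : ∀ {w} → w ∈ tasks → 0# < rem w → χ (id w) ≡ false → now < start-by w
      relaxed {w} w∈ r wait = ≰⇒> λ l → contradiction (trans (sym (urgent w∈ r l)) wait) λ ()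
      0<room : ∀ {b} → b ∈ tasks → now < dl b → 0# < room b
      0<room b∈ t<b = <-diff (≰⇒> λ over → calm b∈ (t<b , over))
      0<δ : 0# < δ
      0<δ = least-pos (least-pos (least-pos (<-diff t<b₀) (λ _ → <-diff ∘ proj₂) from₁)
              (λ { e∈ (wait , r) → <-diff (relaxed e∈ r wait) }) from₂)
              (λ { b∈ (t<b , a<c) → /-pos (0<room b∈ t<b) (<-diff a<c) }) from₃
      δ≤δ₁ : δ ≤ δ₁
      δ≤δ₁ = ≤-trans δ≤δ₂ δ₂≤δ₁
      steady : Steady s χ δ
      steady = record
        { 0≤δ      = <⇒≤ 0<δ
        ; no-cross = λ e∈ b∈ run l → arith 3 (λ l d b → (d ⊑ b :- l ∷ []) ⊢ l :+ d ≼ b) refl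
                       (≤-trans δ≤δ₁ (δ₁≤ (∈-cartesianProduct⁺ e∈ b∈) (run , l)))
        ; no-late  = λ e∈ r wait → arith 3 (λ t d l → (d ⊑ l :- t ∷ []) ⊢ t :+ d ≼ l) refl
                       (≤-trans δ≤δ₂ (δ₂≤ e∈ (wait , r)))
        }
      guard : ∀ {b} → b ∈ tasks → now < dl b → slow b * δ ≤ room b
      guard {b} b∈ t<b with active (dl b) <? c
      ... | yes a<c = subst (slow b * δ ≤_) (/-cancel (<-diff a<c))
        (*-monoʳ-≤ (slow b) (<⇒≤ (<-diff a<c)) (δ≤ b∈ (t<b , a<c)))
      ... | no  a≮c = ≤-trans (arith 3 (λ c a d → (# 0 ⊑ (a :- c) :* d ∷ []) ⊢ (c :- a) :* d ≼ # 0) refl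
          (*-nonNegative (diff-nonneg (≮⇒≥ a≮c)) (<⇒≤ 0<δ)))
        (<⇒≤ (0<room b∈ t<b))
      limit : GapLimit s χ δ
      limit = record { steady = steady ; guard = guard }
      drop : ∀ new → measure (gap-flow s χ δ new) ℕ.< measure s
      drop new = descent (2 ℕ.+ length tasks)
        (crossings-≤ sound runnable steady) (subst (ℕ._≤ nears tasks rem threshold) (sym (nears-gap sound')) z≤n)
        (relaxations-≤ sound runnable steady) (beyonds-≤ tasks h≤now')
        (subst (mode s' ℕ.≤_) (sym (mode-calm s (closed s open-gap) calm)) (mode-gap s' (closed s' refl))) (event from₃)
        where
        s' : State
        s' = gap-flow s χ δ new
        sound' : Sound s'
        sound' = gap-sound sound phase limit new
        h≤now' : threshold ≤ now + δ
        h≤now' = subst (_≤ now + δ) (sym open-gap) (arith 2 (λ t d → (# 0 ⊑ d ∷ []) ⊢ t ≼ t :+ d) refl (<⇒≤ 0<δ))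
        closed : ∀ s → State.threshold s ≡ State.now s → ¬ State.now s < State.threshold s
        closed s eq l = <⇒≱ l (≤-reflexive eq)
        Strict : Set
        Strict = crossings tasks (State.rem s') ℕ.< crossings tasks rem
          ⊎ nears tasks (State.rem s') (now + δ) ℕ.< nears tasks rem threshold
          ⊎ relaxations tasks (State.rem s') (now + δ) ℕ.< relaxations tasks rem now
          ⊎ beyonds tasks (now + δ) ℕ.< beyonds tasks threshold
          ⊎ mode s' ℕ.< mode s
        due-now : ∀ {b} → b ∈ tasks → now < dl b → dl b ≤ now + δ → Strict
        due-now {b} b∈ t<b b≤ = inj₂ (inj₂ (inj₂ (inj₁ (beyonds-< tasks h≤now' b∈ (subst (_< dl b) (sym open-gap) t<b) b≤))))
        event₁ : δ ≡ δ₁ → δ₁ ≡ dl b₀ - now ⊎ _ → Strict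
        event₁ eq (inj₁ top) = due-now b₀∈ t<b₀ (≤-reflexive (sym (trans (cong (now +_) (trans eq top))
            (arith 2 (λ t h → [] ⊢ t :+ (h :- t) ≈ h) refl))))
        event₁ eq (inj₂ (p , p∈ , (run , l) , eq₁)) = inj₁ (crossings-< sound runnable steady
          (proj₁ (∈-cartesianProduct⁻ tasks tasks p∈)) (proj₂ (∈-cartesianProduct⁻ tasks tasks p∈)) run l (trans eq eq₁))
        event₂ : δ ≡ δ₂ → δ₂ ≡ δ₁ ⊎ _ → Strict
        event₂ eq (inj₁ eq₂) = event₁ (trans eq eq₂) from₁
        event₂ eq (inj₂ (e , e∈ , (wait , r) , eq₂)) =
          inj₂ (inj₂ (inj₁ (relaxations-< sound runnable steady e∈ wait (relaxed e∈ r wait) (trans eq eq₂))))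
        event : δ ≡ δ₂ ⊎ _ → Strict
        event (inj₁ eq) = event₂ eq from₂
        event (inj₂ (b , b∈ , (t<b , a<c) , eq)) with dl b ≤? now + δ
        ... | yes b≤ = due-now b∈ t<b b≤
        ... | no  b≰ = inj₂ (inj₂ (inj₂ (inj₂ (subst₂ ℕ._<_ (sym (mode-overfull s' (closed s' refl) b∈ (≰⇒> b≰ , over)))
          (sym (mode-calm s (closed s open-gap) calm)) (s≤s z≤n)))))
          where
          over : c * (dl b - (now + δ)) ≤ State.Vol s' (dl b)
          over = subst (c * (dl b - (now + δ)) ≤_)
            (sym (Steadily.Vol-flow sound runnable steady (λ e∈ run → Steady.no-cross steady e∈ b∈ run)))
            (≤-reflexive (arith 6 (λ c b t d v a → (c :* (b :- t) :- v ≐ (c :- a) :* d ∷ [])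
              ⊢ c :* (b :- (t :+ d)) ≈ v :- a :* d) refl
              (sym (trans (cong (slow b *_) eq) (/-cancel (<-diff a<c))))))

    next : Next s
    next with now <? threshold
    ... | yes t<h = next-block t<h
    ... | no  t≮h with find tasks (Overfull s) (overfull? s)
    ...   | inj₁ (b , b∈ , over) = raise open-gap b∈ over (raise-measure open-gap b∈ (proj₁ over))
      where
      open-gap : threshold ≡ now
      open-gap = ≤-antisym (≮⇒≥ t≮h) now≤threshold
    ...   | inj₂ calm with find tasks (λ b → now < dl b) (λ b → now <? dl b)
    ...     | inj₁ (b , b∈ , t<b) = next-gap (≤-antisym (≮⇒≥ t≮h) now≤threshold) calm b∈ t<b
    ...     | inj₂ none = stop (≤-antisym (≮⇒≥ t≮h) now≤threshold) (λ e∈ → ≮⇒≥ (none e∈))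

module Execution (ℛ : Reals) (m : ℕ) (1≤m : 1 ℕ.≤ m) (ε : Reals.ℝ ℛ)
               (0<ε : Reals._<_ ℛ (Reals.0# ℛ) ε)
               (ε≤1 : Reals._≤_ ℛ ε (Reals.1# ℛ)) where
  open OrderedField ℛ
  open Volumes ℛ
  open Parameters ℛ m 1≤m ε 0<ε ε≤1
  open Scheduling ℛ using (Schedule; start; Runs; AgreeBefore)
  open States ℛ m 1≤m ε 0<ε ε≤1
  open Flows ℛ m 1≤m ε 0<ε ε≤1
  open Raises ℛ m 1≤m ε 0<ε ε≤1
  open Competition ℛ m 1≤m ε 0<ε ε≤1
  open Rivalry ℛ m 1≤m ε 0<ε ε≤1
  open Plans ℛ m
  open Steps ℛ m 1≤m ε 0<ε ε≤1

  record Faces (O : ℕ → ℝ → ℝ) (e : Task) : Set where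
    field
      aware   : Knows O e
      limited : 0# < size e → ∀ x → O (id e) x ≤ size e

  record Good (s : State) : Set where
    open State s
    field
      sound    : Sound s
      planned  : Planned now tasks work segs
      rivalled : ∀ O → Opponent O → (∀ {e} → e ∈ tasks → Faces O e) → ∃[ o ] Rival O s o

  phase-of : (s : State) → (ℕ → Bool) → ℝ → Schedule m
  phase-of s χ δ = phase χ now (now + δ) (allFin m) tasks ++ segs
    where open State s

  gap-next block-next : (s : State) → (ℕ → Bool) → ℝ → State
  gap-next   s χ δ = gap-flow s χ δ (phase-of s χ δ)
  block-next s χ δ = block-flow s χ δ (phase-of s χ δ)

  module _ {s : State} (good : Good s) where
    open State s
    open Good good
    open Sound sound

    flow-planned : ∀ {χ δ} → Runnable s χ → Steady s χ δ →
                   Planned (now + δ) tasks (Flow.advance s χ δ work) (phase-of s χ δ)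
    flow-planned {χ} runnable steady = planned-flow planned χ 0≤δ distinct few λ {e} e∈ run →
      rel≤now e∈ ,
      ≤-trans (+-monoˡ-≤ _ (now≤start-by e∈ (only-pending e∈ run)))
        (no-cross e∈ e∈ run (<-diff⁻¹ (subst (0# <_) (arith 2 (λ d r → [] ⊢ r ≈ d :- (d :- r)) refl) (only-pending e∈ run)))) ,
      <-≤-trans (only-pending e∈ run) (arith 2 (λ p w → (# 0 ⊑ w ∷ []) ⊢ p :- w ≼ p) refl (0≤work (id e)))
      where
      open Runnable runnable
      open Steady steady

    gap-good : ∀ {χ δ} → GapPhase s χ → GapLimit s χ δ → Good (gap-next s χ δ)
    gap-good {χ} {δ} phase limit = record
      { sound    = gap-sound sound phase limit _
      ; planned  = flow-planned (GapPhase.runnable phase) (GapLimit.steady limit)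
      ; rivalled = λ O opponent faces → let o , rival = rivalled O opponent faces in
          _ , gap-rival sound opponent rival phase limit _
      }

    block-good : ∀ {χ δ} → BlockPhase s χ → BlockLimit s χ δ → Good (block-next s χ δ)
    block-good {χ} {δ} phase limit = record
      { sound    = block-sound sound phase limit _
      ; planned  = flow-planned (BlockPhase.runnable phase) (BlockLimit.steady limit)
      ; rivalled = λ O opponent faces → let o , rival = rivalled O opponent faces in
          o , block-rival sound opponent rival phase limit _
      }

    raise-good : threshold ≡ now → ∀ {b} → b ∈ tasks → Overfull s b → Good (guard-raise s b)
    raise-good open-gap b∈ (t<b , full) = record
      { sound    = guard-sound sound open-gap b∈ t<b full
      ; planned  = planned
      ; rivalled = λ O opponent faces → let o , rival = rivalled O opponent faces in
          o , guard-rival sound opponent rival open-gap b∈ t<b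
      }

    shorter-steady : ∀ {χ δ δ'} → 0# ≤ δ' → δ' ≤ δ → Steady s χ δ → Steady s χ δ'
    shorter-steady 0≤δ' δ'≤δ steady = record
      { 0≤δ      = 0≤δ'
      ; no-cross = λ e∈ b∈ run l → arith 4 (λ l d d' b → (l :+ d ⊑ b ∷ d' ⊑ d ∷ []) ⊢ l :+ d' ≼ b) refl
                     (no-cross e∈ b∈ run l) δ'≤δ
      ; no-late  = λ e∈ r wait → arith 4 (λ l d d' b → (l :+ d ⊑ b ∷ d' ⊑ d ∷ []) ⊢ l :+ d' ≼ b) refl
                     (no-late e∈ r wait) δ'≤δ
      }
      where open Steady steady

    shorter-gap : ∀ {χ δ δ'} → threshold ≡ now → 0# ≤ δ' → δ' ≤ δ → GapLimit s χ δ → GapLimit s χ δ'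
    shorter-gap {χ} {δ} {δ'} open-gap 0≤δ' δ'≤δ limit = record
      { steady = shorter-steady 0≤δ' δ'≤δ steady
      ; guard  = guard'
      }
      where
      open GapLimit limit
      guard' : ∀ {b} → b ∈ tasks → now < dl b → (c - Flow.active s χ δ' (dl b)) * δ' ≤ c * (dl b - now) - Vol (dl b)
      guard' {b} b∈ t<b with total 0# (c - Flow.active s χ δ' (dl b))
      ... | inj₁ 0≤c-a = ≤-trans (*-monoʳ-≤ _ 0≤c-a δ'≤δ) (guard b∈ t<b)
      ... | inj₂ c-a≤0 = ≤-trans
        (arith 2 (λ a d → (# 0 ⊑ (# 0 :- a) :* d ∷ []) ⊢ a :* d ≼ # 0) refl (*-nonNegative (diff-nonneg c-a≤0) 0≤δ'))
        (diff-nonneg (gap-volume sound open-gap (<⇒≤ t<b)))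

    shorter-block : ∀ {χ δ δ'} → 0# ≤ δ' → δ' ≤ δ → BlockLimit s χ δ → BlockLimit s χ δ'
    shorter-block 0≤δ' δ'≤δ limit = record
      { steady   = shorter-steady 0≤δ' δ'≤δ steady
      ; in-block = arith 4 (λ l d d' b → (l :+ d ⊑ b ∷ d' ⊑ d ∷ []) ⊢ l :+ d' ≼ b) refl in-block δ'≤δ
      ; near-end = λ e∈ run → arith 4 (λ l d d' b → (l :+ d ⊑ b ∷ d' ⊑ d ∷ []) ⊢ l :+ d' ≼ b) refl
                     (near-end e∈ run) δ'≤δ
      }
      where open BlockLimit limit

    module _ (open-gap : threshold ≡ now) (over : ∀ {e} → e ∈ tasks → dl e ≤ now) where

      private
        nothing-pending : ∀ {e} → e ∈ tasks → ¬ 0# < rem e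
        nothing-pending e∈ r = <⇒≱ (now<dl e∈ r) (over e∈)

      idle-phase : GapPhase s (λ _ → false)
      idle-phase = record
        { runnable = record { only-pending = λ _ () ; only-tasks = λ _ () ; few = subst (ℕ._≤ m) (sym (none tasks)) z≤n }
        ; open-gap = open-gap
        ; full     = inj₁ λ e∈ r → contradiction r (nothing-pending e∈)
        ; urgent   = λ e∈ r _ → contradiction r (nothing-pending e∈)
        }
        where
        none : ∀ (es : List Task) → count es (λ _ → false) ≡ 0
        none []       = refl
        none (e ∷ es) = none es

      idle-limit : ∀ {δ} → 0# ≤ δ → GapLimit s (λ _ → false) δ
      idle-limit 0≤δ = record
        { steady = record
          { 0≤δ = 0≤δ ; no-cross = λ _ _ () ; no-late = λ e∈ r _ → contradiction r (nothing-pending e∈) }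
        ; guard  = λ b∈ t<b → contradiction (over b∈) (<⇒≱ t<b)
        }

  -- The result of following the algorithm from s if no further jobs arrive.
  record Outcome (s : State) : Set where
    field
      final     : State
      good      : Good final
      same-jobs : State.tasks final ≡ State.tasks s
      closed    : State.threshold final ≡ State.now final
      over      : ∀ {e} → e ∈ State.tasks final → dl e ≤ State.now final
      later     : Schedule m
      extends   : State.segs final ≡ later ++ State.segs s
      starts    : ∀ {g} → g ∈ later → State.now s ≤ start g

  flow-outcome : ∀ s χ {δ s'} → 0# ≤ δ → State.tasks s' ≡ State.tasks s → State.now s' ≡ State.now s + δ →
                 State.segs s' ≡ phase-of s χ δ → Outcome s' → Outcome s
  flow-outcome s χ {δ} {s'} 0≤δ tasks≡ now≡ segs≡ outcome = record
    { final = final ; good = good ; same-jobs = trans same-jobs tasks≡ ; closed = closed ; over = over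
    ; later = later ++ new
    ; extends = trans extends (trans (cong (later ++_) segs≡) (sym (++-assoc later new segs)))
    ; starts = λ g∈ → starts' (∈-++⁻ later g∈)
    }
    where
    open Outcome outcome
    open State s
    new : Schedule m
    new = phase χ now (now + δ) (allFin m) tasks
    starts' : ∀ {g} → g ∈ later ⊎ g ∈ new → now ≤ start g
    starts' (inj₁ g∈) = ≤-trans (arith 2 (λ t d → (# 0 ⊑ d ∷ []) ⊢ t ≼ t :+ d) refl 0≤δ)
      (≤-trans (≤-reflexive (sym now≡)) (starts g∈))
    starts' (inj₂ g∈) = ≤-reflexive (sym (proj₁ (proj₂ (phase-∈ χ now (now + δ) (allFin m) tasks g∈))))

  run : ∀ n {s} → Good s → measure s ℕ.< n → Outcome s
  run-next : ∀ n {s} → Good s → measure s ℕ.< suc n → Next s → Outcome s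

  run (suc n) good bound = run-next n good bound (next (Good.sound good))

  run-next n {s} good bound (stop open-gap over) = record
    { final = s ; good = good ; same-jobs = refl ; closed = open-gap ; over = over
    ; later = [] ; extends = refl ; starts = λ () }
  run-next n good bound (raise open-gap b∈ over drop) =
    record { Outcome (run n (raise-good good open-gap b∈ over) (ℕ.≤-trans drop (ℕ.≤-pred bound))) }
  run-next n {s} good bound (gap {χ} {δ} phase limit drop) =
    flow-outcome s χ (Steady.0≤δ (GapLimit.steady limit)) refl refl refl
      (run n (gap-good good phase limit) (ℕ.≤-trans (drop _) (ℕ.≤-pred bound)))
  run-next n {s} good bound (block {χ} {δ} phase limit drop) =
    flow-outcome s χ (Steady.0≤δ (BlockLimit.steady limit)) refl refl refl
      (run n (block-good good phase limit) (ℕ.≤-trans (drop _) (ℕ.≤-pred bound)))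

  agree-trans : ∀ {t} {σ τ υ : Schedule m} → AgreeBefore t σ τ → AgreeBefore t τ υ → AgreeBefore t σ υ
  agree-trans f g i x k x<t = mk⇔
    (Equivalence.to (g i x k x<t) ∘ Equivalence.to (f i x k x<t))
    (Equivalence.from (f i x k x<t) ∘ Equivalence.from (g i x k x<t))

  agree-extend : ∀ {t} (new σ : Schedule m) → (∀ {g} → g ∈ new → t ≤ start g) → AgreeBefore t (new ++ σ) σ
  agree-extend []        σ late i x k x<t = mk⇔ (λ r → r) (λ r → r)
  agree-extend (g ∷ new) σ late i x k x<t = mk⇔ to (there ∘ Equivalence.from rest)
    where
    rest : Runs (new ++ σ) i x k ⇔ Runs σ i x k
    rest = agree-extend new σ (late ∘ there) i x k x<t
    to : Runs (g ∷ new ++ σ) i x k → Runs σ i x k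
    to (here (_ , _ , s≤x , _)) = contradiction (≤-trans (late (here refl)) s≤x) (<⇒≱ x<t)
    to (there r)                = Equivalence.to rest r

  agree-truncate : ∀ χ {t t' T} es (σ : Schedule m) → T ≤ t' →
    AgreeBefore T (phase χ t t' (allFin m) es ++ σ) (phase χ t T (allFin m) es ++ σ)
  agree-truncate χ {t} {t'} {T} es σ T≤t' i x k x<T = mk⇔ (move x<T) (move (<-≤-trans x<T T≤t'))
    where
    move : ∀ {a b} → x < b → Runs (phase χ t a (allFin m) es ++ σ) i x k → Runs (phase χ t b (allFin m) es ++ σ) i x k
    move {a} {b} x<b r with Any.++⁻ (phase χ t a (allFin m) es) r
    ... | inj₁ new = Any.++⁺ˡ (phase-runs χ (allFin m) es x<b new)
    ... | inj₂ old = Any.++⁺ʳ (phase χ t b (allFin m) es) old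

  -- The state at time T, at which the next job arrives.
  record Stage (s : State) (full : Outcome s) (T : ℝ) : Set where
    field
      state     : State
      good      : Good state
      same-jobs : State.tasks state ≡ State.tasks s
      at        : State.now state ≡ T
      agrees    : AgreeBefore T (State.segs (Outcome.final full)) (State.segs state)

  to-T : ∀ t T → t + (T - t) ≡ T
  to-T t T = arith 2 (λ t T → [] ⊢ t :+ (T :- t) ≈ T) refl

  truncated : ∀ {s s' χ δ T} (full : Outcome s) (rest : Outcome s') → State.now s ≤ T → T ≤ State.now s + δ →
    State.segs (Outcome.final full) ≡ State.segs (Outcome.final rest) →
    State.segs s' ≡ phase-of s χ δ → State.now s' ≡ State.now s + δ →
    AgreeBefore T (State.segs (Outcome.final full)) (phase-of s χ (T - State.now s))
  truncated {s} {s'} {χ} {δ} {T} full rest t≤T T≤t' final≡ segs≡ now≡ =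
    subst₂ (AgreeBefore T) (sym (trans final≡ (trans extends (cong (later ++_) segs≡))))
      (cong (λ t' → phase χ now t' (allFin m) tasks ++ segs) (sym (to-T now T)))
      (agree-trans {σ = later ++ phase-of s χ δ}
        (agree-extend later (phase-of s χ δ) λ g∈ → ≤-trans T≤t' (≤-trans (≤-reflexive (sym now≡)) (starts g∈)))
        (agree-truncate χ tasks segs T≤t'))
    where
    open State s
    open Outcome rest

  until : ∀ n {s} (good : Good s) (bound : measure s ℕ.< n) T → State.now s ≤ T → Stage s (run n good bound) T
  until-next : ∀ n {s} (good : Good s) (bound : measure s ℕ.< suc n) (next : Next s) T → State.now s ≤ T →
               Stage s (run-next n good bound next) T

  until (suc n) good bound T t≤T = until-next n good bound (next (Good.sound good)) T t≤T

  until-next n {s} good bound (stop open-gap over) T t≤T = record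
    { state = gap-next s (λ _ → false) (T - now)
    ; good  = gap-good good (idle-phase good open-gap over) (idle-limit good open-gap over (diff-nonneg t≤T))
    ; same-jobs = refl
    ; at = to-T now T
    ; agrees = λ i x k _ → subst (λ σ → Runs segs i x k ⇔ Runs (σ ++ segs) i x k) (sym (empty (allFin m) tasks))
        (mk⇔ (λ r → r) (λ r → r))
    }
    where
    open State s
    empty : ∀ is es → phase (λ _ → false) now (now + (T - now)) is es ≡ []
    empty is       []       = refl
    empty []       (e ∷ es) = refl
    empty (i ∷ is) (e ∷ es) = empty (i ∷ is) es
  until-next n good bound (raise open-gap b∈ over drop) T t≤T =
    record { Stage (until n (raise-good good open-gap b∈ over) (ℕ.≤-trans drop (ℕ.≤-pred bound)) T t≤T) }
  until-next n {s} good bound (gap {χ} {δ} phase limit drop) T t≤T with (State.now s + δ) ≤? T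
  ... | yes t'≤T = record { Stage (until n (gap-good good phase limit) (ℕ.≤-trans (drop _) (ℕ.≤-pred bound)) T t'≤T) }
  ... | no  t'≰T = record
    { state = gap-next s χ (T - now)
    ; good  = gap-good good phase (shorter-gap good (GapPhase.open-gap phase) (diff-nonneg t≤T)
        (arith 3 (λ T t d → (T ⊑ t :+ d ∷ []) ⊢ T :- t ≼ d) refl (≰⇒≥ t'≰T)) limit)
    ; same-jobs = refl
    ; at = to-T now T
    ; agrees = truncated (run-next n good bound (gap phase limit drop))
        (run n (gap-good good phase limit) (ℕ.≤-trans (drop _) (ℕ.≤-pred bound))) t≤T (≰⇒≥ t'≰T) refl refl refl
    }
    where open State s
  until-next n {s} good bound (block {χ} {δ} phase limit drop) T t≤T with (State.now s + δ) ≤? T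
  ... | yes t'≤T = record { Stage (until n (block-good good phase limit) (ℕ.≤-trans (drop _) (ℕ.≤-pred bound)) T t'≤T) }
  ... | no  t'≰T = record
    { state = block-next s χ (T - now)
    ; good  = block-good good phase (shorter-block good (diff-nonneg t≤T)
        (arith 3 (λ T t d → (T ⊑ t :+ d ∷ []) ⊢ T :- t ≼ d) refl (≰⇒≥ t'≰T)) limit)
    ; same-jobs = refl
    ; at = to-T now T
    ; agrees = truncated (run-next n good bound (block phase limit drop))
        (run n (block-good good phase limit) (ℕ.≤-trans (drop _) (ℕ.≤-pred bound))) t≤T (≰⇒≥ t'≰T) refl refl refl
    }
    where open State s

module Online (ℛ : Reals) (m : ℕ) (1≤m : 1 ℕ.≤ m) (ε : Reals.ℝ ℛ)
               (0<ε : Reals._<_ ℛ (Reals.0# ℛ) ε)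
               (ε≤1 : Reals._≤_ ℛ ε (Reals.1# ℛ)) where
  open OrderedField ℛ
  open Volumes ℛ
  open Parameters ℛ m 1≤m ε 0<ε ε≤1
  open Scheduling ℛ using (Job; release; time; deadline; ValidJob; Schedule; AgreeBefore)
  open States ℛ m 1≤m ε 0<ε ε≤1
  open Raises ℛ m 1≤m ε 0<ε ε≤1
  open Competition ℛ m 1≤m ε 0<ε ε≤1
  open Newcomers ℛ m 1≤m ε 0<ε ε≤1
  open Plans ℛ m
  open Steps ℛ m 1≤m ε 0<ε ε≤1
  open Execution ℛ m 1≤m ε 0<ε ε≤1

  start-state : State
  start-state = record
    { now = 0# ; threshold = 0# ; used = 0# ; tasks = [] ; work = λ _ → 0# ; idle = λ _ → 0# ; segs = [] }

  start-good : Good start-state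
  start-good = record
    { sound = record
      { now≤threshold = ≤-refl
      ; 0≤used        = ≤-refl
      ; distinct      = []
      ; fresh         = λ ()
      ; fresh-work    = λ _ _ → refl
      ; fresh-idle    = λ _ _ → refl
      ; 0≤work        = λ _ → ≤-refl
      ; 0≤rem         = λ ()
      ; rel≤now       = λ ()
      ; far-volume    = λ {D} 0≤D → +-nonneg ≤-refl (*-nonNegative 0≤c (diff-nonneg 0≤D))
      ; near-volume   = λ {k} k≤m 0≤D D≤0 → +-nonneg (*-nonNegative (natural-nonneg k) (diff-nonneg 0≤D))
                          (*-nonNegative (0≤σ k≤m) (diff-nonneg ≤-refl))
      ; far-task      = λ ()
      ; account       = arith 1 (λ c → [] ⊢ c :* # 0 :+ # 0 ≈ # 0 :+ # 0) refl
      }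
    ; planned  = record { fits = λ () ; past = λ () ; apart = [] ; exact = λ () }
    ; rivalled = λ O opponent _ → (λ _ → 0#) , record
      { knows   = λ ()
      ; within  = λ ()
      ; 0≤o     = λ _ → ≤-refl
      ; o≤O     = λ k → Opponent.nonneg opponent k 0#
      ; bulk    = ≤-reflexive (arith 1 (λ M → [] ⊢ # 0 ≈ M :* (# 0 :- (# 0 :- # 0)) :+ # 0) refl)
      ; balance = λ _ _ → ≤-reflexive (sym (zeroʳ _))
      }
    }

  outcome : ∀ {s} → Good s → Outcome s
  outcome {s} good = run (suc (measure s)) good ℕ.≤-refl

  module Decision {s : State} (good : Good s) {j : Job} (valid : ValidJob ε j) (on-time : State.now s ≤ release j) where
    open ValidJob valid using (time>0) renaming (slack to slack-j)
    open Stage (until (suc (measure s)) good ℕ.≤-refl (release j) on-time) renaming (state to s₁; good to good₁)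
    open Good good₁

    Worthwhile : Set
    Worthwhile = State.threshold s₁ ≤ deadline j

    worthwhile? : Dec Worthwhile
    worthwhile? = State.threshold s₁ ≤? deadline j

    new : ℝ → Task
    new = task (length (State.tasks s₁)) (release j) (deadline j)

    private
      unseen : ∀ p {e} → e ∈ State.tasks s₁ → id e ≢ id (new p)
      unseen p e∈ eq = ℕ.<-irrefl eq (Sound.fresh sound e∈)

    arrived : Dec Worthwhile → Σ State Good
    arrived (yes h≤d) = Accept.accept time>0 slack-n h≤d , record
      { sound    = Accept.accept-sound time>0 slack-n h≤d
      ; planned  = planned-arrival planned n (unseen (time j)) no-work
      ; rivalled = λ O opponent faces → let o , rival = rivalled O opponent (faces ∘ there) in
          o , accept-rival sound opponent rival n refl (sym at) (Faces.aware (faces (here refl)))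
                time>0 slack-n h≤d (Faces.limited (faces (here refl)) time>0)
      }
      where
      n : Task
      n = new (time j)
      open Arrival sound n refl (sym at)
      slack-n : (1# + ε) * time j ≤ deadline j - State.now s₁
      slack-n = subst (λ t → (1# + ε) * time j ≤ deadline j - t) (sym at) slack-j
    arrived (no h≰d) = reject , record
      { sound    = reject-sound refl (≰⇒> h≰d)
      ; planned  = planned-arrival planned n (unseen 0#) no-work
      ; rivalled = λ O opponent faces → let o , rival = rivalled O opponent (faces ∘ there) in
          o , reject-rival sound opponent rival n refl (sym at) (Faces.aware (faces (here refl))) (≰⇒> h≰d)
      }
      where
      n : Task
      n = new 0#
      open Arrival sound n refl (sym at)

    arrived-tasks : ∀ d → State.tasks (proj₁ (arrived d))
      ≡ task (length (State.tasks s)) (release j) (deadline j) (if does d then time j else 0#) ∷ State.tasks s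
    arrived-tasks d = trans (tasks≡ d)
      (cong (λ es → task (length es) (release j) (deadline j) (if does d then time j else 0#) ∷ es) same-jobs)
      where
      tasks≡ : ∀ d → State.tasks (proj₁ (arrived d)) ≡ new (if does d then time j else 0#) ∷ State.tasks s₁
      tasks≡ (yes _) = refl
      tasks≡ (no _)  = refl

    arrived-now : ∀ d → State.now (proj₁ (arrived d)) ≡ release j
    arrived-now (yes _) = at
    arrived-now (no _)  = at

    arrived-agrees : ∀ d → AgreeBefore (release j) (State.segs (Outcome.final (outcome good)))
                                       (State.segs (Outcome.final (outcome (proj₂ (arrived d)))))
    arrived-agrees d = agree-trans {σ = segs (final (outcome good))} {segs s₁} {segs (final afterwards)} agrees
      (subst₂ (AgreeBefore (release j)) (kept d) (sym extends)
        (agree-flip (segs (proj₁ (arrived d))) (later ++ segs (proj₁ (arrived d)))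
          (agree-extend later (segs (proj₁ (arrived d))) λ g∈ → ≤-trans (≤-reflexive (sym (arrived-now d))) (starts g∈))))
      where
      open State using (segs)
      open Outcome using (final)
      afterwards : Outcome (proj₁ (arrived d))
      afterwards = outcome (proj₂ (arrived d))
      open Outcome afterwards using (later; extends; starts)
      kept : ∀ d → segs (proj₁ (arrived d)) ≡ segs s₁
      kept (yes _) = refl
      kept (no _)  = refl
      agree-flip : ∀ {t} (σ τ : Schedule m) → AgreeBefore t τ σ → AgreeBefore t σ τ
      agree-flip σ τ f i x k x<t = mk⇔ (Equivalence.from (f i x k x<t)) (Equivalence.to (f i x k x<t))

  valid? : ∀ j → Dec (ValidJob ε j)
  valid? j = map′ (λ { (a , b , c) → record { release≥0 = a ; time>0 = b ; slack = c } })
    (λ v → ValidJob.release≥0 v , ValidJob.time>0 v , ValidJob.slack v)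
    ((0# ≤? release j) ×-dec (0# <? time j) ×-dec ((1# + ε) * time j ≤? deadline j - release j))

  -- nothing stands for the state after an inadmissible sequence of jobs.
  Entry : Set
  Entry = Maybe (Σ State Good)

  Admitted : Entry → Job → Set
  Admitted nothing        j = ⊥
  Admitted (just (s , _)) j = ValidJob ε j × State.now s ≤ release j

  admitted? : ∀ x j → Dec (Admitted x j)
  admitted? nothing        j = no λ ()
  admitted? (just (s , _)) j = valid? j ×-dec (State.now s ≤? release j)

  step-by : ∀ x j → Dec (Admitted x j) → Entry
  step-by x                 j (no _)          = nothing
  step-by (just (s , good)) j (yes (v , t≤r)) = just (arrived worthwhile?)
    where open Decision good v t≤r

  verdict-by : ∀ x j → Dec (Admitted x j) → Bool
  verdict-by x                 j (no _)          = false
  verdict-by (just (s , good)) j (yes (v , t≤r)) = does worthwhile?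
    where open Decision good v t≤r

  step : Entry → Job → Entry
  step x j = step-by x j (admitted? x j)

  verdict : Entry → Job → Bool
  verdict x j = verdict-by x j (admitted? x j)

  after : List Job → Entry
  after = foldl step (just (start-state , start-good))

  accept-job : List Job → Job → Bool
  accept-job past j = verdict (after past) j

  plan-of : Entry → Schedule m
  plan-of nothing           = []
  plan-of (just (s , good)) = State.segs (Outcome.final (outcome good))

  record Stepped {s : State} (good : Good s) (j : Job) (d : Dec (Admitted (just (s , good)) j)) : Set where
    field
      state    : State
      is-good  : Good state
      steps    : step-by (just (s , good)) j d ≡ just (state , is-good)
      tasks≡   : State.tasks state ≡ task (length (State.tasks s)) (release j) (deadline j)
                   (if verdict-by (just (s , good)) j d then time j else 0#) ∷ State.tasks s
      now≡     : State.now state ≡ release j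
      agree    : AgreeBefore (release j) (plan-of (just (s , good))) (plan-of (just (state , is-good)))

  stepped : ∀ {s} (good : Good s) {j} → ValidJob ε j → State.now s ≤ release j → ∀ d → Stepped good j d
  stepped good v t≤r (no out)          = contradiction (v , t≤r) out
  stepped good _ _   (yes (v , t≤r)) = record
    { state = _ ; is-good = proj₂ (arrived worthwhile?) ; steps = refl ; tasks≡ = arrived-tasks worthwhile?
    ; now≡ = arrived-now worthwhile? ; agree = arrived-agrees worthwhile? }
    where open Decision good v t≤r

  -- The tasks that result from the jobs in rest, which follow those in past.
  entry : (past rest : List Job) → Fin (length rest) → Task
  entry past rest k = task (length past ℕ.+ toℕ k) (release j) (deadline j)
      (if accept-job (past ++ take (toℕ k) rest) j then time j else 0#)
    where
    j : Job
    j = lookup rest k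

  entry-shift : ∀ past j rest k → entry (past ∷ʳ j) rest k ≡ entry past (j ∷ rest) (Fin.suc k)
  entry-shift past j rest k = cong₂ (λ n J → task n (release i) (deadline i) (if accept-job J i then time i else 0#))
    (trans (cong (ℕ._+ toℕ k) (trans (length-++ past) (ℕ.+-comm (length past) 1))) (sym (ℕ.+-suc (length past) (toℕ k))))
    (++-assoc past (j ∷ []) (take (toℕ k) rest))
    where
    i : Job
    i = lookup rest k

  scan : ∀ past {s} {good : Good s} → after past ≡ just (s , good) → length (State.tasks s) ≡ length past →
    ∀ rest → All (ValidJob ε) rest → AllPairs (λ i j → release i ≤ release j) rest →
    All (λ j → State.now s ≤ release j) rest →
    Σ[ s' ∈ State ] Σ[ good' ∈ Good s' ] after (past ++ rest) ≡ just (s' , good') ×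
      State.tasks s' ≡ tabulate (entry past rest) ʳ++ State.tasks s
  scan past {s} {good} eq len [] _ _ _ = s , good , trans (cong after (++-identityʳ past)) eq , refl
  scan past {s} {good} eq len (j ∷ rest) (v ∷ valid) (first ∷ ordered) (t≤r ∷ _)
    with stepped good v t≤r (admitted? (just (s , good)) j)
  ... | st with scan (past ∷ʳ j) {Stepped.state st} {Stepped.is-good st}
                  (trans (foldl-∷ʳ step _ j past) (trans (cong (λ x → step x j) eq) (Stepped.steps st)))
                  (trans (cong length (Stepped.tasks≡ st)) (trans (cong suc len)
                    (sym (trans (length-++ past) (ℕ.+-comm (length past) 1)))))
                  rest valid ordered (All.map (subst (_≤ _) (sym (Stepped.now≡ st))) first)
  ...   | s' , good' , eq' , tasks' = s' , good' , trans (cong after (sym (++-assoc past (j ∷ []) rest))) eq'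
    , trans tasks' (cong₂ _ʳ++_ (tabulate-cong (entry-shift past j rest))
        (trans (Stepped.tasks≡ st) (cong (_∷ State.tasks s) head≡)))
    where
    head≡ : task (length (State.tasks s)) (release j) (deadline j)
              (if verdict (just (s , good)) j then time j else 0#) ≡ entry past (j ∷ rest) Fin.zero
    head≡ = cong₂ (λ n b → task n (release j) (deadline j) (if b then time j else 0#))
      (trans len (sym (ℕ.+-identityʳ _)))
      (trans (cong (λ x → verdict x j) (sym eq)) (cong (λ J → accept-job J j) (sym (++-identityʳ past))))

module Offline (ℛ : Reals) (m : ℕ) where
  open OrderedField ℛ
  open Summation ℛ
  open Volumes ℛ
  open Plans ℛ m
  open Scheduling ℛ using (Segment; Schedule; machine; job; start; end; Disjoint; NoConflict; processed)

  private
    reals : Poset _ _ _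
    reals = DecTotalOrder.poset (record { isDecTotalOrder = isDecTotalOrder })

  -- The part of the segment g that precedes t.
  done : Segment m → ℝ → ℝ
  done g t = ((t ⊔ start g) ⊓ end g) - start g

  module _ (g : Segment m) (s≤e : start g ≤ end g) where

    done-early : ∀ {t} → t ≤ start g → done g t ≡ 0#
    done-early {t} t≤s = trans (cong (_- start g) (≤-antisym (≤-trans (x⊓y≤x _ _) (⊔-lub t≤s ≤-refl)) (⊓-glb (y≤x⊔y _ _) s≤e)))
      (-‿inverseʳ _)

    done-late : ∀ {t} → end g ≤ t → done g t ≡ end g - start g
    done-late {t} e≤t = cong (_- start g) (≤-antisym (x⊓y≤y _ _) (⊓-glb (≤-trans e≤t (x≤x⊔y _ _)) ≤-refl))

    0≤done : ∀ t → 0# ≤ done g t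
    0≤done t = diff-nonneg (⊓-glb (y≤x⊔y _ _) s≤e)

    done-mono : ∀ {x y} → x ≤ y → done g x ≤ done g y
    done-mono x≤y = +-monoˡ-≤ (- start g) (⊓-glb (≤-trans (x⊓y≤x _ _)
      (⊔-lub (≤-trans x≤y (x≤x⊔y _ _)) (y≤x⊔y _ _))) (x⊓y≤y _ _))

    done≤ : ∀ t → done g t ≤ end g - start g
    done≤ t = +-monoˡ-≤ (- start g) (x⊓y≤y _ _)

    done-lipschitz : ∀ {x y} → x ≤ y → done g y - done g x ≤ y - x
    done-lipschitz {x} {y} x≤y with ⊓-case (x ⊔ start g) (end g)
    ... | inj₁ eq = arith 5 (λ x y s c d → (d ⊑ y :- x :+ c ∷ []) ⊢ (d :- s) :- (c :- s) ≼ y :- x) refl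
      (≤-trans (x⊓y≤x _ _) (⊔-lub
        (subst (λ c → y ≤ y - x + c) (sym eq) (≤-trans (≤-reflexive (arith 2 (λ x y → [] ⊢ y ≈ y :- x :+ x) refl))
          (subst₂ _≤_ (+-comm _ _) (+-comm _ _) (+-monoˡ-≤ (y - x) (x≤x⊔y x (start g))))))
        (subst (λ c → start g ≤ y - x + c) (sym eq) (arith 4 (λ x y s c → (x ⊑ y ∷ s ⊑ c ∷ []) ⊢ s ≼ y :- x :+ c) refl
          x≤y (y≤x⊔y x (start g))))))
    ... | inj₂ eq = subst (λ c → done g y - (c - start g) ≤ y - x) (sym eq)
      (arith 5 (λ x y s e d → (x ⊑ y ∷ d :- s ⊑ e :- s ∷ []) ⊢ (d :- s) :- (e :- s) ≼ y :- x) refl x≤y (done≤ y))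

    module _ {x y : ℝ} (x≤y : x ≤ y) where

      from to : ℝ
      from = x ⊔ (start g ⊓ y)
      to   = y ⊓ (end g ⊔ x)

      x≤from : x ≤ from
      x≤from = x≤x⊔y _ _

      to≤y : to ≤ y
      to≤y = x⊓y≤x _ _

      from≤to : from ≤ to
      from≤to = ⊔-lub (⊓-glb x≤y (y≤x⊔y _ _))
        (⊓-glb (x⊓y≤y _ _) (≤-trans (x⊓y≤x _ _) (≤-trans s≤e (x≤x⊔y _ _))))

      done-inside : done g y - done g x ≤ to - from
      done-inside = arith 6 (λ dx df dt dy f t → (df ⊑ dx ∷ dy ⊑ dt ∷ dt :- df ⊑ t :- f ∷ []) ⊢ dy :- dx ≼ t :- f) refl
        before after (done-lipschitz from≤to)
        where
        before : done g from ≤ done g x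
        before with total x (start g ⊓ y)
        ... | inj₁ x≤ = ≤-trans (≤-reflexive (done-early (⊔-lub (≤-trans x≤ (x⊓y≤x _ _)) (x⊓y≤x _ _)))) (0≤done x)
        ... | inj₂ ≤x = done-mono (⊔-lub ≤-refl ≤x)
        after : done g y ≤ done g to
        after with total y (end g ⊔ x)
        ... | inj₁ y≤ = done-mono (⊓-glb ≤-refl y≤)
        ... | inj₂ ≤y = ≤-trans (done≤ y) (≤-reflexive (sym (done-late (⊓-glb (≤-trans (x≤x⊔y _ _) ≤y) (x≤x⊔y _ _)))))

  done-outside : ∀ g g' (s≤e : start g ≤ end g) → start g' ≤ end g' → ∀ {x y} (x≤y : x ≤ y) → Disjoint g g' →
                 done g' (to g s≤e x≤y) ≤ done g' (from g s≤e x≤y)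
  done-outside g g' s≤e s'≤e' {x} {y} x≤y (inj₁ e≤s') with total x (end g)
  ... | inj₁ x≤e = ≤-trans (≤-reflexive (done-early g' s'≤e' (≤-trans (x⊓y≤y _ _) (≤-trans (⊔-lub ≤-refl x≤e) e≤s'))))
    (0≤done g' s'≤e' _)
  ... | inj₂ e≤x = done-mono g' s'≤e' (≤-trans (x⊓y≤y _ _) (≤-trans (⊔-lub e≤x ≤-refl) (x≤from g s≤e x≤y)))
  done-outside g g' s≤e s'≤e' {x} {y} x≤y (inj₂ e'≤s) with total (start g) y
  ... | inj₁ s≤y = ≤-trans (done≤ g' s'≤e' _) (≤-reflexive (sym (done-late g' s'≤e'
    (≤-trans e'≤s (≤-trans (⊓-glb ≤-refl s≤y) (y≤x⊔y _ _))))))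
  ... | inj₂ y≤s = done-mono g' s'≤e' (≤-trans (to≤y g s≤e x≤y) (≤-trans (⊓-glb y≤s ≤-refl) (y≤x⊔y _ _)))

  packing : ∀ (σ : Schedule m) (p : Segment m → Bool) → (∀ {g} → g ∈ σ → start g ≤ end g) →
    AllPairs (λ g g' → p g ≡ true → p g' ≡ true → Disjoint g g') σ →
    ∀ {x y} → x ≤ y → ∑ σ (λ g → [ p g ] * (done g y - done g x)) ≤ y - x
  packing []      p ok _ x≤y = diff-nonneg x≤y
  packing (g ∷ σ) p ok (g# ∷ apart) {x} {y} x≤y with true-or-false (p g)
  ... | inj₂ ¬pg = subst (λ b → [ b ] * (done g y - done g x) + ∑ σ (λ g → [ p g ] * (done g y - done g x)) ≤ y - x) (sym ¬pg)
    (arith 3 (λ r s z → (s ⊑ z ∷ []) ⊢ # 0 :* r :+ s ≼ z) refl (packing σ p (ok ∘ there) apart x≤y))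
  ... | inj₁ pg = subst (λ b → [ b ] * (done g y - done g x) + rest x y ≤ y - x) (sym pg)
    (subst (λ z → 1# * (done g y - done g x) + z ≤ y - x) (sym split)
      (arith 8 (λ r t f x y a b c → (r ⊑ t :- f ∷ a ⊑ f :- x ∷ b ⊑ # 0 ∷ c ⊑ y :- t ∷ []) ⊢ # 1 :* r :+ (a :+ b :+ c) ≼ y :- x) refl
        (done-inside g s≤e x≤y)
        (packing σ p (ok ∘ there) apart (x≤from g s≤e x≤y))
        (∑-nonpos σ middle)
        (packing σ p (ok ∘ there) apart (to≤y g s≤e x≤y))))
    where
    s≤e : start g ≤ end g
    s≤e = ok (here refl)
    f t : ℝ
    f = from g s≤e x≤y
    t = to g s≤e x≤y
    rest : ℝ → ℝ → ℝ
    rest x y = ∑ σ (λ g → [ p g ] * (done g y - done g x))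
    split : rest x y ≡ rest x f + rest f t + rest t y
    split = trans (∑-cong σ (λ {g'} _ → arith 5 (λ b x f t y → [] ⊢ b :* (y :- x) ≈ b :* (f :- x) :+ b :* (t :- f) :+ b :* (y :- t)) refl))
      (trans (∑-+ σ _ _) (cong (_+ rest t y) (∑-+ σ _ _)))
    middle : ∀ {g'} → g' ∈ σ → [ p g' ] * (done g' t - done g' f) ≤ 0#
    middle {g'} g'∈ with true-or-false (p g')
    ... | inj₂ ¬pg' = subst (λ b → [ b ] * (done g' t - done g' f) ≤ 0#) (sym ¬pg') (≤-reflexive (zeroˡ _))
    ... | inj₁ pg'  = subst (λ b → [ b ] * (done g' t - done g' f) ≤ 0#) (sym pg')
      (arith 2 (λ a b → (a ⊑ b ∷ []) ⊢ # 1 :* (a :- b) ≼ # 0) refl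
        (done-outside g g' s≤e (ok (there g'∈)) x≤y (All.lookup g# g'∈ pg pg')))

  module _ (σ : Schedule m) (ok : ∀ {g} → g ∈ σ → start g ≤ end g) (apart : AllPairs NoConflict σ) where

    progress : ℕ → ℝ → ℝ
    progress k t = ∑ σ (λ g → [ does (job g ℕ.≟ k) ] * done g t)

    0≤progress : ∀ k t → 0# ≤ progress k t
    0≤progress k t = ∑-nonneg σ λ {g} g∈ → *-nonNegative (0≤[] (does (job g ℕ.≟ k))) (0≤done g (ok g∈) t)

    progress-mono : ∀ k {x y} → x ≤ y → progress k x ≤ progress k y
    progress-mono k x≤y = ∑-mono σ λ {g} g∈ → *-monoʳ-≤ _ (0≤[] (does (job g ℕ.≟ k))) (done-mono g (ok g∈) x≤y)

    progress-diff : ∀ k x y → progress k y - progress k x ≡ ∑ σ (λ g → [ does (job g ℕ.≟ k) ] * (done g y - done g x))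
    progress-diff k x y = trans (sym (∑-- σ _ _)) (∑-cong σ λ _ →
      arith 3 (λ b x y → [] ⊢ b :* y :- b :* x ≈ b :* (y :- x)) refl)

    progress-lipschitz : ∀ k {x y} → x ≤ y → progress k y ≤ progress k x + (y - x)
    progress-lipschitz k {x} {y} x≤y = arith 4 (λ px py x y → (py :- px ⊑ y :- x ∷ []) ⊢ py ≼ px :+ (y :- x)) refl
      (subst (_≤ y - x) (sym (progress-diff k x y)) (packing σ (λ g → does (job g ℕ.≟ k)) ok
        (AllPairs.map (λ {g} {g'} no-conflict p p' → no-conflict (inj₂
          (trans (does-true {d = job g ℕ.≟ k} p) (sym (does-true {d = job g' ℕ.≟ k} p'))))) apart) x≤y))

    at-most-once : ∀ es → AllPairs (λ e e' → id e ≢ id e') es → ∀ k → ∑ es (λ e → [ does (k ℕ.≟ id e) ]) ≤ 1#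
    at-most-once []       _         k = 0≤1
    at-most-once (e ∷ es) (e∉ ∷ d) k with holds-or-not (k ℕ.≟ id e)
    ... | inj₂ k≢ = subst (λ b → [ b ] + ∑ es (λ e → [ does (k ℕ.≟ id e) ]) ≤ 1#) (sym (false-does (k ℕ.≟ id e) k≢))
      (≤-trans (≤-reflexive (+-identityˡ _)) (at-most-once es d k))
    ... | inj₁ refl = subst (λ b → [ b ] + ∑ es (λ e → [ does (k ℕ.≟ id e) ]) ≤ 1#) (sym (true-does (k ℕ.≟ k) refl))
      (arith 2 (λ o s → (s ⊑ # 0 ∷ []) ⊢ o :+ s ≼ o) refl (∑-nonpos es λ {e'} e'∈ →
        subst (λ b → [ b ] ≤ 0#) (sym (false-does (k ℕ.≟ id e') (All.lookup e∉ e'∈))) ≤-refl))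

    progress-capacity : ∀ es → AllPairs (λ e e' → id e ≢ id e') es → ∀ {x y} → x ≤ y →
      ∑ es (λ e → progress (id e) y) ≤ ∑ es (λ e → progress (id e) x) + natural m * (y - x)
    progress-capacity es distinct {x} {y} x≤y = arith 3 (λ a b d → (a :- b ⊑ d ∷ []) ⊢ a ≼ b :+ d) refl (begin
        ∑ es (λ e → progress (id e) y) - ∑ es (λ e → progress (id e) x)
          ≡⟨ trans (sym (∑-- es _ _)) (trans (∑-cong es (λ {e} _ → progress-diff (id e) x y)) (∑-swap es σ _)) ⟩
        ∑ σ (λ g → ∑ es (λ e → [ does (job g ℕ.≟ id e) ] * Δ g))
          ≤⟨ ∑-mono σ (λ {g} g∈ → ≤-trans (≤-reflexive (∑-*ʳ es (Δ g) _)) (≤-trans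
               (*-monoˡ-≤ (Δ g) (diff-nonneg (done-mono g (ok g∈) x≤y)) (at-most-once es distinct (job g)))
               (*-monoˡ-≤ (Δ g) (diff-nonneg (done-mono g (ok g∈) x≤y)) (each-machine (machine g))))) ⟩
        ∑ σ (λ g → ∑ (allFin m) (λ i → [ does (machine g Fin.≟ i) ]) * Δ g)
          ≡⟨ trans (∑-cong σ (λ {g} _ → sym (∑-*ʳ (allFin m) (Δ g) _))) (∑-swap σ (allFin m) _) ⟩
        ∑ (allFin m) (λ i → ∑ σ (λ g → [ does (machine g Fin.≟ i) ] * Δ g))
          ≤⟨ ∑-mono (allFin m) (λ {i} _ → packing σ (λ g → does (machine g Fin.≟ i)) ok
               (AllPairs.map (λ {g} {g'} no-conflict p p' → no-conflict (inj₁
                 (trans (does-true {d = machine g Fin.≟ i} p) (sym (does-true {d = machine g' Fin.≟ i} p'))))) apart) x≤y) ⟩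
        ∑ (allFin m) (λ _ → y - x)
          ≡⟨ trans (∑-const (allFin m) (y - x)) (cong (λ n → natural n * (y - x)) (length-tabulate {n = m} (λ i → i))) ⟩
        natural m * (y - x) ∎)
      where
      open PartialOrderReasoning reals
      Δ : Segment m → ℝ
      Δ g = done g y - done g x
      each-machine : ∀ i → 1# ≤ ∑ (allFin m) (λ i' → [ does (i Fin.≟ i') ])
      each-machine i = subst (_≤ ∑ (allFin m) (λ i' → [ does (i Fin.≟ i') ])) (cong [_] (true-does (i Fin.≟ i) refl))
        (∑-member (allFin m) (∈-allFin i) (λ {i'} _ → 0≤[] (does (i Fin.≟ i'))))

    progress-before : ∀ {k t} → (∀ {g} → g ∈ σ → job g ≡ k → t ≤ start g) → progress k t ≡ 0#
    progress-before {k} {t} h = trans (∑-cong σ term) (∑-zero σ)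
      where
      term : ∀ {g} → g ∈ σ → [ does (job g ℕ.≟ k) ] * done g t ≡ 0#
      term {g} g∈ with holds-or-not (job g ℕ.≟ k)
      ... | inj₁ eq  = trans (cong ([ does (job g ℕ.≟ k) ] *_) (done-early g (ok g∈) (h g∈ eq))) (zeroʳ _)
      ... | inj₂ neq = trans (cong (λ b → [ b ] * done g t) (false-does (job g ℕ.≟ k) neq)) (zeroˡ _)

    progress≤processed : ∀ k t → progress k t ≤ processed σ k
    progress≤processed k t = subst (progress k t ≤_) (sym (total-processed σ)) (∑-mono σ λ {g} g∈ →
      *-monoʳ-≤ _ (0≤[] (does (job g ℕ.≟ k))) (done≤ g (ok g∈) t))
      where
      total-processed : ∀ σ → processed σ k ≡ ∑ σ (λ g → [ does (job g ℕ.≟ k) ] * (end g - start g))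
      total-processed []      = refl
      total-processed (g ∷ σ) = trans (processed-∷ g σ k) (cong ([ does (job g ℕ.≟ k) ] * (end g - start g) +_) (total-processed σ))

    progress-after : ∀ {k t} → (∀ {g} → g ∈ σ → job g ≡ k → end g ≤ t) → processed σ k ≤ progress k t
    progress-after {k} {t} h = go σ (λ g∈ → ok g∈ , h g∈)
      where
      go : ∀ σ → (∀ {g} → g ∈ σ → start g ≤ end g × (job g ≡ k → end g ≤ t)) →
           processed σ k ≤ ∑ σ (λ g → [ does (job g ℕ.≟ k) ] * done g t)
      go []      h = ≤-refl
      go (g ∷ σ) h = ≤-trans (≤-reflexive (processed-∷ g σ k)) (+-mono-≤ (term (holds-or-not (job g ℕ.≟ k))) (go σ (h ∘ there)))
        where
        term : job g ≡ k ⊎ ¬ job g ≡ k → [ does (job g ℕ.≟ k) ] * (end g - start g) ≤ [ does (job g ℕ.≟ k) ] * done g t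
        term (inj₁ eq)  = ≤-reflexive (cong ([ does (job g ℕ.≟ k) ] *_)
          (sym (done-late g (proj₁ (h (here refl))) (proj₂ (h (here refl)) eq))))
        term (inj₂ neq) = ≤-reflexive (trans (cong (λ b → [ b ] * (end g - start g)) (false-does (job g ℕ.≟ k) neq))
          (trans (zeroˡ _) (trans (sym (zeroˡ _)) (cong (λ b → [ b ] * done g t) (sym (false-does (job g ℕ.≟ k) neq))))))

module Analysis (ℛ : Reals) (m : ℕ) (1≤m : 1 ℕ.≤ m) (ε : Reals.ℝ ℛ)
               (0<ε : Reals._<_ ℛ (Reals.0# ℛ) ε)
               (ε≤1 : Reals._≤_ ℛ ε (Reals.1# ℛ)) where
  open OrderedField ℛ
  open Summation ℛ
  open Volumes ℛ
  open Parameters ℛ m 1≤m ε 0<ε ε≤1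
  open Weighting ℛ m 1≤m
  open Scheduling ℛ using
    ( Job; release; time; deadline; ValidJob; Admissible; Schedule; start; end; job; processed
    ; Schedules; SegmentFits; value; OPT; AgreeBefore; acceptedBy; OnlineAlgorithm; StrictCompetitiveRatio)
  open States ℛ m 1≤m ε 0<ε ε≤1
  open Competition ℛ m 1≤m ε 0<ε ε≤1
  open Plans ℛ m
  open Execution ℛ m 1≤m ε 0<ε ε≤1
  open Online ℛ m 1≤m ε 0<ε ε≤1
  open Offline ℛ m

  ∑-ʳ++ : ∀ (xs ys : List Task) h → ∑ (xs ʳ++ ys) h ≡ ∑ xs h + ∑ ys h
  ∑-ʳ++ []       ys h = sym (+-identityˡ _)
  ∑-ʳ++ (x ∷ xs) ys h = trans (∑-ʳ++ xs (x ∷ ys) h)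
    (arith 3 (λ a b c → [] ⊢ b :+ (a :+ c) ≈ (a :+ b) :+ c) refl)

  ∑-tabulate : ∀ {n} (e : Fin n → Task) h → ∑ (tabulate e) h ≡ sum (h ∘ e)
  ∑-tabulate {zero}  e h = refl
  ∑-tabulate {suc n} e h = cong (h (e Fin.zero) +_) (∑-tabulate (e ∘ Fin.suc) h)

  sum-mono : ∀ {n} {f g : Fin n → ℝ} → (∀ k → f k ≤ g k) → sum f ≤ sum g
  sum-mono {zero}  f≤g = ≤-refl
  sum-mono {suc n} f≤g = +-mono-≤ (f≤g Fin.zero) (sum-mono (f≤g ∘ Fin.suc))

  sum-cong : ∀ {n} {f g : Fin n → ℝ} → (∀ k → f k ≡ g k) → sum f ≡ sum g
  sum-cong f≡g = ≤-antisym (sum-mono (≤-reflexive ∘ f≡g)) (sum-mono (≤-reflexive ∘ sym ∘ f≡g))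

  accepts : (J : List Job) → Subset (length J)
  accepts = acceptedBy accept-job

  accepts-lookup : ∀ J k → Vec.lookup (accepts J) k ≡ accept-job (take (toℕ k) J) (lookup J k)
  accepts-lookup J = lookup∘tabulate _

  record Reached (J : List Job) : Set where
    field
      state  : State
      good   : Good state
      after≡ : after J ≡ just (state , good)
      tasks≡ : State.tasks state ≡ reverse (tabulate (entry [] J))

  reach : ∀ J → Admissible ε J → Reached J
  reach J admissible with scan [] {start-state} {start-good} refl refl J valid ordered (All.map ValidJob.release≥0 valid)
    where open Admissible admissible
  ... | s , good , eq , tasks≡ = record { state = s ; good = good ; after≡ = eq ; tasks≡ = tasks≡ }

  module Completed (J : List Job) (valid : All (ValidJob ε) J) {s : State} (good : Good s)
                   (closed : State.threshold s ≡ State.now s)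
                   (over : ∀ {e} → e ∈ State.tasks s → dl e ≤ State.now s)
                   (listing : State.tasks s ≡ reverse (tabulate (entry [] J))) where
    open State s
    open Good good
    open Sound sound

    e-of : Fin (length J) → Task
    e-of = entry [] J

    ∑-tasks : ∀ h → ∑ tasks h ≡ sum (h ∘ e-of)
    ∑-tasks h = trans (cong (λ es → ∑ es h) listing) (trans (∑-ʳ++ (tabulate e-of) [] h)
      (trans (+-identityʳ _) (∑-tabulate e-of h)))

    e-of∈ : ∀ k → e-of k ∈ tasks
    e-of∈ k = subst (e-of k ∈_) (sym listing) (Any.reverse⁺ (∈-tabulate⁺ k))

    ∈-inv : ∀ {e} → e ∈ tasks → ∃[ k ] e ≡ e-of k
    ∈-inv e∈ = ∈-tabulate⁻ (Any.reverse⁻ (subst (_ ∈_) listing e∈))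

    nothing-left : ∀ {e} → e ∈ tasks → rem e ≡ 0#
    nothing-left e∈ with pending-or-done e∈
    ... | inj₁ r = contradiction (over e∈) (<⇒≱ (now<dl e∈ r))
    ... | inj₂ z = z

    worked : ∀ {e} → e ∈ tasks → work (id e) ≡ size e
    worked e∈ = arith 2 (λ p w → (# 0 ≐ p :- w ∷ []) ⊢ w ≈ p) refl (sym (nothing-left e∈))

    size-accepted : ∀ k → Vec.lookup (accepts J) k ≡ true → size (e-of k) ≡ time (lookup J k)
    size-accepted k yes' = cong (λ b → if b then time (lookup J k) else 0#) (trans (sym (accepts-lookup J k)) yes')

    accepted-size : ∀ k → 0# < size (e-of k) → Vec.lookup (accepts J) k ≡ true
    accepted-size k 0<p = trans (accepts-lookup J k) (positive (accept-job (take (toℕ k) J) (lookup J k)) 0<p)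
      where
      positive : ∀ b → 0# < (if b then time (lookup J k) else 0#) → b ≡ true
      positive true  _ = refl
      positive false l = contradiction ≤-refl (<⇒≱ l)

    feasible : Schedules J (accepts J) segs
    feasible = record
      { fits        = All.tabulate (fit ∘ Planned.fits planned)
      ; no-conflict = Planned.apart planned
      ; complete    = λ k k∈ → trans (Planned.exact planned (e-of∈ k))
                        (trans (worked (e-of∈ k)) (size-accepted k ([]=⇒lookup k∈)))
      }
      where
      fit : ∀ {g} → Fits tasks g → SegmentFits J (accepts J) g
      fit fits with ∈-inv (Fits.member fits)
      ... | k , refl = record
        { index           = k
        ; index-job       = Fits.own fits
        ; selected        = lookup⇒[]= k (accepts J) (accepted-size k (Fits.substantial fits))
        ; after-release   = Fits.after-rel fits
        ; start≤end       = Fits.forward fits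
        ; before-deadline = Fits.before-dl fits
        }

    ALG≡ : value J (accepts J) ≡ ∑ tasks size
    ALG≡ = sym (trans (∑-tasks size) (sum-cong λ k →
      cong (λ b → if b then time (lookup J k) else 0#) (sym (accepts-lookup J k))))

    module _ {S : Subset (length J)} {τ : Schedule m} (schedules : Schedules J S τ) where
      open Schedules schedules

      private
        fit : ∀ {g} → g ∈ τ → SegmentFits J S g
        fit = All.lookup fits

        forward : ∀ {g} → g ∈ τ → start g ≤ end g
        forward = SegmentFits.start≤end ∘ fit

        O : ℕ → ℝ → ℝ
        O = progress τ forward no-conflict

        opponent : Opponent O
        opponent = record
          { nonneg    = 0≤progress τ forward no-conflict
          ; mono      = progress-mono τ forward no-conflict
          ; lipschitz = progress-lipschitz τ forward no-conflict
          ; capacity  = progress-capacity τ forward no-conflict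
          }

        within-window : ∀ k {g} → g ∈ τ → job g ≡ toℕ k →
                        release (lookup J k) ≤ start g × end g ≤ deadline (lookup J k) × k ∈ₛ S
        within-window k g∈ eq with fit g∈
        ... | fits with Fin.toℕ-injective (trans (SegmentFits.index-job fits) eq)
        ...   | refl = SegmentFits.after-release fits , SegmentFits.before-deadline fits , SegmentFits.selected fits

        finished : ∀ k {t} → deadline (lookup J k) ≤ t → processed τ (toℕ k) ≤ O (toℕ k) t
        finished k d≤t = progress-after τ forward no-conflict λ g∈ eq →
          ≤-trans (proj₁ (proj₂ (within-window k g∈ eq))) d≤t

        at-most : ∀ (k : Fin (length J)) t → O (toℕ k) t ≤ processed τ (toℕ k)
        at-most k t = progress≤processed τ forward no-conflict (toℕ k) t

        0≤time : ∀ k → 0# ≤ time (lookup J k)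
        0≤time k = <⇒≤ (ValidJob.time>0 (All.lookup valid (∈-lookup k)))

        processed≤time : ∀ k → processed τ (toℕ k) ≤ time (lookup J k)
        processed≤time k with Vec.lookup S k in eq
        ... | true  = ≤-reflexive (complete k (lookup⇒[]= k S eq))
        ... | false = ≤-trans (≤-reflexive (absent τ λ g∈ own →
          contradiction (trans (sym eq) ([]=⇒lookup (proj₂ (proj₂ (within-window k g∈ own))))) λ ())) (0≤time k)

        faces : ∀ {e} → e ∈ tasks → Faces O e
        faces e∈ with ∈-inv e∈
        ... | k , refl = record
          { aware   = record
            { before = λ x≤r → progress-before τ forward no-conflict λ g∈ eq → ≤-trans x≤r (proj₁ (within-window k g∈ eq))
            ; after  = λ {x} {y} d≤x _ → ≤-trans (at-most k y) (finished k d≤x)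
            }
          ; limited = λ 0<p x → ≤-trans (≤-trans (at-most k x) (processed≤time k))
                        (≤-reflexive (sym (size-accepted k (accepted-size k 0<p))))
          }

        value≤O : value J S ≤ ∑ tasks (λ e → O (id e) now)
        value≤O = subst (value J S ≤_) (sym (∑-tasks (λ e → O (id e) now))) (sum-mono term)
          where
          term : ∀ k → (if Vec.lookup S k then time (lookup J k) else 0#) ≤ O (toℕ k) now
          term k with Vec.lookup S k in eq
          ... | true  = ≤-trans (≤-reflexive (sym (complete k (lookup⇒[]= k S eq)))) (finished k (over (e-of∈ k)))
          ... | false = 0≤progress τ forward no-conflict (toℕ k) now

      competitive : value J S ≤ R * value J (accepts J)
      competitive with rivalled O opponent faces
      ... | o , rival = subst (value J S ≤_) (cong (R *_) (sym ALG≡)) (≤-trans value≤O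
        (arith 8 (λ x M u o R c i w →
            (x ⊑ M :* u :+ o ∷ # 0 ⊑ (R :* c :- M) :* u ∷ o ⊑ R :* i ∷ R :* (c :* u :+ i) ≗ R :* w ∷ []) ⊢ x ≼ R :* w) refl
          bulk' (*-nonNegative (diff-nonneg M≤Rc) 0≤used) o≤Ri (cong (R *_) account')))
        where
        open Rival rival
        i : ℝ
        i = ∑ tasks (idle ∘ id)
        bulk' : ∑ tasks (λ e → O (id e) now) ≤ M * used + ∑ tasks (o ∘ id)
        bulk' = subst (λ u → ∑ tasks (λ e → O (id e) now) ≤ M * u + ∑ tasks (o ∘ id))
          (trans (cong (λ h → used - (h - now)) closed) (arith 2 (λ u t → [] ⊢ u :- (t :- t) ≈ u) refl)) bulk
        account' : c * used + i ≡ ∑ tasks size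
        account' = trans account (trans (cong₂ _+_ (∑-cong tasks worked) (trans (cong Vol closed) Vol-now)) (+-identityʳ _))
        all-due : ∀ {e} → e ∈ tasks → dl e ≤ threshold
        all-due e∈ = ≤-trans (over e∈) (≤-reflexive (sym closed))
        o-i≤κi : ∑ tasks (o ∘ id) - i ≤ κ * i
        o-i≤κi = subst (_≤ κ * i)
          (trans (∑-cong tasks λ {e} e∈ → trans (cong (_* (o (id e) - idle (id e)))
              (weight-one tasks (due threshold) (λ _ → false) {e} (inj₁ (due-yes {threshold} {e} (all-due e∈))))) (*-identityˡ _))
            (∑-- tasks _ _))
          (balance (λ _ → false) record
            { unexpired = λ _ () ; pending = λ _ () ; tight = λ e∈ h<d → contradiction (all-due e∈) (<⇒≱ h<d) })
        13o≤18i : natural 13 * ∑ tasks (o ∘ id) ≤ natural 18 * i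
        13o≤18i = arith 3 (λ o i k → (# 13 :* (o :- i) ⊑ # 13 :* (k :* i) ∷ # 13 :* k :* i ≗ # 5 :* i ∷ []) ⊢ # 13 :* o ≼ # 18 :* i) refl
          (*-monoʳ-≤ (natural 13) (natural-nonneg 13) o-i≤κi) (cong (_* i) 13κ)
        0≤i : 0# ≤ i
        0≤i = *-cancelˡ-≤ (natural 18) (0<natural 17) (≤-trans (≤-reflexive (zeroʳ _))
          (≤-trans (*-nonNegative (natural-nonneg 13) (∑-nonneg tasks λ {e} _ → 0≤o (id e))) 13o≤18i))
        o≤Ri : ∑ tasks (o ∘ id) ≤ R * i
        o≤Ri = *-cancelˡ-≤ (natural 13) (0<natural 12) (≤-trans 13o≤18i
          (≤-trans (*-monoˡ-≤ i 0≤i 18≤13R) (≤-reflexive (*-assoc _ _ _))))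

  prefix : ∀ J {j} → Admissible ε (J ∷ʳ j) → Admissible ε J
  prefix J admissible = record { valid = All.++⁻ˡ J valid ; ordered = front J ordered }
    where
    open Admissible admissible
    front : ∀ xs {ys} → AllPairs (λ i j → release i ≤ release j) (xs ++ ys) → AllPairs (λ i j → release i ≤ release j) xs
    front []       _             = []
    front (x ∷ xs) (first ∷ rest) = All.++⁻ˡ xs first ∷ front xs rest

  module Complete (J : List Job) (admissible : Admissible ε J) where
    open Reached (reach J admissible)
    open Outcome (outcome good) renaming (good to final-good)
    module Final = Completed J (Admissible.valid admissible) final-good closed over (trans same-jobs tasks≡)

    feasible : Schedules J (accepts J) (plan-of (after J))
    feasible = subst (Schedules J (accepts J)) (cong plan-of (sym after≡)) Final.feasible

  algorithm : OnlineAlgorithm m ε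
  algorithm = record
    { accept        = accept-job
    ; plan          = λ J → plan-of (after J)
    ; plan-feasible = Complete.feasible
    ; plan-online   = online
    }
    where
    online : ∀ J j → Admissible ε (J ∷ʳ j) → AgreeBefore (release j) (plan-of (after J)) (plan-of (after (J ∷ʳ j)))
    online J j admissible = subst₂ (λ x y → AgreeBefore (release j) (plan-of x) (plan-of y))
        (sym after≡) (sym (trans continued steps))
        agree
      where
      open Reached (reach J (prefix J admissible))
      continued : after (J ∷ʳ j) ≡ step (just (state , good)) j
      continued = trans (foldl-∷ʳ step _ j J) (cong (λ x → step x j) after≡)
      admitted : ∀ d {y} → step-by (just (state , good)) j d ≡ just y → Admitted (just (state , good)) j
      admitted (yes a) _ = a
      a : Admitted (just (state , good)) j
      a = admitted (admitted? (just (state , good)) j)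
        (trans (sym continued) (Reached.after≡ (reach (J ∷ʳ j) admissible)))
      open Stepped (stepped good (proj₁ a) (proj₂ a) (admitted? (just (state , good)) j)) using (steps; agree)

  ratio : StrictCompetitiveRatio algorithm (fromℕ m * (1# + ε) * (root m ((1# + ε) / ε) - 1#))
  ratio J admissible = subst (λ n → OPT m J ≤ n * (1# + ε) * (root m ((1# + ε) / ε) - 1#) * value J (accepts J))
    (natural≡fromℕ m)
    (sup-least _ (value J (accepts J) , accepts J , (plan-of (after J) , Complete.feasible J admissible) , refl) _
      λ { v (S , (τ , schedules) , refl) → Complete.Final.competitive J admissible schedules })

theorem2 : (ℛ : Reals) → let open Scheduling ℛ in
    (m : ℕ) → 1 ℕ.≤ m → (ε : ℝ) → 0# < ε → ε ≤ 1# →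
    Σ[ A ∈ OnlineAlgorithm m ε ]
    StrictCompetitiveRatio A
    (fromℕ m * (1# + ε) * (root m ((1# + ε) / ε) - 1#))
theorem2 ℛ m 1≤m ε 0<ε ε≤1 = algorithm , ratio
  where open Analysis ℛ m 1≤m ε 0<ε ε≤1
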